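{- Let $q$ be even with $q \ge 2048$. Then $m'_2(3,q) < q^2 - 2q + 3\sqrt{q} + 2$.
   Context: A $k$-cap of the projective space $\mathrm{PG}(n,q)$, $n \ge 3$, is a set of $k$ points no three of which are collinear. A $k$-cap is complete if it is not contained in a $(k+1)$-cap. $m'_2(n,q)$ denotes the second largest value of $k$ for which there exists a complete $k$-cap in $\mathrm{PG}(n,q)$ (i.e. the largest size of a complete cap that is not of maximum size; for $q$ even, $q>2$, the maximum size of a cap in $\mathrm{PG}(3,q)$ is $q^2+1$). -}

module Defs where

open import Level using (Level; _⊔_)
open import Algebra.Bundles using (CommutativeRing)
open import Data.Nat using (ℕ)
open import Data.Fin using (Fin)
open import Data.List using (List; []; _∷_)
open import Data.List.Relation.Unary.All using (All)
open import Data.List.Relation.Unary.AllPairs using (AllPairs)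
open import Data.Product using (Σ; ∃; _×_)
open import Data.Unit.Polymorphic using (⊤)
open import Relation.Nullary using (¬_)
open import Relation.Binary.PropositionalEquality using (_≡_)

record IsField {c ℓ} (F : CommutativeRing c ℓ) : Set (c ⊔ ℓ) where
  open CommutativeRing F
  field
    0≉1     : ¬ (0# ≈ 1#)
    inverse : ∀ x → ¬ (x ≈ 0#) → ∃ λ y → x * y ≈ 1#

HasSize : ∀ {c ℓ} (F : CommutativeRing c ℓ) → ℕ → Set (c ⊔ ℓ)
HasSize F q = Σ (Fin q → Carrier) λ f →
                (∀ i j → f i ≈ f j → i ≡ j) × (∀ x → ∃ λ i → f i ≈ x)
  where open CommutativeRing F

-- Projective space PG(3,F): points are represented by nonzero vectors of F^4,
-- two vectors representing the same point iff they are proportional.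
module PG3 {c ℓ} (F : CommutativeRing c ℓ) where
  open CommutativeRing F

  Vec4 : Set c
  Vec4 = Fin 4 → Carrier

  _·_ : Carrier → Vec4 → Vec4
  (a · u) i = a * u i

  _⊕_ : Vec4 → Vec4 → Vec4
  (u ⊕ v) i = u i + v i

  IsZeroVec : Vec4 → Set ℓ
  IsZeroVec u = ∀ i → u i ≈ 0#

  NonzeroVec : Vec4 → Set ℓ
  NonzeroVec u = ¬ IsZeroVec u

  SamePoint : Vec4 → Vec4 → Set (c ⊔ ℓ)
  SamePoint u v = ∃ λ a → ∃ λ b →
    ¬ (a ≈ 0# × b ≈ 0#) × IsZeroVec ((a · u) ⊕ (b · v))

  Collinear : Vec4 → Vec4 → Vec4 → Set (c ⊔ ℓ)
  Collinear u v w = ∃ λ a → ∃ λ b → ∃ λ d →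
    ¬ (a ≈ 0# × b ≈ 0# × d ≈ 0#) × IsZeroVec (((a · u) ⊕ (b · v)) ⊕ (d · w))

  -- A cap: a list of points (nonzero vectors), pairwise distinct as projective
  -- points, no three of them collinear.  Its size is the length of the list.
  IsCap : List Vec4 → Set (c ⊔ ℓ)
  IsCap [] = ⊤
  IsCap (u ∷ K) = NonzeroVec u
                × All (λ v → ¬ SamePoint u v) K
                × AllPairs (λ v w → ¬ Collinear u v w) K
                × IsCap K

  IsCompleteCap : List Vec4 → Set (c ⊔ ℓ)
  IsCompleteCap K = IsCap K × (∀ v → ¬ IsCap (v ∷ K))

{-# OPTIONS --safe #-}
-- Let K be a complete k-cap with k ≠ q² + 1 and t = q² + q + 2 − k, the number of tangents at a
-- point of K; if the bound fails then t ≤ 3q − 3√q, hence t ≤ 3q − 136.  In a plane arc with d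
-- tangents at each point, q even, the tangents lie in an algebraic envelope of class d (Segre), so a
-- point on a secant of the arc lies on at most d of them.  By completeness every point N ∉ K is on a
-- secant; summing over the planes through it, N lies on at most t tangents of K.
--
-- Fix P ∈ K and let T be the set of the t tangents at P in the quotient plane PG(2,q), and let
-- δ(L) = |T ∩ L|.  Summing the bound over the points of a tangent v ∈ T gives
-- Σ_{L ∋ v} δ(L)(δ(L) − 1) ≥ q² + q.  Hence v is on a line with δ > q/3, and averaging over the
-- points of such a line forces δ ≥ q − 13.  There is no room for three such lines, so T is empty,
-- a line, or a union of two lines minus at most one point.  A line means k = q² + 1.  In the other
-- cases the number of planes through P meeting K in q + 1, or in q + 2, points is the same explicit
-- number for every P ∈ K, and double counting makes q + 1 or q + 2 divide a small integer.
module Submission where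

open import Defs
open import Algebra.Bundles using (CommutativeRing; CommutativeSemiring; RawRing)
import Algebra.Properties.Ring
import Algebra.Solver.Ring
open import Algebra.Solver.Ring.AlmostCommutativeRing using (fromCommutativeSemiring; _-Raw-AlmostCommutative⟶_)
open import Algebra.Structures using (IsCommutativeSemiring)
open import Data.Bool using (Bool; true; false; _xor_; _∧_)
open import Data.Empty using (⊥; ⊥-elim)
open import Data.Fin as Fin using (Fin)
import Data.Fin.Properties as Finₚ
open import Data.List using (List; []; _∷_; _++_; map; length; filter; take; cartesianProductWith; allFin)
import Data.List.Membership.DecPropositional as DecMem
open import Data.List.Membership.Propositional using (_∈_; _∉_)
open import Data.List.Membership.Propositional.Properties using (∈-∃++; ∈-filter⁻; ∈-filter⁺; ∈-++⁺ˡ; ∈-++⁺ʳ; ∈-map⁺; ∈-map⁻; ∈-cartesianProductWith⁺; ∈-allFin)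
open import Data.List.Properties using (length-++; length-map; length-take; length-tabulate)
import Data.List.Relation.Binary.Permutation.Propositional as Perm
open import Data.List.Relation.Binary.Permutation.Propositional.Properties using (shift; ∈-resp-↭; All-resp-↭; ↭-length)
open import Data.List.Relation.Unary.All as All using (All; []; _∷_)
open import Data.List.Relation.Unary.AllPairs using (AllPairs; []; _∷_)
open import Data.List.Relation.Unary.Any using (here; there)
open import Data.List.Relation.Unary.Unique.Propositional using (Unique)
import Data.List.Relation.Unary.Unique.Propositional.Properties as Uₚ
open import Data.Maybe using (Maybe; just; nothing)
import Data.Maybe.Properties as Maybeₚ
open import Data.Nat as ℕ using (ℕ; zero; suc; s≤s; z≤n; _≤_) renaming (_+_ to _+ⁿ_; _*_ to _*ⁿ_)
open import Data.Nat.Divisibility using (_∣_; divides; ∣⇒≤; ∣m+n∣m⇒∣n; m∣m*n)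
import Data.Nat.Properties as ℕₚ
open import Data.Nat.Tactic.RingSolver using (solve-∀)
open import Data.Product using (∃; ∃₂; _×_; _,_; proj₁; proj₂)
open import Data.Product.Properties using (≡-dec)
open import Data.Sum using (_⊎_; inj₁; inj₂)
open import Function using (_∘_)
open import Level using (Level; 0ℓ)
open import Relation.Binary.Definitions using (tri<; tri≈; tri>)
open import Relation.Binary.PropositionalEquality as ≡ using (_≡_; _≢_; module ≡-Reasoning)
open import Relation.Nullary using (¬_; Dec; yes; no; ¬?; _×-dec_)
open import Relation.Unary using (Pred; Decidable)

-- The envelope itself is never constructed. Only one consequence is proved: a point on a secant of
-- a plane arc lies on at most d tangents. If d + 1 tangents passed through it, their points of
-- contact would index a square matrix whose rows are the terms of divided differences of tangent
-- polynomials. Putting the chosen point at infinity removes one tangent from each of these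
-- polynomials, so they have degree d - 1, and over d + 1 nodes every row sums to 0. Segre's lemma
-- of tangents makes the matrix symmetric, so in characteristic 2 the sum of all entries is the
-- trace. The trace is the leading coefficient of the monic tangent polynomial, of degree d, of a
-- point of the secant, and 0 = 1 results. The number 136 comes from q ≥ 2048: since 135² < 9 ·
-- 2048, a failure of the bound leaves an excess of at least 136, which later has to absorb the
-- errors of size 13 on three lines.

module Counting where

  -- Sums over lists and counting with indicators.

  open import Data.Nat
  open import Data.Nat.Properties
  open ≡ using (refl; sym; trans; cong; cong₂; subst)

  private
    variable
      a b p r : Level
      A : Set a
      B : Set b
      P : Set p
      R : Set r

  𝟙 : Dec P → ℕ
  𝟙 (yes _) = 1
  𝟙 (no _)  = 0

  𝟙-yes : (d : Dec P) → P → 𝟙 d ≡ 1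
  𝟙-yes (yes _) _  = refl
  𝟙-yes (no ¬p) pf = ⊥-elim (¬p pf)

  𝟙-no : (d : Dec P) → ¬ P → 𝟙 d ≡ 0
  𝟙-no (yes pf) ¬p = ⊥-elim (¬p pf)
  𝟙-no (no _)  _   = refl

  𝟙≢0 : (d : Dec P) → 𝟙 d ≢ 0 → P
  𝟙≢0 (yes pf) _ = pf
  𝟙≢0 (no _)  h = ⊥-elim (h refl)

  𝟙-mono : (d : Dec P) (e : Dec R) → (P → R) → 𝟙 d ≤ 𝟙 e
  𝟙-mono (no _) e _ = z≤n
  𝟙-mono (yes pf) e f = ≤-reflexive (sym (𝟙-yes e (f pf)))

  𝟙-cong : (d : Dec P) (e : Dec R) → (P → R) → (R → P) → 𝟙 d ≡ 𝟙 e
  𝟙-cong d e f g = ≤-antisym (𝟙-mono d e f) (𝟙-mono e d g)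

  𝟙-and : ∀ {s} {S : Set s} (d : Dec P) (e : Dec R) (f : Dec S) → (P → R → S) → (S → P × R) → 𝟙 d * 𝟙 e ≡ 𝟙 f
  𝟙-and (yes x) (yes y) f g _ = sym (𝟙-yes f (g x y))
  𝟙-and (yes _) (no ¬y) f _ h = sym (𝟙-no f λ z → ¬y (proj₂ (h z)))
  𝟙-and (no ¬x) _ f _ h = sym (𝟙-no f λ z → ¬x (proj₁ (h z)))

  ∑ : List A → (A → ℕ) → ℕ
  ∑ []       f = 0
  ∑ (x ∷ xs) f = f x + ∑ xs f

  ∑-cong-∈ : (xs : List A) {f g : A → ℕ} → (∀ x → x ∈ xs → f x ≡ g x) → ∑ xs f ≡ ∑ xs g
  ∑-cong-∈ [] h = refl
  ∑-cong-∈ (x ∷ xs) h = cong₂ _+_ (h x (here refl)) (∑-cong-∈ xs λ y y∈ → h y (there y∈))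

  ∑-cong : (xs : List A) {f g : A → ℕ} → (∀ x → f x ≡ g x) → ∑ xs f ≡ ∑ xs g
  ∑-cong xs h = ∑-cong-∈ xs λ x _ → h x

  ∑-mono-∈ : (xs : List A) {f g : A → ℕ} → (∀ x → x ∈ xs → f x ≤ g x) → ∑ xs f ≤ ∑ xs g
  ∑-mono-∈ [] h = z≤n
  ∑-mono-∈ (x ∷ xs) h = +-mono-≤ (h x (here refl)) (∑-mono-∈ xs λ y y∈ → h y (there y∈))

  ∑-mono : (xs : List A) {f g : A → ℕ} → (∀ x → f x ≤ g x) → ∑ xs f ≤ ∑ xs g
  ∑-mono xs h = ∑-mono-∈ xs λ x _ → h x

  interchange : ∀ a b c d → (a + b) + (c + d) ≡ (a + c) + (b + d)
  interchange = solve-∀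

  ∑-+ : (xs : List A) (f g : A → ℕ) → ∑ xs (λ x → f x + g x) ≡ ∑ xs f + ∑ xs g
  ∑-+ [] f g = refl
  ∑-+ (x ∷ xs) f g = trans (cong (f x + g x +_) (∑-+ xs f g)) (interchange (f x) (g x) (∑ xs f) (∑ xs g))

  ∑-*ˡ : (xs : List A) (c : ℕ) (f : A → ℕ) → ∑ xs (λ x → c * f x) ≡ c * ∑ xs f
  ∑-*ˡ [] c f = sym (*-zeroʳ c)
  ∑-*ˡ (x ∷ xs) c f = trans (cong (c * f x +_) (∑-*ˡ xs c f)) (sym (*-distribˡ-+ c (f x) _))

  ∑-*ʳ : (xs : List A) (c : ℕ) (f : A → ℕ) → ∑ xs (λ x → f x * c) ≡ ∑ xs f * c
  ∑-*ʳ xs c f = trans (∑-cong xs λ x → *-comm (f x) c) (trans (∑-*ˡ xs c f) (*-comm c _))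

  ∑-const : (xs : List A) (c : ℕ) → ∑ xs (λ _ → c) ≡ length xs * c
  ∑-const [] c = refl
  ∑-const (x ∷ xs) c = cong (c +_) (∑-const xs c)

  ∑-one : (xs : List A) → ∑ xs (λ _ → 1) ≡ length xs
  ∑-one xs = trans (∑-const xs 1) (*-identityʳ _)

  ∑-zero-∈ : (xs : List A) {f : A → ℕ} → (∀ x → x ∈ xs → f x ≡ 0) → ∑ xs f ≡ 0
  ∑-zero-∈ xs h = trans (∑-cong-∈ xs h) (trans (∑-const xs 0) (*-zeroʳ (length xs)))

  ∑-swap : (xs : List A) (ys : List B) (f : A → B → ℕ) →
           ∑ xs (λ x → ∑ ys (f x)) ≡ ∑ ys (λ y → ∑ xs (λ x → f x y))
  ∑-swap [] ys f = sym (∑-zero-∈ ys λ _ _ → refl)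
  ∑-swap (x ∷ xs) ys f = trans (cong (∑ ys (f x) +_) (∑-swap xs ys f)) (sym (∑-+ ys (f x) _))

  ∑-++ : (xs ys : List A) (f : A → ℕ) → ∑ (xs ++ ys) f ≡ ∑ xs f + ∑ ys f
  ∑-++ [] ys f = refl
  ∑-++ (x ∷ xs) ys f = trans (cong (f x +_) (∑-++ xs ys f)) (sym (+-assoc (f x) _ _))

  ∑-map : (g : A → B) (xs : List A) (f : B → ℕ) → ∑ (map g xs) f ≡ ∑ xs (λ x → f (g x))
  ∑-map g [] f = refl
  ∑-map g (x ∷ xs) f = cong (f (g x) +_) (∑-map g xs f)

  ∑-filter : {P : Pred A p} (P? : Decidable P) (xs : List A) (f : A → ℕ) →
             ∑ (filter P? xs) f ≡ ∑ xs (λ x → 𝟙 (P? x) * f x)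
  ∑-filter P? [] f = refl
  ∑-filter P? (x ∷ xs) f with P? x
  ... | yes _ = cong₂ _+_ (sym (+-identityʳ (f x))) (∑-filter P? xs f)
  ... | no _  = ∑-filter P? xs f

  f≤∑ : (xs : List A) (f : A → ℕ) {x : A} → x ∈ xs → f x ≤ ∑ xs f
  f≤∑ (x ∷ xs) f (here refl) = m≤m+n (f x) _
  f≤∑ (y ∷ xs) f (there x∈) = ≤-trans (f≤∑ xs f x∈) (m≤n+m _ (f y))

  ∑≢0 : (xs : List A) (f : A → ℕ) → ∑ xs f ≢ 0 → ∃ λ x → x ∈ xs × f x ≢ 0
  ∑≢0 [] f h = ⊥-elim (h refl)
  ∑≢0 (x ∷ xs) f h with f x ≟ 0
  ... | no fx≢0 = x , here refl , fx≢0
  ... | yes fx≡0 with ∑≢0 xs f (λ e → h (trans (cong (_+ ∑ xs f) fx≡0) e))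
  ...   | y , y∈ , fy = y , there y∈ , fy

  ∑-zero⊎∃ : (xs : List A) (f : A → ℕ) →
             (∀ x → x ∈ xs → f x ≡ 0) ⊎ (∃ λ x → x ∈ xs × f x ≢ 0)
  ∑-zero⊎∃ xs f with ∑ xs f ≟ 0
  ... | yes z = inj₁ λ x x∈ → n≤0⇒n≡0 (subst (f x ≤_) z (f≤∑ xs f x∈))
  ... | no nz = inj₂ (∑≢0 xs f nz)

  -- The single equation `once` says that nothing is missing and nothing repeats, in the form that
  -- double counting uses: summing a function against an indicator picks out one value.
  record Finite (A : Set) : Set where
    infix 4 _≟ᶠ_
    field
      enum : List A
      _≟ᶠ_ : (x y : A) → Dec (x ≡ y)
      once : ∀ x → ∑ enum (λ y → 𝟙 (x ≟ᶠ y)) ≡ 1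

  module Fi {A : Set} (FA : Finite A) where
    open Finite FA public

    ∑∀ : (A → ℕ) → ℕ
    ∑∀ = ∑ enum

    enum-complete : ∀ x → x ∈ enum
    enum-complete x with ∑≢0 enum (λ y → 𝟙 (x ≟ᶠ y)) (λ z → 1+n≢0 (trans (sym (once x)) z))
    ... | y , y∈ , h = subst (_∈ enum) (sym (𝟙≢0 (x ≟ᶠ y) h)) y∈

    ∑-pick : ∀ x (f : A → ℕ) → ∑∀ (λ y → 𝟙 (x ≟ᶠ y) * f y) ≡ f x
    ∑-pick x f = begin
      ∑∀ (λ y → 𝟙 (x ≟ᶠ y) * f y) ≡⟨ ∑-cong enum step ⟩
      ∑∀ (λ y → 𝟙 (x ≟ᶠ y) * f x) ≡⟨ ∑-*ʳ enum (f x) _ ⟩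
      ∑∀ (λ y → 𝟙 (x ≟ᶠ y)) * f x ≡⟨ cong (_* f x) (once x) ⟩
      1 * f x                      ≡⟨ *-identityˡ (f x) ⟩
      f x ∎
      where
      open ≡-Reasoning
      step : ∀ y → 𝟙 (x ≟ᶠ y) * f y ≡ 𝟙 (x ≟ᶠ y) * f x
      step y with x ≟ᶠ y
      ... | yes refl = refl
      ... | no _ = refl

    f≤∑∀ : ∀ (f : A → ℕ) x → f x ≤ ∑∀ f
    f≤∑∀ f x = f≤∑ enum f (enum-complete x)

    ∑∀-zero⊎∃ : (f : A → ℕ) → (∀ x → f x ≡ 0) ⊎ (∃ λ x → f x ≢ 0)
    ∑∀-zero⊎∃ f with ∑-zero⊎∃ enum f
    ... | inj₁ z = inj₁ λ x → z x (enum-complete x)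
    ... | inj₂ (x , _ , h) = inj₂ (x , h)

    -- Write f (σ x) as a sum over y against the indicator of σ x = y and exchange the sums; for
    -- each y exactly one x, namely ρ y, remains.
    ∑∀-bij : (σ ρ : A → A) → (∀ x → ρ (σ x) ≡ x) → (∀ x → σ (ρ x) ≡ x) →
             ∀ (f : A → ℕ) → ∑∀ (λ x → f (σ x)) ≡ ∑∀ f
    ∑∀-bij σ ρ ρσ σρ f = begin
      ∑∀ (λ x → f (σ x))                              ≡⟨ ∑-cong enum (λ x → sym (∑-pick (σ x) f)) ⟩
      ∑∀ (λ x → ∑∀ (λ y → 𝟙 (σ x ≟ᶠ y) * f y))       ≡⟨ ∑-swap enum enum _ ⟩
      ∑∀ (λ y → ∑∀ (λ x → 𝟙 (σ x ≟ᶠ y) * f y))       ≡⟨ ∑-cong enum (λ y → ∑-*ʳ enum (f y) _) ⟩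
      ∑∀ (λ y → ∑∀ (λ x → 𝟙 (σ x ≟ᶠ y)) * f y)       ≡⟨ ∑-cong enum (λ y → cong (_* f y) (inner y)) ⟩
      ∑∀ (λ y → 1 * f y)                              ≡⟨ ∑-cong enum (λ y → *-identityˡ (f y)) ⟩
      ∑∀ f ∎
      where
      open ≡-Reasoning
      inner : ∀ y → ∑∀ (λ x → 𝟙 (σ x ≟ᶠ y)) ≡ 1
      inner y = trans (∑-cong enum λ x → 𝟙-cong (σ x ≟ᶠ y) (ρ y ≟ᶠ x)
                  (λ e → trans (cong ρ (sym e)) (ρσ x))
                  (λ e → trans (cong σ (sym e)) (σρ y)))
                (once (ρ y))

-- Point sets in a projective plane with many collinear pairs at each of their points.

module PlaneCombinatorics where
  open import Data.Nat
  open import Data.Nat.Properties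
  open ≡ using (refl; sym; trans; cong; cong₂; subst; subst₂)
  open Counting

  -- Memberships and incidences are kept as numbers so that they can be multiplied under sums; `Bit`
  -- allows pointwise inequalities between them to be checked by cases.
  data Bit : ℕ → Set where
    O : Bit 0
    I : Bit 1

  𝟙-Bit : ∀ {p} {P : Set p} (d : Dec P) → Bit (𝟙 d)
  𝟙-Bit (yes _) = I
  𝟙-Bit (no _)  = O

  Bit-*-≤ : ∀ {a} → Bit a → ∀ n → a * n ≤ n
  Bit-*-≤ O n = z≤n
  Bit-*-≤ I n = ≤-reflexive (*-identityˡ n)

  Bit-≢0 : ∀ {a} → Bit a → a ≢ 0 → a ≡ 1
  Bit-≢0 O h = ⊥-elim (h refl)
  Bit-≢0 I h = refl

  Bit-idem : ∀ {a} → Bit a → a * a ≡ a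
  Bit-idem O = refl
  Bit-idem I = refl

  Bit-split : ∀ {a} → Bit a → a ≡ 0 ⊎ a ≡ 1
  Bit-split O = inj₁ refl
  Bit-split I = inj₂ refl

  ∑-tight : ∀ {A : Set} (xs : List A) {f g : A → ℕ} → (∀ x → f x ≤ g x) → ∑ xs f ≡ ∑ xs g →
            ∀ x → x ∈ xs → f x ≡ g x
  ∑-tight (x ∷ xs) {f} {g} f≤g e = λ where
      _ (here refl) → fx≡gx
      y (there y∈)  → ∑-tight xs f≤g
        (+-cancelˡ-≡ (f x) _ _ (trans e (cong (_+ ∑ xs g) (sym fx≡gx)))) y y∈
    where
    fx≡gx : f x ≡ g x
    fx≡gx = ≤-antisym (f≤g x) (+-cancelʳ-≤ (∑ xs g) (g x) (f x)
      (≤-trans (≤-reflexive (sym e)) (+-monoʳ-≤ (f x) (∑-mono xs f≤g))))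

  -- The number of ordered pairs of distinct elements in a set of size n; at n = 0 the truncation
  -- does no harm.
  falling : ℕ → ℕ
  falling n = n * (n ∸ 1)

  falling-square : ∀ n → falling n + n ≡ n * n
  falling-square zero = refl
  falling-square (suc n) = lem n
    where
    lem : ∀ n → suc n * n + suc n ≡ suc n * suc n
    lem = solve-∀

  record ProjectivePlane (q : ℕ) (Pt Ln : Set) : Set where
    field
      finPt : Finite Pt
      finLn : Finite Ln
      inc   : Pt → Ln → ℕ
      bit   : ∀ p L → Bit (inc p L)
      size  : length (Finite.enum finLn) ≡ q * q + q + 1
      points-on : ∀ L → ∑ (Finite.enum finPt) (λ p → inc p L) ≡ q + 1
      lines-on  : ∀ p → ∑ (Finite.enum finLn) (λ L → inc p L) ≡ q + 1
      join : ∀ p p′ → p ≢ p′ → ∑ (Finite.enum finLn) (λ L → inc p L * inc p′ L) ≡ 1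
      meet : ∀ L M → L ≢ M → ∑ (Finite.enum finPt) (λ p → inc p L * inc p M) ≡ 1

  module PointSet {q : ℕ} {Pt Ln : Set} (Π : ProjectivePlane q Pt Ln)
                  (T : Pt → ℕ) (T-bit : ∀ p → Bit (T p)) where
    open ProjectivePlane Π
    open Fi finPt public using () renaming (∑∀ to ∑P; enum to pts; _≟ᶠ_ to _≟P_; enum-complete to ∈pts;
                                     ∑-pick to ∑P-pick; ∑∀-zero⊎∃ to zero⊎∃P)
    open Fi finLn public using () renaming (∑∀ to ∑L; enum to lns; _≟ᶠ_ to _≟L_;
                                     ∑-pick to ∑L-pick; ∑∀-zero⊎∃ to zero⊎∃L)

    δ : Ln → ℕ
    δ L = ∑P λ p → T p * inc p L

    t : ℕ
    t = ∑P T

    lines-through-two : ∀ v p → ∑L (λ L → inc v L * inc p L) ≡ 1 + 𝟙 (v ≟P p) * q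
    lines-through-two v p with v ≟P p
    ... | yes refl = trans (∑-cong lns λ L → Bit-idem (bit v L))
                       (trans (lines-on v) (trans (+-comm q 1) (cong suc (sym (+-identityʳ q)))))
    ... | no v≢p = join v p v≢p

    -- A point other than v is on one line through v, while v is on all q + 1 of them and so counts
    -- q extra times if it belongs to `T`.
    ∑-δ-through : ∀ v → ∑L (λ L → inc v L * δ L) ≡ t + T v * q
    ∑-δ-through v = begin
      ∑L (λ L → inc v L * δ L)
        ≡⟨ ∑-cong lns (λ L → sym (∑-*ˡ pts (inc v L) _)) ⟩
      ∑L (λ L → ∑P λ p → inc v L * (T p * inc p L))
        ≡⟨ ∑-swap lns pts _ ⟩
      ∑P (λ p → ∑L λ L → inc v L * (T p * inc p L))
        ≡⟨ ∑-cong pts (λ p → trans (∑-cong lns λ L → assoc₁ (inc v L) (T p) (inc p L)) (∑-*ˡ lns (T p) _)) ⟩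
      ∑P (λ p → T p * ∑L λ L → inc v L * inc p L)
        ≡⟨ ∑-cong pts (λ p → trans (cong (T p *_) (lines-through-two v p)) (assoc₂ (T p) (𝟙 (v ≟P p)) q)) ⟩
      ∑P (λ p → T p + 𝟙 (v ≟P p) * (T p * q))
        ≡⟨ ∑-+ pts T _ ⟩
      t + ∑P (λ p → 𝟙 (v ≟P p) * (T p * q))
        ≡⟨ cong (t +_) (∑P-pick v (λ p → T p * q)) ⟩
      t + T v * q ∎
      where
      open ≡-Reasoning
      assoc₁ : ∀ a b c → a * (b * c) ≡ b * (a * c)
      assoc₁ = solve-∀
      assoc₂ : ∀ a b c → a * (1 + b * c) ≡ a + b * (a * c)
      assoc₂ = solve-∀

    ∑-δ : ∑L δ ≡ t * (q + 1)
    ∑-δ = trans (∑-swap lns pts _) (trans (∑-cong pts λ p → trans (∑-*ˡ lns (T p) _) (cong (T p *_) (lines-on p)))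
            (∑-*ʳ pts (q + 1) T))

    ∑-δ² : ∑L (λ L → δ L * δ L) ≡ t * t + t * q
    ∑-δ² = begin
      ∑L (λ L → δ L * δ L)
        ≡⟨ ∑-cong lns (λ L → sym (∑-*ʳ pts (δ L) _)) ⟩
      ∑L (λ L → ∑P λ p → T p * inc p L * δ L)
        ≡⟨ ∑-swap lns pts _ ⟩
      ∑P (λ p → ∑L λ L → T p * inc p L * δ L)
        ≡⟨ ∑-cong pts (λ p → trans (∑-cong lns λ L → *-assoc (T p) (inc p L) (δ L)) (∑-*ˡ lns (T p) _)) ⟩
      ∑P (λ p → T p * ∑L λ L → inc p L * δ L)
        ≡⟨ ∑-cong pts (λ p → trans (cong (T p *_) (∑-δ-through p)) (step (T-bit p))) ⟩
      ∑P (λ p → T p * (t + q))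
        ≡⟨ ∑-*ʳ pts (t + q) T ⟩
      t * (t + q)
        ≡⟨ *-distribˡ-+ t t q ⟩
      t * t + t * q ∎
      where
      open ≡-Reasoning
      step : ∀ {a} → Bit a → a * (t + a * q) ≡ a * (t + q)
      step O = refl
      step I = cong (λ z → 1 * (t + z)) (+-identityʳ q)

    -- Both sides count ordered pairs of points of `T`: a pair of distinct points is found on
    -- exactly one line.
    ∑-falling-δ : ∑L (λ L → falling (δ L)) + t ≡ t * t
    ∑-falling-δ = +-cancelʳ-≡ (t * q) _ _ (begin
      ∑L (λ L → falling (δ L)) + t + t * q ≡⟨ lem (∑L λ L → falling (δ L)) t q ⟩
      ∑L (λ L → falling (δ L)) + t * (q + 1) ≡⟨ cong (∑L (λ L → falling (δ L)) +_) (sym ∑-δ) ⟩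
      ∑L (λ L → falling (δ L)) + ∑L δ ≡⟨ sym (∑-+ lns _ δ) ⟩
      ∑L (λ L → falling (δ L) + δ L) ≡⟨ ∑-cong lns (λ L → falling-square (δ L)) ⟩
      ∑L (λ L → δ L * δ L) ≡⟨ ∑-δ² ⟩
      t * t + t * q ∎)
      where
      open ≡-Reasoning
      lem : ∀ a t q → a + t + t * q ≡ a + t * (q + 1)
      lem = solve-∀

    δ≤q+1 : ∀ L → δ L ≤ q + 1
    δ≤q+1 L = ≤-trans (∑-mono pts λ p → Bit-*-≤ (T-bit p) (inc p L)) (≤-reflexive (points-on L))

    on⇒1≤δ : ∀ v L → T v ≡ 1 → inc v L ≡ 1 → 1 ≤ δ L
    on⇒1≤δ v L Tv i = ≤-trans (≤-reflexive (sym (cong₂ _*_ Tv i))) (Fi.f≤∑∀ finPt (λ p → T p * inc p L) v)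

    ∑-δ∸1-through : ∀ v → T v ≡ 1 → ∑L (λ L → inc v L * (δ L ∸ 1)) + 1 ≡ t
    ∑-δ∸1-through v Tv = +-cancelʳ-≡ q _ _ (begin
      ∑L (λ L → inc v L * (δ L ∸ 1)) + 1 + q ≡⟨ lem (∑L λ L → inc v L * (δ L ∸ 1)) q ⟩
      ∑L (λ L → inc v L * (δ L ∸ 1)) + (q + 1) ≡⟨ cong (∑L (λ L → inc v L * (δ L ∸ 1)) +_) (sym (lines-on v)) ⟩
      ∑L (λ L → inc v L * (δ L ∸ 1)) + ∑L (λ L → inc v L) ≡⟨ sym (∑-+ lns _ _) ⟩
      ∑L (λ L → inc v L * (δ L ∸ 1) + inc v L) ≡⟨ ∑-cong lns (λ L → step L (bit v L) refl) ⟩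
      ∑L (λ L → inc v L * δ L) ≡⟨ ∑-δ-through v ⟩
      t + T v * q ≡⟨ cong (λ z → t + z * q) Tv ⟩
      t + 1 * q ≡⟨ cong (t +_) (*-identityˡ q) ⟩
      t + q ∎)
      where
      open ≡-Reasoning
      lem : ∀ a q → a + 1 + q ≡ a + (q + 1)
      lem = solve-∀
      step : ∀ L {i} → Bit i → inc v L ≡ i → i * (δ L ∸ 1) + i ≡ i * δ L
      step L O e = refl
      step L I e = trans (cong (_+ 1) (*-identityˡ (δ L ∸ 1))) (trans (m∸n+n≡m (on⇒1≤δ v L Tv e)) (sym (*-identityˡ (δ L))))

    module Star (q≥2048 : 2048 ≤ q) (t-small : t + 136 ≤ 3 * q)
                (star : ∀ v → T v ≡ 1 → q * q + q ≤ ∑L (λ L → inc v L * falling (δ L))) where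

      -- Otherwise 3δ ≤ q on every line through v, and three times the inequality at v gives 3(q² +
      -- q) ≤ q Σ (δ - 1) ≤ q t ≤ 3q².
      third-line : ∀ v → T v ≡ 1 → ∃ λ L → inc v L ≡ 1 × q < 3 * δ L
      third-line v Tv with zero⊎∃L (λ L → inc v L * 𝟙 (q <? 3 * δ L))
      ... | inj₂ (L , nz) = L , Bit-≢0 (bit v L) (λ e → nz (cong (_* 𝟙 (q <? 3 * δ L)) e))
                              , 𝟙≢0 (q <? 3 * δ L) (λ e → nz (trans (cong (inc v L *_) e) (*-zeroʳ (inc v L))))
      ... | inj₁ z = ⊥-elim (1+n≰n (≤-trans big small))
        where
        S1 = ∑L (λ L → inc v L * (δ L ∸ 1))
        bound : ∀ L → 3 * (inc v L * falling (δ L)) ≤ q * (inc v L * (δ L ∸ 1))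
        bound L = go (bit v L) (z L)
          where
          lem : ∀ a b → 3 * (1 * (a * b)) ≡ 3 * a * b
          lem = solve-∀
          go : ∀ {i} → Bit i → i * 𝟙 (q <? 3 * δ L) ≡ 0 → 3 * (i * falling (δ L)) ≤ q * (i * (δ L ∸ 1))
          go O _ = z≤n
          go I zL with q <? 3 * δ L
          ... | yes _ = ⊥-elim (1+n≢0 zL)
          ... | no h  = ≤-trans (≤-reflexive (lem (δ L) (δ L ∸ 1))) (*-mono-≤ (≮⇒≥ h) (≤-reflexive (sym (*-identityˡ (δ L ∸ 1)))))
        open ≤-Reasoning
        big : suc (q * (3 * q)) ≤ 3 * (q * q + q)
        big = ≤-trans (+-monoˡ-≤ (q * (3 * q)) (≤-trans (s≤s (z≤n {2047})) (≤-trans q≥2048 (m≤m+n q (q + (q + 0)))))) (≤-reflexive (lem q))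
          where
          lem : ∀ q → 3 * q + q * (3 * q) ≡ 3 * (q * q + q)
          lem = solve-∀
        small : 3 * (q * q + q) ≤ q * (3 * q)
        small = begin
          3 * (q * q + q) ≤⟨ *-monoʳ-≤ 3 (star v Tv) ⟩
          3 * ∑L (λ L → inc v L * falling (δ L)) ≡⟨ sym (∑-*ˡ lns 3 _) ⟩
          ∑L (λ L → 3 * (inc v L * falling (δ L))) ≤⟨ ∑-mono lns bound ⟩
          ∑L (λ L → q * (inc v L * (δ L ∸ 1))) ≡⟨ ∑-*ˡ lns q _ ⟩
          q * S1 ≤⟨ *-monoʳ-≤ q (≤-trans (m≤m+n S1 1) (≤-reflexive (∑-δ∸1-through v Tv))) ⟩
          q * t ≤⟨ *-monoʳ-≤ q (≤-trans (m≤m+n t 136) t-small) ⟩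
          q * (3 * q) ∎

      -- Averaging (star) over the points of T on L: every other line meets L in one point,
      -- and the falling squares of all δ sum to t (t − 1).
      line-average : ∀ L → δ L * (q * q + q) + t ≤ t * t + falling (δ L) * (δ L ∸ 1)
      line-average L = begin
        x * (q * q + q) + t
          ≡⟨ cong (_+ t) (sym (∑-*ʳ pts (q * q + q) _)) ⟩
        ∑P (λ v → T v * inc v L * (q * q + q)) + t
          ≤⟨ +-monoˡ-≤ t (∑-mono pts step₁) ⟩
        ∑P (λ v → T v * inc v L * ∑L (λ M → inc v M * falling (δ M))) + t
          ≡⟨ cong (_+ t) (∑-cong pts λ v → sym (∑-*ˡ lns (T v * inc v L) _)) ⟩
        ∑P (λ v → ∑L (λ M → T v * inc v L * (inc v M * falling (δ M)))) + t
          ≡⟨ cong (_+ t) (∑-swap pts lns _) ⟩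
        ∑L (λ M → ∑P (λ v → T v * inc v L * (inc v M * falling (δ M)))) + t
          ≡⟨ cong (_+ t) (∑-cong lns λ M → trans (∑-cong pts λ v → sym (*-assoc (T v * inc v L) (inc v M) _)) (∑-*ʳ pts (falling (δ M)) _)) ⟩
        ∑L (λ M → ∑P (λ v → T v * inc v L * inc v M) * falling (δ M)) + t
          ≤⟨ +-monoˡ-≤ t (∑-mono lns λ M → *-monoˡ-≤ (falling (δ M)) (common M)) ⟩
        ∑L (λ M → (1 + 𝟙 (L ≟L M) * (x ∸ 1)) * falling (δ M)) + t
          ≡⟨ cong (_+ t) (∑-cong lns λ M → lem (𝟙 (L ≟L M)) (x ∸ 1) (falling (δ M))) ⟩
        ∑L (λ M → falling (δ M) + 𝟙 (L ≟L M) * (falling (δ M) * (x ∸ 1))) + t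
          ≡⟨ cong (_+ t) (trans (∑-+ lns _ _) (cong (∑L (λ M → falling (δ M)) +_) (∑L-pick L λ M → falling (δ M) * (x ∸ 1)))) ⟩
        ∑L (λ M → falling (δ M)) + falling x * (x ∸ 1) + t
          ≡⟨ swap₃ (∑L λ M → falling (δ M)) (falling x * (x ∸ 1)) t ⟩
        ∑L (λ M → falling (δ M)) + t + falling x * (x ∸ 1)
          ≡⟨ cong (_+ falling x * (x ∸ 1)) ∑-falling-δ ⟩
        t * t + falling x * (x ∸ 1) ∎
        where
        open ≤-Reasoning
        x = δ L
        lem : ∀ a b c → (1 + a * b) * c ≡ c + a * (c * b)
        lem = solve-∀
        swap₃ : ∀ a b c → a + b + c ≡ a + c + b
        swap₃ = solve-∀
        step₁ : ∀ v → T v * inc v L * (q * q + q) ≤ T v * inc v L * ∑L (λ M → inc v M * falling (δ M))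
        step₁ v with Bit-split (T-bit v)
        ... | inj₁ e rewrite e = z≤n
        ... | inj₂ e = *-monoʳ-≤ (T v * inc v L) (star v e)
        drop : ∀ {a b c} → Bit a → a * b * c ≤ b * c
        drop O = z≤n
        drop {b = b} {c} I = ≤-reflexive (cong (_* c) (*-identityˡ b))
        common : ∀ M → ∑P (λ v → T v * inc v L * inc v M) ≤ 1 + 𝟙 (L ≟L M) * (x ∸ 1)
        common M with L ≟L M
        ... | no L≢M = ≤-trans (∑-mono pts λ v → drop (T-bit v)) (≤-reflexive (meet L M L≢M))
        ... | yes refl = ≤-trans (≤-reflexive (∑-cong pts λ v → trans (*-assoc (T v) (inc v L) (inc v L)) (cong (T v *_) (Bit-idem (bit v L)))))
                           (≤-trans (m≤n+m∸n x 1) (≤-reflexive (cong suc (sym (+-identityʳ (x ∸ 1))))))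

      -- Let x = δ L. From t ≤ 3q and q < 3x one gets t² ≤ 9q² ≤ 27 q x, so the averaged inequality
      -- can be divided by x and becomes q² + q ≤ 27q + (x - 1)². This fails once x - 1 ≤ q - 15.
      heavy : ∀ L → q < 3 * δ L → q ≤ δ L + 13
      heavy L q<3x with q ≤? δ L + 13
      ... | yes h = h
      ... | no  h = ⊥-elim (go (δ L) q<3x (≰⇒> h) (line-average L))
        where
        go : ∀ x → q < 3 * x → x + 13 < q → x * (q * q + q) + t ≤ t * t + falling x * (x ∸ 1) → ⊥
        go zero () _ _
        go (suc y) q<3x x+13<q avg with m≤n⇒∃[o]m+o≡n x+13<q
        ... | e , refl = 1+n≰n (≤-trans final big)
          where
          open ≤-Reasoning
          x = suc y
          Q = suc (suc y + 13) + e
          expand : Q ≡ y + 15 + e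
          expand = lem y e
            where
            lem : ∀ y e → suc (suc y + 13) + e ≡ y + 15 + e
            lem = solve-∀
          divided : x * (Q * Q + Q) ≤ x * (27 * Q + y * y)
          divided = begin
            x * (Q * Q + Q) ≤⟨ m≤m+n _ t ⟩
            x * (Q * Q + Q) + t ≤⟨ avg ⟩
            t * t + x * y * y ≤⟨ +-monoˡ-≤ _ (*-mono-≤ t≤3Q t≤3Q) ⟩
            3 * Q * (3 * Q) + x * y * y ≡⟨ lem₁ Q x y ⟩
            9 * Q * Q + x * (y * y) ≤⟨ +-monoˡ-≤ _ (*-monoʳ-≤ (9 * Q) (<⇒≤ q<3x)) ⟩
            9 * Q * (3 * x) + x * (y * y) ≡⟨ lem₂ Q x y ⟩
            x * (27 * Q + y * y) ∎
            where
            t≤3Q : t ≤ 3 * Q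
            t≤3Q = ≤-trans (m≤m+n t 136) t-small
            lem₁ : ∀ Q x y → 3 * Q * (3 * Q) + x * y * y ≡ 9 * Q * Q + x * (y * y)
            lem₁ = solve-∀
            lem₂ : ∀ Q x y → 9 * Q * (3 * x) + x * (y * y) ≡ x * (27 * Q + y * y)
            lem₂ = solve-∀
          big : Q * Q + Q ≤ 27 * Q + y * y
          big = *-cancelˡ-≤ x divided
          y≥100 : 100 ≤ y
          y≥100 = ≤-pred (*-cancelˡ-≤ {100 + 1} {suc y} 3 (≤-trans (≤-trans (m≤m+n 303 1745) q≥2048) (<⇒≤ q<3x)))
          -- With Q = y + 15 + e the two sides differ by 4y - 165 plus nonnegative terms in e. The
          -- coefficient 4 is 2 · 15 - 26, which is where the margin 13 comes from, and 4 · 100 ≥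
          -- 166 settles the constant.
          final : suc (27 * Q + y * y) ≤ Q * Q + Q
          final = begin
            suc (27 * Q + y * y) ≡⟨ cong (λ z → suc (27 * z + y * y)) expand ⟩
            suc (27 * (y + 15 + e) + y * y) ≡⟨ lem₁ y e ⟩
            26 * y + (166 + 225) + y + 15 + 27 * e + y * y ≤⟨ +-monoˡ-≤ (y * y) (+-monoˡ-≤ (27 * e) (+-monoˡ-≤ 15 (+-monoˡ-≤ y
               (+-monoʳ-≤ (26 * y) (+-monoˡ-≤ 225 (≤-trans (m≤m+n 166 234) (*-monoʳ-≤ 4 y≥100))))))) ⟩
            26 * y + (4 * y + 225) + y + 15 + 27 * e + y * y ≤⟨ m≤m+n _ (e * e + 2 * e * y + 4 * e) ⟩
            26 * y + (4 * y + 225) + y + 15 + 27 * e + y * y + (e * e + 2 * e * y + 4 * e) ≡⟨ lem₂ y e ⟩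
            (y + 15 + e) * (y + 15 + e) + (y + 15 + e) ≡⟨ cong (λ z → z * z + z) (sym expand) ⟩
            Q * Q + Q ∎
            where
            lem₁ : ∀ y e → suc (27 * (y + 15 + e) + y * y) ≡ 26 * y + (166 + 225) + y + 15 + 27 * e + y * y
            lem₁ = solve-∀
            lem₂ : ∀ y e → 26 * y + (4 * y + 225) + y + 15 + 27 * e + y * y + (e * e + 2 * e * y + 4 * e) ≡ (y + 15 + e) * (y + 15 + e) + (y + 15 + e)
            lem₂ = solve-∀

      -- The three lines share at most three points pairwise, so they would carry at least 3(q - 13)
      -- - 3 = 3q - 42 points of `T`, against t ≤ 3q - 136.
      not-three-heavy : ∀ L M N → L ≢ M → L ≢ N → M ≢ N →
                        q ≤ δ L + 13 → q ≤ δ M + 13 → q ≤ δ N + 13 → ⊥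
      not-three-heavy L M N L≢M L≢N M≢N hL hM hN = 1+n≰n (begin
        suc (3 * q + 93) ≤⟨ s≤s (+-monoˡ-≤ 93 (≤-trans (≤-reflexive (lem₁ q)) (+-mono-≤ hL (+-mono-≤ hM hN)))) ⟩
        suc ((δ L + 13) + ((δ M + 13) + (δ N + 13)) + 93) ≡⟨ lem₂ (δ L) (δ M) (δ N) ⟩
        (δ L + δ M + δ N) + 133 ≤⟨ +-monoˡ-≤ 133 incl-excl ⟩
        t + 3 + 133 ≡⟨ +-assoc t 3 133 ⟩
        t + 136 ≤⟨ t-small ⟩
        3 * q ≤⟨ m≤m+n (3 * q) 93 ⟩
        3 * q + 93 ∎)
        where
        open ≤-Reasoning
        lem₁ : ∀ q → 3 * q ≡ q + (q + q)
        lem₁ = solve-∀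
        lem₂ : ∀ a b c → suc ((a + 13) + ((b + 13) + (c + 13)) + 93) ≡ (a + b + c) + 133
        lem₂ = solve-∀
        -- The Bonferroni inequality for three sets at a single point.
        pointwise : ∀ {T a b c} → Bit T → Bit a → Bit b → Bit c →
                    T * a + T * b + T * c ≤ T + (a * b + a * c + b * c)
        pointwise O _ _ _ = z≤n
        pointwise I O O O = z≤n
        pointwise I I O O = ≤-refl
        pointwise I O I O = ≤-refl
        pointwise I O O I = ≤-refl
        pointwise I I I O = ≤-refl
        pointwise I I O I = ≤-refl
        pointwise I O I I = ≤-refl
        pointwise I I I I = n≤1+n 3
        incl-excl : δ L + δ M + δ N ≤ t + 3
        incl-excl = begin
          δ L + δ M + δ N
            ≡⟨ trans (cong (_+ δ N) (sym (∑-+ pts _ _))) (sym (∑-+ pts _ _)) ⟩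
          ∑P (λ p → T p * inc p L + T p * inc p M + T p * inc p N)
            ≤⟨ ∑-mono pts (λ p → pointwise (T-bit p) (bit p L) (bit p M) (bit p N)) ⟩
          ∑P (λ p → T p + (inc p L * inc p M + inc p L * inc p N + inc p M * inc p N))
            ≡⟨ trans (∑-+ pts T _) (cong (t +_) (trans (∑-+ pts _ _) (cong (_+ ∑P (λ p → inc p M * inc p N)) (∑-+ pts _ _)))) ⟩
          t + (∑P (λ p → inc p L * inc p M) + ∑P (λ p → inc p L * inc p N) + ∑P (λ p → inc p M * inc p N))
            ≡⟨ cong₂ (λ a b → t + (a + b)) (cong₂ _+_ (meet L M L≢M) (meet L N L≢N)) (meet M N M≢N) ⟩
          t + 3 ∎

      -- Any other line through v meets `T` at most in v and contributes nothing to the inequality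
      -- at v, so L alone has to supply q² + q ordered pairs.
      in-one-line : ∀ v L → T v ≡ 1 → inc v L ≡ 1 → (∀ p → T p ≤ inc p L) → t ≡ q + 1
      in-one-line v L Tv i T⊆L = trans t≡x (≤-antisym (δ≤q+1 L) (root (δ L) bound))
        where
        contained : ∀ {a b} → Bit a → Bit b → a ≤ b → a ≡ a * b
        contained O _ _ = refl
        contained I I _ = refl
        contained I O ()
        t≡x : t ≡ δ L
        t≡x = ∑-cong pts λ p → contained (T-bit p) (bit p L) (T⊆L p)
        at-most-1 : ∀ n → n ≤ 1 → falling n ≡ 0
        at-most-1 zero _ = refl
        at-most-1 (suc zero) _ = refl
        at-most-1 (suc (suc n)) (s≤s ())
        pointwise : ∀ M → inc v M * falling (δ M) ≤ 𝟙 (L ≟L M) * falling (δ M)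
        pointwise M with L ≟L M
        ... | yes refl = ≤-reflexive (cong (_* falling (δ L)) i)
        ... | no L≢M = ≤-reflexive (trans (cong (inc v M *_) (at-most-1 (δ M)
                 (≤-trans (∑-mono pts λ p → *-monoˡ-≤ (inc p M) (T⊆L p)) (≤-reflexive (meet L M L≢M)))))
                 (*-zeroʳ (inc v M)))
        bound : q * q + q ≤ falling (δ L)
        bound = ≤-trans (star v Tv) (≤-trans (∑-mono lns pointwise) (≤-reflexive (∑L-pick L (λ M → falling (δ M)))))
        root : ∀ x → q * q + q ≤ falling x → q + 1 ≤ x
        root x h with q + 1 ≤? x
        ... | yes g = g
        ... | no g  = ⊥-elim (1+n≰n (≤-trans (+-monoʳ-≤ 1 (≤-trans h small)) strict))
          where
          x≤q : x ≤ q
          x≤q = ≤-pred (subst (suc x ≤_) (+-comm q 1) (≰⇒> g))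
          small : falling x ≤ q * q
          small = *-mono-≤ x≤q (≤-trans (m∸n≤m x 1) x≤q)
          strict : suc (q * q) ≤ q * q + q
          strict = ≤-trans (≤-reflexive (+-comm 1 (q * q))) (+-monoʳ-≤ (q * q) (≤-trans (m≤m+n 1 2047) q≥2048))

      -- When the plane is the quotient at a point of the cap, lines with δ = 0 and δ = 1 are the
      -- planes through that point with q + 2 and q + 1 points of the cap.
      A₀ A₁ : ℕ
      A₀ = ∑L λ L → 𝟙 (δ L ≟ 0)
      A₁ = ∑L λ L → 𝟙 (δ L ≟ 1)

      -- `blocking` covers two full lines, and two lines less one point other than their
      -- intersection. `even` is two lines less their intersection, so that any other line meets `T`
      -- in 0 or 2 points. Only the numbers for the later double counts are retained.
      data Shape : Set where
        empty    : t ≡ 0 → Shape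
        line     : t ≡ q + 1 → Shape
        blocking : (∀ L → 1 ≤ δ L) →
                   (t ≡ 2 * q + 1 × A₁ + 1 ≡ q) ⊎ (t ≡ 2 * q × A₁ + 1 ≡ 2 * q) → Shape
        even     : t ≡ 2 * q → A₀ + 1 ≡ q → (∀ L → δ L ≢ 1) → Shape

      module TwoLines (L₁ L₂ : Ln) (L₁≢L₂ : L₁ ≢ L₂)
                      (h₁ : q ≤ δ L₁ + 13) (h₂ : q ≤ δ L₂ + 13)
                      (T⊆ : ∀ p → T p ≤ inc p L₁ + inc p L₂) where

        -- `e₁₂` is 1 or 0 according as the intersection of the two lines belongs to `T`.
        x₁ x₂ e₁₂ : ℕ
        x₁ = δ L₁
        x₂ = δ L₂
        e₁₂ = ∑P λ p → T p * (inc p L₁ * inc p L₂)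

        t+e₁₂ : t + e₁₂ ≡ x₁ + x₂
        t+e₁₂ = begin
          t + e₁₂ ≡⟨ sym (∑-+ pts T _) ⟩
          ∑P (λ p → T p + T p * (inc p L₁ * inc p L₂))
            ≡⟨ ∑-cong pts (λ p → pointwise (T-bit p) (bit p L₁) (bit p L₂) (T⊆ p)) ⟩
          ∑P (λ p → T p * inc p L₁ + T p * inc p L₂) ≡⟨ ∑-+ pts _ _ ⟩
          x₁ + x₂ ∎
          where
          open ≡-Reasoning
          pointwise : ∀ {a b c} → Bit a → Bit b → Bit c → a ≤ b + c → a + a * (b * c) ≡ a * b + a * c
          pointwise O _ _ _ = refl
          pointwise I O O ()
          pointwise I I O _ = refl
          pointwise I O I _ = refl
          pointwise I I I _ = refl

        other≤2 : ∀ M → L₁ ≢ M → L₂ ≢ M → δ M ≤ 2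
        other≤2 M n₁ n₂ = begin
          δ M ≤⟨ ∑-mono pts (λ p → *-monoˡ-≤ (inc p M) (T⊆ p)) ⟩
          ∑P (λ p → (inc p L₁ + inc p L₂) * inc p M) ≡⟨ ∑-cong pts (λ p → *-distribʳ-+ (inc p M) (inc p L₁) (inc p L₂)) ⟩
          ∑P (λ p → inc p L₁ * inc p M + inc p L₂ * inc p M) ≡⟨ ∑-+ pts _ _ ⟩
          ∑P (λ p → inc p L₁ * inc p M) + ∑P (λ p → inc p L₂ * inc p M) ≡⟨ cong₂ _+_ (meet L₁ M n₁) (meet L₂ M n₂) ⟩
          2 ∎
          where open ≤-Reasoning

        x₁≥2 : 2 ≤ x₁
        x₁≥2 = +-cancelʳ-≤ 13 2 x₁ (≤-trans (≤-trans (m≤m+n 15 2033) q≥2048) h₁)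

        e₁₂≤1 : e₁₂ ≤ 1
        e₁₂≤1 = ≤-trans (∑-mono pts λ p → Bit-*-≤ (T-bit p) (inc p L₁ * inc p L₂)) (≤-reflexive (meet L₁ L₂ L₁≢L₂))

        private-point : ∃ λ v → T v ≡ 1 × inc v L₁ ≡ 1 × inc v L₂ ≡ 0
        private-point with zero⊎∃P (λ p → T p * (inc p L₁ * (1 ∸ inc p L₂)))
        ... | inj₂ (v , nz) = v , unpack (T-bit v) (bit v L₁) (bit v L₂) nz
          where
          unpack : ∀ {a b c} → Bit a → Bit b → Bit c → a * (b * (1 ∸ c)) ≢ 0 → a ≡ 1 × b ≡ 1 × c ≡ 0
          unpack O _ _ h = ⊥-elim (h refl)
          unpack I O _ h = ⊥-elim (h refl)
          unpack I I O h = refl , refl , refl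
          unpack I I I h = ⊥-elim (h refl)
        ... | inj₁ z = ⊥-elim (1+n≰n (≤-trans x₁≥2 (≤-trans (∑-mono pts λ p →
                         pointwise (T-bit p) (bit p L₁) (bit p L₂) (z p)) e₁₂≤1)))
          where
          pointwise : ∀ {a b c} → Bit a → Bit b → Bit c → a * (b * (1 ∸ c)) ≡ 0 → a * b ≤ a * (b * c)
          pointwise O _ _ _ = z≤n
          pointwise I O _ _ = z≤n
          pointwise I I O ()
          pointwise I I I _ = ≤-refl

        -- The inequality is used at a point of `T` on `L₁` but not on `L₂`. Every other line
        -- through it has δ ≤ 2, where δ(δ - 1) ≤ 2(δ - 1), and δ - 1 summed over all lines through
        -- the point is t - 1.
        key : q * q + q + 2 * x₁ ≤ falling x₁ + 2 * t
        key with private-point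
        ... | v , Tv , i₁ , i₂ = begin
          q * q + q + 2 * x₁
            ≤⟨ +-monoˡ-≤ (2 * x₁) (star v Tv) ⟩
          S + 2 * x₁
            ≡⟨ cong (S +_) (trans (cong (2 *_) (sym (m∸n+n≡m (≤-trans (s≤s z≤n) x₁≥2)))) (*-distribˡ-+ 2 (x₁ ∸ 1) 1)) ⟩
          S + (2 * (x₁ ∸ 1) + 2)
            ≡⟨ sym (+-assoc S _ 2) ⟩
          S + 2 * (x₁ ∸ 1) + 2
            ≡⟨ cong (λ z → S + z + 2) (sym (∑L-pick L₁ λ M → 2 * (δ M ∸ 1))) ⟩
          S + ∑L (λ M → 𝟙 (L₁ ≟L M) * (2 * (δ M ∸ 1))) + 2
            ≡⟨ cong (_+ 2) (sym (∑-+ lns _ _)) ⟩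
          ∑L (λ M → inc v M * falling (δ M) + 𝟙 (L₁ ≟L M) * (2 * (δ M ∸ 1))) + 2
            ≤⟨ +-monoˡ-≤ 2 (∑-mono lns pointwise) ⟩
          ∑L (λ M → 𝟙 (L₁ ≟L M) * falling (δ M) + 2 * (inc v M * (δ M ∸ 1))) + 2
            ≡⟨ cong (_+ 2) (trans (∑-+ lns _ _) (cong₂ _+_ (∑L-pick L₁ λ M → falling (δ M)) (∑-*ˡ lns 2 _))) ⟩
          falling x₁ + 2 * S1 + 2
            ≡⟨ lem (falling x₁) S1 ⟩
          falling x₁ + 2 * (S1 + 1)
            ≡⟨ cong (λ z → falling x₁ + 2 * z) (∑-δ∸1-through v Tv) ⟩
          falling x₁ + 2 * t ∎
          where
          open ≤-Reasoning
          S = ∑L (λ M → inc v M * falling (δ M))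
          S1 = ∑L (λ M → inc v M * (δ M ∸ 1))
          lem : ∀ a b → a + 2 * b + 2 ≡ a + 2 * (b + 1)
          lem = solve-∀
          small : ∀ n → n ≤ 2 → falling n ≤ 2 * (n ∸ 1)
          small 0 _ = z≤n
          small 1 _ = z≤n
          small 2 _ = ≤-refl
          small (suc (suc (suc _))) (s≤s (s≤s ()))
          pointwise : ∀ M → inc v M * falling (δ M) + 𝟙 (L₁ ≟L M) * (2 * (δ M ∸ 1))
                          ≤ 𝟙 (L₁ ≟L M) * falling (δ M) + 2 * (inc v M * (δ M ∸ 1))
          pointwise M with L₁ ≟L M
          ... | yes refl rewrite i₁ = ≤-reflexive (lem₁ (falling (δ L₁)) (δ L₁ ∸ 1))
            where
            lem₁ : ∀ a b → a + 0 + (2 * b + 0) ≡ a + 0 + 2 * (b + 0)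
            lem₁ = solve-∀
          ... | no n₁ with L₂ ≟L M
          ...   | yes refl rewrite i₂ = z≤n
          ...   | no n₂ = ≤-trans (≤-reflexive (+-identityʳ _)) (≤-trans (*-monoʳ-≤ (inc v M) (small (δ M) (other≤2 M n₁ n₂)))
                            (≤-reflexive (lem₂ (inc v M) (δ M ∸ 1))))
            where
            lem₂ : ∀ a b → a * (2 * b) ≡ 2 * (a * b)
            lem₂ = solve-∀

        full-line : ∀ L → δ L ≡ q + 1 → ∀ p → T p * inc p L ≡ inc p L
        full-line L e p = ∑-tight pts {λ p → T p * inc p L} {λ p → inc p L}
          (λ p → Bit-*-≤ (T-bit p) (inc p L)) (trans e (sym (points-on L))) p (∈pts p)

        full⇒blocking : ∀ L → δ L ≡ q + 1 → ∀ M → 1 ≤ δ M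
        full⇒blocking L e M with L ≟L M
        ... | yes refl = subst (1 ≤_) (sym e) (m≤n+m 1 q)
        ... | no L≢M = begin
          1 ≡⟨ sym (meet L M L≢M) ⟩
          ∑P (λ p → inc p L * inc p M) ≡⟨ ∑-cong pts (λ p → cong (_* inc p M) (sym (full-line L e p))) ⟩
          ∑P (λ p → T p * inc p L * inc p M) ≤⟨ ∑-mono pts (λ p → drop (T p) (bit p L) (inc p M)) ⟩
          δ M ∎
          where
          open ≤-Reasoning
          drop : ∀ a {b} → Bit b → ∀ c → a * b * c ≤ a * c
          drop a O c = ≤-trans (≤-reflexive (cong (_* c) (*-zeroʳ a))) z≤n
          drop a I c = ≤-reflexive (cong (_* c) (*-identityʳ a))

        full⇒e₁₂ : x₁ ≡ q + 1 ⊎ x₂ ≡ q + 1 → e₁₂ ≡ 1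
        full⇒e₁₂ (inj₁ e) = trans (∑-cong pts λ p → trans (sym (*-assoc (T p) _ _)) (cong (_* inc p L₂) (full-line L₁ e p))) (meet L₁ L₂ L₁≢L₂)
        full⇒e₁₂ (inj₂ e) = trans (∑-cong pts λ p → trans (lem (T p) (inc p L₁) (inc p L₂)) (cong (inc p L₁ *_) (full-line L₂ e p))) (meet L₁ L₂ L₁≢L₂)
          where
          lem : ∀ a b c → a * (b * c) ≡ b * (a * c)
          lem = solve-∀

        -- Here f measures how far a line other than `L₁` and `L₂` falls short of two points of `T`;
        -- since Σ δ is known, its total is too. It is taken as the indicator of δ = 1 in one case
        -- and as twice the indicator of δ = 0 in the other.
        ∑-two-lines : (f : Ln → ℕ) → (∀ M → L₁ ≢ M → L₂ ≢ M → f M + δ M ≡ 2) →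
                      (∀ M → δ M ≡ x₁ ⊎ δ M ≡ x₂ → f M ≡ 0) →
                      ∑L f + t * (q + 1) + 4 ≡ 2 * (q * q + q + 1) + (x₁ + x₂)
        ∑-two-lines f other zero₁₂ = begin
          ∑L f + t * (q + 1) + 4
            ≡⟨ cong₂ _+_ (cong (∑L f +_) (sym ∑-δ)) (sym (cong₂ _+_ (∑L-pick L₁ λ _ → 2) (∑L-pick L₂ λ _ → 2))) ⟩
          ∑L f + ∑L δ + (∑L (λ M → 𝟙 (L₁ ≟L M) * 2) + ∑L (λ M → 𝟙 (L₂ ≟L M) * 2))
            ≡⟨ sym (trans (∑-+ lns _ _) (cong₂ _+_ (∑-+ lns f δ) (∑-+ lns _ _))) ⟩
          ∑L (λ M → f M + δ M + (𝟙 (L₁ ≟L M) * 2 + 𝟙 (L₂ ≟L M) * 2))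
            ≡⟨ ∑-cong lns pointwise ⟩
          ∑L (λ M → 2 + (𝟙 (L₁ ≟L M) * δ M + 𝟙 (L₂ ≟L M) * δ M))
            ≡⟨ trans (∑-+ lns _ _) (cong₂ _+_ (trans (∑-const lns 2) (trans (cong (_* 2) size) (*-comm (q * q + q + 1) 2))) (trans (∑-+ lns _ _) (cong₂ _+_ (∑L-pick L₁ δ) (∑L-pick L₂ δ)))) ⟩
          2 * (q * q + q + 1) + (x₁ + x₂) ∎
          where
          open ≡-Reasoning
          pointwise : ∀ M → f M + δ M + (𝟙 (L₁ ≟L M) * 2 + 𝟙 (L₂ ≟L M) * 2)
                          ≡ 2 + (𝟙 (L₁ ≟L M) * δ M + 𝟙 (L₂ ≟L M) * δ M)
          pointwise M with L₁ ≟L M | L₂ ≟L M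
          ... | yes refl | yes e = ⊥-elim (L₁≢L₂ (sym e))
          ... | yes refl | no _  = trans (cong (λ z → z + δ M + 2) (zero₁₂ M (inj₁ refl))) (lem (δ M))
            where
            lem : ∀ a → a + 2 ≡ 2 + (a + 0 + 0)
            lem = solve-∀
          ... | no _ | yes refl  = trans (cong (λ z → z + δ M + 2) (zero₁₂ M (inj₂ refl))) (lem (δ M))
            where
            lem : ∀ a → a + 2 ≡ 2 + (a + 0)
            lem = solve-∀
          ... | no n₁ | no n₂ = trans (+-identityʳ _) (other M n₁ n₂)

        blocking-shape : (∀ M → 1 ≤ δ M) → A₁ + t * (q + 1) + 4 ≡ 2 * (q * q + q + 1) + (x₁ + x₂)
        blocking-shape b = ∑-two-lines (λ M → 𝟙 (δ M ≟ 1)) (λ M n₁ n₂ → one-two (δ M) (b M) (other≤2 M n₁ n₂))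
            (λ M e → 𝟙-no (δ M ≟ 1) (big e))
          where
          one-two : ∀ n → 1 ≤ n → n ≤ 2 → 𝟙 (n ≟ 1) + n ≡ 2
          one-two 1 _ _ = refl
          one-two 2 _ _ = refl
          one-two (suc (suc (suc _))) _ (s≤s (s≤s ()))
          large : ∀ {x y} → q ≤ x + 13 → y ≡ x → y ≢ 1
          large h e refl = 1+n≰n (≤-trans (≤-trans (m≤m+n 15 2033) q≥2048) (subst (λ z → q ≤ z + 13) (sym e) h))
          big : ∀ {M} → δ M ≡ x₁ ⊎ δ M ≡ x₂ → δ M ≢ 1
          big (inj₁ e) = large h₁ e
          big (inj₂ e) = large h₂ e

        module Even (e₁ : x₁ ≡ q) (e₂ : x₂ ≡ q) (e₁₂≡0 : e₁₂ ≡ 0) where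

          T-off-meet : ∀ p → T p * (inc p L₁ * inc p L₂) ≡ 0
          T-off-meet p = n≤0⇒n≡0 (subst (T p * (inc p L₁ * inc p L₂) ≤_) e₁₂≡0
            (Fi.f≤∑∀ finPt (λ p → T p * (inc p L₁ * inc p L₂)) p))

          all-but-meet : ∀ L → δ L ≡ q → (∀ p → T p * inc p L + inc p L₁ * inc p L₂ ≤ inc p L) →
                         ∀ p → T p * inc p L + inc p L₁ * inc p L₂ ≡ inc p L
          all-but-meet L e h p = ∑-tight pts {λ p → T p * inc p L + inc p L₁ * inc p L₂} {λ p → inc p L} h
            (trans (∑-+ pts _ _) (trans (cong₂ _+_ e (meet L₁ L₂ L₁≢L₂)) (sym (points-on L)))) p (∈pts p)

          on-L₁ : ∀ p → T p * inc p L₁ + inc p L₁ * inc p L₂ ≡ inc p L₁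
          on-L₁ = all-but-meet L₁ e₁ λ p → pointwise (T-bit p) (bit p L₁) (bit p L₂) (T-off-meet p)
            where
            pointwise : ∀ {a b c} → Bit a → Bit b → Bit c → a * (b * c) ≡ 0 → a * b + b * c ≤ b
            pointwise O O _ _ = z≤n
            pointwise O I O _ = z≤n
            pointwise O I I _ = ≤-refl
            pointwise I O _ _ = z≤n
            pointwise I I O _ = ≤-refl
            pointwise I I I ()

          on-L₂ : ∀ p → T p * inc p L₂ + inc p L₁ * inc p L₂ ≡ inc p L₂
          on-L₂ = all-but-meet L₂ e₂ λ p → pointwise (T-bit p) (bit p L₁) (bit p L₂) (T-off-meet p)
            where
            pointwise : ∀ {a b c} → Bit a → Bit b → Bit c → a * (b * c) ≡ 0 → a * c + b * c ≤ c
            pointwise O O _ _ = z≤n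
            pointwise O I O _ = z≤n
            pointwise O I I _ = ≤-refl
            pointwise I O O _ = z≤n
            pointwise I O I _ = ≤-refl
            pointwise I I O _ = z≤n
            pointwise I I I ()

          -- A line through the missing intersection meets neither of the two punctured lines, and
          -- any other line meets each of them once; `e` is 1 in the first case.
          other-even : ∀ M → L₁ ≢ M → L₂ ≢ M → ∃ λ e → δ M + 2 * e ≡ 2
          other-even M n₁ n₂ = e , (begin
            δ M + 2 * e
              ≡⟨ cong (δ M +_) (sym (∑-*ˡ pts 2 _)) ⟩
            δ M + ∑P (λ p → 2 * (inc p L₁ * inc p L₂ * inc p M))
              ≡⟨ sym (∑-+ pts _ _) ⟩
            ∑P (λ p → T p * inc p M + 2 * (inc p L₁ * inc p L₂ * inc p M))
              ≡⟨ ∑-cong pts pointwise ⟩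
            ∑P (λ p → inc p L₁ * inc p M + inc p L₂ * inc p M)
              ≡⟨ ∑-+ pts _ _ ⟩
            ∑P (λ p → inc p L₁ * inc p M) + ∑P (λ p → inc p L₂ * inc p M)
              ≡⟨ cong₂ _+_ (meet L₁ M n₁) (meet L₂ M n₂) ⟩
            2 ∎)
            where
            open ≡-Reasoning
            e = ∑P λ p → inc p L₁ * inc p L₂ * inc p M
            T-split : ∀ {a b c} → Bit a → Bit b → Bit c → a ≤ b + c → a * (b * c) ≡ 0 → a ≡ a * b + a * c
            T-split O _ _ _ _ = refl
            T-split I O O () _
            T-split I I O _ _ = refl
            T-split I O I _ _ = refl
            T-split I I I _ ()
            lem : ∀ a b c d → (a + b) * c + 2 * (d * c) ≡ ((a + d) + (b + d)) * c
            lem = solve-∀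
            pointwise : ∀ p → T p * inc p M + 2 * (inc p L₁ * inc p L₂ * inc p M) ≡ inc p L₁ * inc p M + inc p L₂ * inc p M
            pointwise p = begin
              T p * inc p M + 2 * (inc p L₁ * inc p L₂ * inc p M)
                ≡⟨ cong (λ z → z * inc p M + 2 * (inc p L₁ * inc p L₂ * inc p M)) (T-split (T-bit p) (bit p L₁) (bit p L₂) (T⊆ p) (T-off-meet p)) ⟩
              (T p * inc p L₁ + T p * inc p L₂) * inc p M + 2 * (inc p L₁ * inc p L₂ * inc p M)
                ≡⟨ lem (T p * inc p L₁) (T p * inc p L₂) (inc p M) (inc p L₁ * inc p L₂) ⟩
              ((T p * inc p L₁ + inc p L₁ * inc p L₂) + (T p * inc p L₂ + inc p L₁ * inc p L₂)) * inc p M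
                ≡⟨ cong (_* inc p M) (cong₂ _+_ (on-L₁ p) (on-L₂ p)) ⟩
              (inc p L₁ + inc p L₂) * inc p M
                ≡⟨ *-distribʳ-+ (inc p M) (inc p L₁) (inc p L₂) ⟩
              inc p L₁ * inc p M + inc p L₂ * inc p M ∎

          zero-or-two : ∀ n e → n + 2 * e ≡ 2 → 2 * 𝟙 (n ≟ 0) + n ≡ 2 × n ≢ 1
          zero-or-two 0 e _ = refl , λ ()
          zero-or-two 1 zero ()
          zero-or-two 1 (suc zero) ()
          zero-or-two 1 (suc (suc e)) ()
          zero-or-two 2 e _ = refl , λ ()
          zero-or-two (suc (suc (suc n))) e ()

          q≢ : ∀ {n} → n < 2048 → q ≢ n
          q≢ h refl = 1+n≰n (≤-trans h q≥2048)

          even-shape : t ≡ 2 * q → Shape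
          even-shape t≡ = even t≡ (*-cancelˡ-≡ (A₀ + 1) q 2 count) not-one
            where
            not-one : ∀ M → δ M ≢ 1
            not-one M with L₁ ≟L M | L₂ ≟L M
            ... | yes refl | _ = λ e → q≢ {1} (s≤s (s≤s z≤n)) (trans (sym e₁) e)
            ... | no _ | yes refl = λ e → q≢ {1} (s≤s (s≤s z≤n)) (trans (sym e₂) e)
            ... | no n₁ | no n₂ with other-even M n₁ n₂
            ...   | e , h = proj₂ (zero-or-two (δ M) e h)
            raw : ∑L (λ M → 2 * 𝟙 (δ M ≟ 0)) + t * (q + 1) + 4 ≡ 2 * (q * q + q + 1) + (x₁ + x₂)
            raw = ∑-two-lines (λ M → 2 * 𝟙 (δ M ≟ 0))
              (λ M n₁ n₂ → proj₁ (zero-or-two (δ M) (proj₁ (other-even M n₁ n₂)) (proj₂ (other-even M n₁ n₂))))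
              (λ M e → cong (2 *_) (𝟙-no (δ M ≟ 0) λ z → q≢ {0} (s≤s z≤n) (trans (sym (is-q e)) z)))
              where
              is-q : ∀ {M} → δ M ≡ x₁ ⊎ δ M ≡ x₂ → δ M ≡ q
              is-q (inj₁ e) = trans e e₁
              is-q (inj₂ e) = trans e e₂
            open ≡-Reasoning
            count : 2 * (A₀ + 1) ≡ 2 * q
            count = +-cancelʳ-≡ (2 * q * (q + 1) + 2) _ _ (begin
              2 * (A₀ + 1) + (2 * q * (q + 1) + 2) ≡⟨ lem₁ A₀ q ⟩
              2 * A₀ + 2 * q * (q + 1) + 4 ≡⟨ cong₂ (λ a b → a + b * (q + 1) + 4) (sym (∑-*ˡ lns 2 _)) (sym t≡) ⟩
              ∑L (λ M → 2 * 𝟙 (δ M ≟ 0)) + t * (q + 1) + 4 ≡⟨ raw ⟩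
              2 * (q * q + q + 1) + (x₁ + x₂) ≡⟨ cong₂ (λ a b → 2 * (q * q + q + 1) + (a + b)) e₁ e₂ ⟩
              2 * (q * q + q + 1) + (q + q) ≡⟨ lem₂ q ⟩
              2 * q + (2 * q * (q + 1) + 2) ∎)
              where
              lem₁ : ∀ a q → 2 * (a + 1) + (2 * q * (q + 1) + 2) ≡ 2 * a + 2 * q * (q + 1) + 4
              lem₁ = solve-∀
              lem₂ : ∀ q → 2 * (q * q + q + 1) + (q + q) ≡ 2 * q + (2 * q * (q + 1) + 2)
              lem₂ = solve-∀

      -- Inserting the bound on t leaves (q - 2)(q + 1) ≤ x(x - 1), which fails for x ≤ q - 1. At x
      -- = q the inequality itself reads 4q ≤ 2t.
      near-full : ∀ x → 3 ≤ x → x ≤ q + 1 → t ≤ x + (q + 1) → q * q + q + 2 * x ≤ falling x + 2 * t →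
                  (x ≡ q × 2 * q ≤ t) ⊎ x ≡ q + 1
      near-full x x≥3 x≤ t≤ key with x ≟ q + 1
      ... | yes e = inj₂ e
      ... | no x≢ with x ≟ q
      ...   | yes refl = inj₁ (refl , *-cancelˡ-≤ 2 (+-cancelˡ-≤ (falling q) _ _ (begin
                falling q + 2 * (2 * q) ≡⟨ lem (falling q) q ⟩
                falling q + q + q + 2 * q ≡⟨ cong (λ z → z + q + 2 * q) (falling-square q) ⟩
                q * q + q + 2 * q ≤⟨ key ⟩
                falling q + 2 * t ∎)))
            where
            open ≤-Reasoning
            lem : ∀ a q → a + 2 * (2 * q) ≡ a + q + q + 2 * q
            lem = solve-∀
      ...   | no x≢q with m≤n⇒∃[o]m+o≡n (≤∧≢⇒< (≤-pred (subst (suc x ≤_) (+-comm q 1) (≤∧≢⇒< x≤ x≢))) x≢q)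
      ...     | e , refl = ⊥-elim (1+n≰n (≤-trans gap (+-cancelʳ-≤ (2 * x + x) _ _ (begin
                Q * Q + Q + (2 * x + x) ≡⟨ sym (+-assoc (Q * Q + Q) (2 * x) x) ⟩
                Q * Q + Q + 2 * x + x ≤⟨ +-monoˡ-≤ x key ⟩
                falling x + 2 * t + x ≤⟨ +-monoˡ-≤ x (+-monoʳ-≤ (falling x) (*-monoʳ-≤ 2 t≤)) ⟩
                falling x + 2 * (x + (Q + 1)) + x ≡⟨ lem₁ (falling x) x Q ⟩
                falling x + x + (2 * (Q + 1) + 2 * x) ≡⟨ cong (_+ (2 * (Q + 1) + 2 * x)) (falling-square x) ⟩
                x * x + (2 * (Q + 1) + 2 * x) ≤⟨ m≤m+n _ (x + 0) ⟩
                x * x + (2 * (Q + 1) + 2 * x) + (x + 0) ≡⟨ lem₂ x Q ⟩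
                x * x + 2 * (Q + 1) + (2 * x + x) ∎))))
            where
            open ≤-Reasoning
            Q = suc x + e
            lem₁ : ∀ a x Q → a + 2 * (x + (Q + 1)) + x ≡ a + x + (2 * (Q + 1) + 2 * x)
            lem₁ = solve-∀
            lem₂ : ∀ x Q → x * x + (2 * (Q + 1) + 2 * x) + (x + 0) ≡ x * x + 2 * (Q + 1) + (2 * x + x)
            lem₂ = solve-∀
            gap : suc (x * x + 2 * (Q + 1)) ≤ Q * Q + Q
            gap = begin
              suc (x * x + 2 * (Q + 1)) ≡⟨ lem₃ x e ⟩
              x * x + 3 + (e + 1 + x) + suc x + e ≤⟨ +-monoˡ-≤ e (+-monoˡ-≤ (suc x) (+-monoˡ-≤ (e + 1 + x) (+-monoʳ-≤ (x * x) x≥3))) ⟩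
              x * x + x + (e + 1 + x) + suc x + e ≤⟨ m≤m+n _ (e * e + 2 * x * e + e) ⟩
              x * x + x + (e + 1 + x) + suc x + e + (e * e + 2 * x * e + e) ≡⟨ lem₄ x e ⟩
              Q * Q + Q ∎
              where
              lem₃ : ∀ x e → suc (x * x + 2 * (suc x + e + 1)) ≡ x * x + 3 + (e + 1 + x) + suc x + e
              lem₃ = solve-∀
              lem₄ : ∀ x e → x * x + x + (e + 1 + x) + suc x + e + (e * e + 2 * x * e + e) ≡ (suc x + e) * (suc x + e) + (suc x + e)
              lem₄ = solve-∀

      -- Each line carries q or q + 1 points of `T`. If both carry q, then t ≥ 2q leaves no room for
      -- a shared point, so what both lack is their intersection.
      two-lines-shape : (L₁ L₂ : Ln) → L₁ ≢ L₂ → q ≤ δ L₁ + 13 → q ≤ δ L₂ + 13 →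
                        (∀ p → T p ≤ inc p L₁ + inc p L₂) → Shape
      two-lines-shape L₁ L₂ L₁≢L₂ h₁ h₂ T⊆ = cases (near-full x₁ (≥3 h₁) (δ≤q+1 L₁) t≤₁ key)
                                                (near-full x₂ (≥3 h₂) (δ≤q+1 L₂) t≤₂ S.key)
        where
        open TwoLines L₁ L₂ L₁≢L₂ h₁ h₂ T⊆
        module S = TwoLines L₂ L₁ (λ e → L₁≢L₂ (sym e)) h₂ h₁ (λ p → subst (T p ≤_) (+-comm (inc p L₁) (inc p L₂)) (T⊆ p))
        ≥3 : ∀ {x} → q ≤ x + 13 → 3 ≤ x
        ≥3 {x} h = +-cancelʳ-≤ 13 3 x (≤-trans (≤-trans (m≤m+n 16 2032) q≥2048) h)
        t≤ : t ≤ x₁ + x₂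
        t≤ = ≤-trans (m≤m+n t e₁₂) (≤-reflexive t+e₁₂)
        t≤₁ : t ≤ x₁ + (q + 1)
        t≤₁ = ≤-trans t≤ (+-monoʳ-≤ x₁ (δ≤q+1 L₂))
        t≤₂ : t ≤ x₂ + (q + 1)
        t≤₂ = ≤-trans t≤ (≤-trans (≤-reflexive (+-comm x₁ x₂)) (+-monoʳ-≤ x₂ (δ≤q+1 L₁)))
        open ≡-Reasoning

        mixed : x₁ ≡ q + 1 ⊎ x₂ ≡ q + 1 → x₁ + x₂ ≡ 2 * q + 1 → Shape
        mixed e e′ = blocking b (inj₂ (t≡ , +-cancelʳ-≡ (2 * q * (q + 1) + 3) _ _ (begin
            A₁ + 1 + (2 * q * (q + 1) + 3) ≡⟨ lem₁ A₁ q ⟩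
            A₁ + 2 * q * (q + 1) + 4 ≡⟨ cong (λ z → A₁ + z * (q + 1) + 4) (sym t≡) ⟩
            A₁ + t * (q + 1) + 4 ≡⟨ blocking-shape b ⟩
            2 * (q * q + q + 1) + (x₁ + x₂) ≡⟨ cong (2 * (q * q + q + 1) +_) e′ ⟩
            2 * (q * q + q + 1) + (2 * q + 1) ≡⟨ lem₂ q ⟩
            2 * q + (2 * q * (q + 1) + 3) ∎)))
          where
          b : ∀ M → 1 ≤ δ M
          b = full e
            where
            full : x₁ ≡ q + 1 ⊎ x₂ ≡ q + 1 → ∀ M → 1 ≤ δ M
            full (inj₁ e) = full⇒blocking L₁ e
            full (inj₂ e) = full⇒blocking L₂ e
          t≡ : t ≡ 2 * q
          t≡ = +-cancelʳ-≡ 1 _ _ (trans (cong (t +_) (sym (full⇒e₁₂ e))) (trans t+e₁₂ e′))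
          lem₁ : ∀ a q → a + 1 + (2 * q * (q + 1) + 3) ≡ a + 2 * q * (q + 1) + 4
          lem₁ = solve-∀
          lem₂ : ∀ q → 2 * (q * q + q + 1) + (2 * q + 1) ≡ 2 * q + (2 * q * (q + 1) + 3)
          lem₂ = solve-∀

        cases : (x₁ ≡ q × 2 * q ≤ t) ⊎ x₁ ≡ q + 1 → (x₂ ≡ q × 2 * q ≤ t) ⊎ x₂ ≡ q + 1 → Shape
        cases (inj₂ f₁) (inj₂ f₂) = blocking (full⇒blocking L₁ f₁) (inj₁ (t≡ , +-cancelʳ-≡ ((2 * q + 1) * (q + 1) + 3) _ _ (begin
            A₁ + 1 + ((2 * q + 1) * (q + 1) + 3) ≡⟨ lem₁ A₁ q ⟩
            A₁ + (2 * q + 1) * (q + 1) + 4 ≡⟨ cong (λ z → A₁ + z * (q + 1) + 4) (sym t≡) ⟩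
            A₁ + t * (q + 1) + 4 ≡⟨ blocking-shape (full⇒blocking L₁ f₁) ⟩
            2 * (q * q + q + 1) + (x₁ + x₂) ≡⟨ cong₂ (λ a b → 2 * (q * q + q + 1) + (a + b)) f₁ f₂ ⟩
            2 * (q * q + q + 1) + (q + 1 + (q + 1)) ≡⟨ lem₂ q ⟩
            q + ((2 * q + 1) * (q + 1) + 3) ∎)))
          where
          t≡ : t ≡ 2 * q + 1
          t≡ = +-cancelʳ-≡ 1 _ _ (begin
            t + 1 ≡⟨ cong (t +_) (sym (full⇒e₁₂ (inj₁ f₁))) ⟩
            t + e₁₂ ≡⟨ t+e₁₂ ⟩
            x₁ + x₂ ≡⟨ cong₂ _+_ f₁ f₂ ⟩
            q + 1 + (q + 1) ≡⟨ lem q ⟩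
            2 * q + 1 + 1 ∎)
            where
            lem : ∀ q → q + 1 + (q + 1) ≡ 2 * q + 1 + 1
            lem = solve-∀
          lem₁ : ∀ a q → a + 1 + ((2 * q + 1) * (q + 1) + 3) ≡ a + (2 * q + 1) * (q + 1) + 4
          lem₁ = solve-∀
          lem₂ : ∀ q → 2 * (q * q + q + 1) + (q + 1 + (q + 1)) ≡ q + ((2 * q + 1) * (q + 1) + 3)
          lem₂ = solve-∀
        cases (inj₁ (e₁ , _)) (inj₂ f₂) = mixed (inj₂ f₂) (trans (cong₂ _+_ e₁ f₂) (lem q))
          where
          lem : ∀ q → q + (q + 1) ≡ 2 * q + 1
          lem = solve-∀
        cases (inj₂ f₁) (inj₁ (e₂ , _)) = mixed (inj₁ f₁) (trans (cong₂ _+_ f₁ e₂) (lem q))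
          where
          lem : ∀ q → q + 1 + q ≡ 2 * q + 1
          lem = solve-∀
        cases (inj₁ (e₁ , 2q≤t)) (inj₁ (e₂ , _)) = Even.even-shape e₁ e₂ e₁₂≡0 t≡
          where
          sum : t + e₁₂ ≡ 2 * q
          sum = trans t+e₁₂ (trans (cong₂ _+_ e₁ e₂) (cong (q +_) (sym (+-identityʳ q))))
          t≡ : t ≡ 2 * q
          t≡ = ≤-antisym (≤-trans (m≤m+n t e₁₂) (≤-reflexive sum)) 2q≤t
          e₁₂≡0 : e₁₂ ≡ 0
          e₁₂≡0 = +-cancelˡ-≡ t _ _ (trans sum (trans (sym t≡) (sym (+-identityʳ t))))

      -- A point of `T` yields a heavy line, a point of `T` off that line yields a second one, and a
      -- point of `T` off both would yield a third.
      shape : Shape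
      shape with zero⊎∃P T
      ... | inj₁ z = empty (∑-zero-∈ pts λ p _ → z p)
      ... | inj₂ (v₁ , nz₁) with third-line v₁ (Bit-≢0 (T-bit v₁) nz₁)
      ...   | L₁ , i₁ , third₁ with zero⊎∃P (λ p → T p ∸ inc p L₁)
      ...     | inj₁ z = line (in-one-line v₁ L₁ (Bit-≢0 (T-bit v₁) nz₁) i₁ (λ p → m∸n≡0⇒m≤n (z p)))
      ...     | inj₂ (v₂ , nz₂) with off (T-bit v₂) (bit v₂ L₁) nz₂
        where
        off : ∀ {a b} → Bit a → Bit b → a ∸ b ≢ 0 → a ≡ 1 × b ≡ 0
        off O O h = ⊥-elim (h refl)
        off O I h = ⊥-elim (h refl)
        off I O h = refl , refl
        off I I h = ⊥-elim (h refl)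
      ...       | Tv₂ , v₂∉L₁ with third-line v₂ Tv₂
      ...         | L₂ , i₂ , third₂ = two-lines-shape L₁ L₂ L₁≢L₂ (heavy L₁ third₁) (heavy L₂ third₂) covered
        where
        differ : ∀ v {L M} → inc v L ≡ 0 → inc v M ≡ 1 → L ≢ M
        differ v e f refl = 1+n≢0 (trans (sym f) e)
        L₁≢L₂ : L₁ ≢ L₂
        L₁≢L₂ = differ v₂ v₂∉L₁ i₂
        covered : ∀ p → T p ≤ inc p L₁ + inc p L₂
        covered p with Bit-split (T-bit p) | Bit-split (bit p L₁) | Bit-split (bit p L₂)
        ... | inj₁ e | _ | _ = subst (_≤ inc p L₁ + inc p L₂) (sym e) z≤n
        ... | inj₂ e | inj₂ f | _ = subst₂ _≤_ (sym e) (cong (_+ inc p L₂) (sym f)) (s≤s z≤n)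
        ... | inj₂ e | inj₁ _ | inj₂ f = subst₂ _≤_ (sym e) (cong (inc p L₁ +_) (sym f)) (m≤n+m 1 (inc p L₁))
        ... | inj₂ e | inj₁ f₁ | inj₁ f₂ with third-line p e
        ...   | L₃ , i₃ , third₃ = ⊥-elim (not-three-heavy L₁ L₂ L₃ L₁≢L₂ (differ p f₁ i₃) (differ p f₂ i₃)
                                     (heavy L₁ third₁) (heavy L₂ third₂) (heavy L₃ third₃))

-- Finite fields of characteristic 2, products over them, and divided differences.

module Characteristic2 where
  open ≡ using (refl; sym; trans; cong; cong₂)
  open import Data.List.Relation.Binary.Permutation.Propositional using (_↭_; refl; prep; swap; ↭-sym)
  open Counting

  Unique-resp-↭ : {A : Set} {xs ys : List A} → xs ↭ ys → Unique xs → Unique ys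
  Unique-resp-↭ refl u = u
  Unique-resp-↭ (prep x p) (n ∷ u) = All-resp-↭ p n ∷ Unique-resp-↭ p u
  Unique-resp-↭ (swap x y p) ((x≢y ∷ nx) ∷ ny ∷ u) =
    ((λ e → x≢y (sym e)) ∷ All-resp-↭ p ny) ∷ All-resp-↭ p nx ∷ Unique-resp-↭ p u
  Unique-resp-↭ (Perm.trans p r) u = Unique-resp-↭ r (Unique-resp-↭ p u)

  -- Turns equality of two sets into a permutation of lists, so that products over them can be
  -- compared.
  Unique-↭ : {A : Set} {xs ys : List A} → Unique xs → Unique ys →
             (∀ {x} → x ∈ xs → x ∈ ys) → (∀ {x} → x ∈ ys → x ∈ xs) → xs ↭ ys
  Unique-↭ {xs = []} {[]} _ _ _ _ = refl
  Unique-↭ {xs = []} {y ∷ ys} _ _ _ g with g (here refl)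
  ... | ()
  Unique-↭ {xs = x ∷ xs} {ys} (x∉ ∷ ux) uy f g with ∈-∃++ (f (here refl))
  ... | as , bs , refl = Perm.trans (prep x (Unique-↭ ux (tail-unique uy′) f′ g′)) (↭-sym sh)
    where
    sh = shift x as bs
    uy′ : Unique (x ∷ (as ++ bs))
    uy′ = Unique-resp-↭ sh uy
    tail-unique : Unique (x ∷ (as ++ bs)) → Unique (as ++ bs)
    tail-unique (_ ∷ u) = u
    head-fresh : Unique (x ∷ (as ++ bs)) → ∀ {y} → y ∈ as ++ bs → x ≢ y
    head-fresh (a ∷ _) = All.lookup a
    f′ : ∀ {y} → y ∈ xs → y ∈ as ++ bs
    f′ y∈ with ∈-resp-↭ sh (f (there y∈))
    ... | here refl = ⊥-elim (All.lookup x∉ y∈ refl)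
    ... | there h = h
    g′ : ∀ {y} → y ∈ as ++ bs → y ∈ xs
    g′ y∈ with g (∈-resp-↭ (↭-sym sh) (there y∈))
    ... | here refl = ⊥-elim (head-fresh uy′ y∈ refl)
    ... | there h = h

  module _ {A : Set} (FA : Finite A) where
    open Finite FA

    at-most-once⇒Unique : ∀ xs → (∀ x → ∑ xs (λ y → 𝟙 (x ≟ᶠ y)) ℕ.≤ 1) → Unique xs
    at-most-once⇒Unique [] _ = []
    at-most-once⇒Unique (x ∷ xs) h = All.tabulate fresh ∷
        at-most-once⇒Unique xs (λ y → ℕₚ.≤-trans (ℕₚ.m≤n+m _ _) (h y))
      where
      fresh : ∀ {y} → y ∈ xs → x ≢ y
      fresh y∈ refl = ℕₚ.1+n≰n (ℕₚ.≤-trans (ℕₚ.≤-trans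
        (ℕₚ.+-mono-≤ (ℕₚ.≤-reflexive (sym (𝟙-yes (x ≟ᶠ x) refl)))
          (ℕₚ.≤-trans (ℕₚ.≤-reflexive (sym (𝟙-yes (x ≟ᶠ x) refl))) (f≤∑ xs (λ y → 𝟙 (x ≟ᶠ y)) y∈)))
        ℕₚ.≤-refl) (h x))

    enum-unique : Unique enum
    enum-unique = at-most-once⇒Unique enum (λ x → ℕₚ.≤-reflexive (once x))

  -- With x + x = 0 every element is its own negative, so a commutative semiring suffices for ring
  -- structure. The inverse is total, so quotients are plain products.
  record Char2Field : Set₁ where
    infixl 6 _+_
    infixl 7 _*_
    field
      F      : Set
      finite : Finite F
      _+_ _*_ : F → F → F
      0# 1#  : F
      isCommutativeSemiring : IsCommutativeSemiring _≡_ _+_ _*_ 0# 1#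
      x+x≡0  : ∀ x → x + x ≡ 0#
      inv    : F → F
      inv-0  : inv 0# ≡ 0#
      *-inv  : ∀ {x} → x ≢ 0# → x * inv x ≡ 1#
      0≢1    : 0# ≢ 1#

  module FieldTheory (𝔽 : Char2Field) where
    open Char2Field 𝔽 public
    open Fi finite public using (∑∀; ∑-pick; ∑∀-bij; enum-complete; enum) renaming (_≟ᶠ_ to _≟_)
    open IsCommutativeSemiring isCommutativeSemiring public
      using (+-assoc; +-comm; +-identityˡ; +-identityʳ; *-assoc; *-comm; *-identityˡ; *-identityʳ; zeroˡ; zeroʳ; distribˡ; distribʳ)

    q : ℕ
    q = length enum

    private
      semiring : CommutativeSemiring 0ℓ 0ℓ
      semiring = record { isCommutativeSemiring = isCommutativeSemiring }

      𝔽₂ : RawRing 0ℓ 0ℓ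
      𝔽₂ = record { Carrier = Bool ; _≈_ = _≡_ ; _+_ = _xor_ ; _*_ = _∧_ ; -_ = λ x → x ; 0# = false ; 1# = true }

      ⟦_⟧₂ : Bool → F
      ⟦ true ⟧₂ = 1#
      ⟦ false ⟧₂ = 0#

      +-homo₂ : ∀ a b → ⟦ a xor b ⟧₂ ≡ ⟦ a ⟧₂ + ⟦ b ⟧₂
      +-homo₂ true true = sym (x+x≡0 1#)
      +-homo₂ true false = sym (+-identityʳ 1#)
      +-homo₂ false b = sym (+-identityˡ ⟦ b ⟧₂)

      *-homo₂ : ∀ a b → ⟦ a ∧ b ⟧₂ ≡ ⟦ a ⟧₂ * ⟦ b ⟧₂
      *-homo₂ true b = sym (*-identityˡ ⟦ b ⟧₂)
      *-homo₂ false b = sym (zeroˡ ⟦ b ⟧₂)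

      morphism : 𝔽₂ -Raw-AlmostCommutative⟶ fromCommutativeSemiring semiring
      morphism = record
        { ⟦_⟧ = ⟦_⟧₂ ; +-homo = +-homo₂ ; *-homo = *-homo₂ ; -‿homo = λ _ → refl ; 0-homo = refl ; 1-homo = refl }

      _≟₂_ : ∀ a b → Maybe (⟦ a ⟧₂ ≡ ⟦ b ⟧₂)
      true  ≟₂ true  = just refl
      false ≟₂ false = just refl
      _     ≟₂ _     = nothing

    -- Coefficients in the prime field, so that the solver knows x + x = 0.
    module Solver = Algebra.Solver.Ring 𝔽₂ (fromCommutativeSemiring semiring) morphism _≟₂_
    open Solver public using (solve; _:=_; _:+_; _:*_; con)

    x+y≡0⇒x≡y : ∀ {x y} → x + y ≡ 0# → x ≡ y
    x+y≡0⇒x≡y {x} {y} e = begin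
      x           ≡⟨ solve 2 (λ x y → x := x :+ y :+ y) refl x y ⟩
      x + y + y   ≡⟨ cong (_+ y) e ⟩
      0# + y      ≡⟨ +-identityˡ y ⟩
      y ∎
      where open ≡-Reasoning

    +-cancelʳ : ∀ {x y} z → x + z ≡ y + z → x ≡ y
    +-cancelʳ {x} {y} z e = trans (solve 2 (λ x z → x := x :+ z :+ z) refl x z)
      (trans (cong (_+ z) e) (solve 2 (λ x z → x :+ z :+ z := x) refl y z))

    x≢y⇒x+y≢0 : ∀ {x y} → x ≢ y → x + y ≢ 0#
    x≢y⇒x+y≢0 h e = h (x+y≡0⇒x≡y e)

    1≢0 : 1# ≢ 0#
    1≢0 e = 0≢1 (sym e)

    *-invˡ : ∀ {x} → x ≢ 0# → inv x * x ≡ 1#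
    *-invˡ h = trans (*-comm _ _) (*-inv h)

    *-cancel : ∀ {x y z} → x ≢ 0# → x * y ≡ x * z → y ≡ z
    *-cancel {x} {y} {z} h e = begin
      y                ≡⟨ sym (*-identityˡ y) ⟩
      1# * y           ≡⟨ cong (_* y) (sym (*-invˡ h)) ⟩
      inv x * x * y    ≡⟨ *-assoc (inv x) x y ⟩
      inv x * (x * y)  ≡⟨ cong (inv x *_) e ⟩
      inv x * (x * z)  ≡⟨ sym (*-assoc (inv x) x z) ⟩
      inv x * x * z    ≡⟨ cong (_* z) (*-invˡ h) ⟩
      1# * z           ≡⟨ *-identityˡ z ⟩
      z ∎
      where open ≡-Reasoning

    *≡0 : ∀ {x y} → x ≢ 0# → x * y ≡ 0# → y ≡ 0#
    *≡0 {x} h e = *-cancel h (trans e (sym (zeroʳ x)))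

    *≢0 : ∀ {x y} → x ≢ 0# → y ≢ 0# → x * y ≢ 0#
    *≢0 hx hy e = hy (*≡0 hx e)

    inv≢0 : ∀ {x} → x ≢ 0# → inv x ≢ 0#
    inv≢0 {x} h e = 0≢1 (trans (sym (zeroʳ x)) (trans (cong (x *_) (sym e)) (*-inv h)))

    inv-unique : ∀ {x y} → x * y ≡ 1# → inv x ≡ y
    inv-unique {x} {y} e = *-cancel x≢0 (trans (*-inv x≢0) (sym e))
      where
      x≢0 : x ≢ 0#
      x≢0 refl = 0≢1 (trans (sym (zeroˡ y)) e)

    inv-* : ∀ {x y} → x ≢ 0# → y ≢ 0# → inv (x * y) ≡ inv x * inv y
    inv-* {x} {y} hx hy = inv-unique (begin
      x * y * (inv x * inv y)   ≡⟨ solve 4 (λ x y x′ y′ → x :* y :* (x′ :* y′) := (x :* x′) :* (y :* y′)) refl x y (inv x) (inv y) ⟩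
      (x * inv x) * (y * inv y) ≡⟨ cong₂ _*_ (*-inv hx) (*-inv hy) ⟩
      1# * 1#                   ≡⟨ *-identityˡ 1# ⟩
      1# ∎)
      where open ≡-Reasoning

    -- Turns zero factors into 1, so that ∏ over j ≠ i of a nonzero expression vanishing
    -- only at j = i can be written as a product over all j.
    nz : F → F
    nz x with x ≟ 0#
    ... | yes _ = 1#
    ... | no _  = x

    nz-0 : nz 0# ≡ 1#
    nz-0 with 0# ≟ 0#
    ... | yes _ = refl
    ... | no h = ⊥-elim (h refl)

    nz-≢0 : ∀ {x} → x ≢ 0# → nz x ≡ x
    nz-≢0 {x} h with x ≟ 0#
    ... | yes e = ⊥-elim (h e)
    ... | no _ = refl

    nz≢0 : ∀ x → nz x ≢ 0#
    nz≢0 x with x ≟ 0#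
    ... | yes _ = 1≢0
    ... | no h = h

    ∏ : ∀ {A : Set} → List A → (A → F) → F
    ∏ [] f = 1#
    ∏ (x ∷ xs) f = f x * ∏ xs f

    ⨁ : ∀ {A : Set} → List A → (A → F) → F
    ⨁ [] f = 0#
    ⨁ (x ∷ xs) f = f x + ⨁ xs f

    module _ {A : Set} where

      ∏-cong : ∀ (xs : List A) {f g : A → F} → (∀ x → x ∈ xs → f x ≡ g x) → ∏ xs f ≡ ∏ xs g
      ∏-cong [] h = refl
      ∏-cong (x ∷ xs) h = cong₂ _*_ (h x (here refl)) (∏-cong xs λ y y∈ → h y (there y∈))

      ⨁-cong : ∀ (xs : List A) {f g : A → F} → (∀ x → x ∈ xs → f x ≡ g x) → ⨁ xs f ≡ ⨁ xs g
      ⨁-cong [] h = refl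
      ⨁-cong (x ∷ xs) h = cong₂ _+_ (h x (here refl)) (⨁-cong xs λ y y∈ → h y (there y∈))

      ∏-* : ∀ (xs : List A) (f g : A → F) → ∏ xs (λ x → f x * g x) ≡ ∏ xs f * ∏ xs g
      ∏-* [] f g = sym (*-identityˡ 1#)
      ∏-* (x ∷ xs) f g = trans (cong (f x * g x *_) (∏-* xs f g))
        (solve 4 (λ a b c d → a :* b :* (c :* d) := a :* c :* (b :* d)) refl (f x) (g x) (∏ xs f) (∏ xs g))

      ⨁-+ : ∀ (xs : List A) (f g : A → F) → ⨁ xs (λ x → f x + g x) ≡ ⨁ xs f + ⨁ xs g
      ⨁-+ [] f g = sym (+-identityˡ 0#)
      ⨁-+ (x ∷ xs) f g = trans (cong (f x + g x +_) (⨁-+ xs f g))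
        (solve 4 (λ a b c d → a :+ b :+ (c :+ d) := a :+ c :+ (b :+ d)) refl (f x) (g x) (⨁ xs f) (⨁ xs g))

      ⨁-*ˡ : ∀ (xs : List A) c (f : A → F) → ⨁ xs (λ x → c * f x) ≡ c * ⨁ xs f
      ⨁-*ˡ [] c f = sym (zeroʳ c)
      ⨁-*ˡ (x ∷ xs) c f = trans (cong (c * f x +_) (⨁-*ˡ xs c f)) (sym (distribˡ c (f x) _))

      ⨁-0 : ∀ (xs : List A) {f : A → F} → (∀ x → x ∈ xs → f x ≡ 0#) → ⨁ xs f ≡ 0#
      ⨁-0 [] h = refl
      ⨁-0 (x ∷ xs) h = trans (cong₂ _+_ (h x (here refl)) (⨁-0 xs λ y y∈ → h y (there y∈))) (+-identityˡ 0#)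

      ∏≢0 : ∀ (xs : List A) {f : A → F} → (∀ x → x ∈ xs → f x ≢ 0#) → ∏ xs f ≢ 0#
      ∏≢0 [] h = 1≢0
      ∏≢0 (x ∷ xs) h = *≢0 (h x (here refl)) (∏≢0 xs λ y y∈ → h y (there y∈))

      ∏-++ : ∀ (xs ys : List A) (f : A → F) → ∏ (xs ++ ys) f ≡ ∏ xs f * ∏ ys f
      ∏-++ [] ys f = sym (*-identityˡ _)
      ∏-++ (x ∷ xs) ys f = trans (cong (f x *_) (∏-++ xs ys f)) (sym (*-assoc (f x) _ _))

      ∏-↭ : ∀ {xs ys : List A} (f : A → F) → xs ↭ ys → ∏ xs f ≡ ∏ ys f
      ∏-↭ f refl = refl
      ∏-↭ f (prep x p) = cong (f x *_) (∏-↭ f p)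
      ∏-↭ f (swap x y p) = trans (cong (λ z → f x * (f y * z)) (∏-↭ f p))
        (solve 3 (λ a b c → a :* (b :* c) := b :* (a :* c)) refl (f x) (f y) _)
      ∏-↭ f (Perm.trans p r) = trans (∏-↭ f p) (∏-↭ f r)

      ∏-extract : ∀ (xs : List A) → Unique xs → ∀ {i} → i ∈ xs → (f g : A → F) → g i ≡ 1# →
                  (∀ l → l ∈ xs → l ≢ i → f l ≡ g l) → ∏ xs f ≡ f i * ∏ xs g
      ∏-extract (x ∷ xs) (x∉ ∷ u) (here refl) f g gi h = cong (f x *_)
        (trans (∏-cong xs λ l l∈ → h l (there l∈) λ e → All.lookup x∉ l∈ (sym e))
          (trans (sym (*-identityˡ _)) (cong (_* ∏ xs g) (sym gi))))
      ∏-extract (x ∷ xs) (x∉ ∷ u) {i} (there i∈) f g gi h = begin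
        f x * ∏ xs f         ≡⟨ cong₂ _*_ (h x (here refl) (All.lookup x∉ i∈)) (∏-extract xs u i∈ f g gi λ l l∈ → h l (there l∈)) ⟩
        g x * (f i * ∏ xs g) ≡⟨ solve 3 (λ a b c → a :* (b :* c) := b :* (a :* c)) refl (g x) (f i) _ ⟩
        f i * (g x * ∏ xs g) ∎
        where open ≡-Reasoning

      -- For products over the points of an arc in which the factors at the two points spanning a
      -- line are exceptional.
      ∏-extract₂ : ∀ (xs : List A) → Unique xs → ∀ {i j} → i ∈ xs → j ∈ xs → i ≢ j → (f g : A → F) →
                   g i ≡ 1# → g j ≡ 1# → (∀ l → l ∈ xs → l ≢ i → l ≢ j → f l ≡ g l) →
                   ∏ xs f ≡ f i * f j * ∏ xs g
      ∏-extract₂ _ _ (here refl) (here refl) i≢j = ⊥-elim (i≢j refl)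
      ∏-extract₂ (x ∷ xs) (x∉ ∷ u) {_} {j} (here refl) (there j∈) i≢j f g gi gj h = trans
        (cong (f x *_) (∏-extract xs u j∈ f g gj λ l l∈ → h l (there l∈) λ e → All.lookup x∉ l∈ (sym e)))
        (trans (sym (*-assoc (f x) (f j) _)) (cong (f x * f j *_) (trans (sym (*-identityˡ _)) (cong (_* ∏ xs g) (sym gi)))))
      ∏-extract₂ (x ∷ xs) (x∉ ∷ u) {i} (there i∈) (here refl) i≢j f g gi gj h = trans
        (cong (f x *_) (∏-extract xs u i∈ f g gi λ l l∈ l≢i → h l (there l∈) l≢i λ e → All.lookup x∉ l∈ (sym e)))
        (trans (solve 3 (λ a b c → a :* (b :* c) := b :* a :* c) refl (f x) (f i) _)
          (cong (f i * f x *_) (trans (sym (*-identityˡ _)) (cong (_* ∏ xs g) (sym gj)))))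
      ∏-extract₂ (x ∷ xs) (x∉ ∷ u) {i} {j} (there i∈) (there j∈) i≢j f g gi gj h = trans
        (cong₂ _*_ (h x (here refl) (All.lookup x∉ i∈) (All.lookup x∉ j∈)) (∏-extract₂ xs u i∈ j∈ i≢j f g gi gj λ l l∈ → h l (there l∈)))
        (solve 4 (λ a b c d → a :* (b :* c :* d) := b :* c :* (a :* d)) refl (g x) (f i) (f j) _)

      -- Off the diagonal, the entries at (i, j) and (j, i) add up to 0.
      ⨁-symmetric : ∀ (xs : List A) (H : A → A → F) → (∀ i j → i ∈ xs → j ∈ xs → H i j ≡ H j i) →
                    ⨁ xs (λ i → ⨁ xs (H i)) ≡ ⨁ xs (λ i → H i i)
      ⨁-symmetric [] H s = refl
      ⨁-symmetric (x ∷ xs) H s = begin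
        H x x + ⨁ xs (H x) + ⨁ xs (λ i → H i x + ⨁ xs (H i))
          ≡⟨ cong (H x x + ⨁ xs (H x) +_) (⨁-+ xs _ _) ⟩
        H x x + ⨁ xs (H x) + (⨁ xs (λ i → H i x) + ⨁ xs (λ i → ⨁ xs (H i)))
          ≡⟨ cong (λ z → H x x + ⨁ xs (H x) + (z + _)) (⨁-cong xs λ i i∈ → s i x (there i∈) (here refl)) ⟩
        H x x + ⨁ xs (H x) + (⨁ xs (H x) + ⨁ xs (λ i → ⨁ xs (H i)))
          ≡⟨ solve 3 (λ a b c → a :+ b :+ (b :+ c) := a :+ c) refl (H x x) (⨁ xs (H x)) _ ⟩
        H x x + ⨁ xs (λ i → ⨁ xs (H i))
          ≡⟨ cong (H x x +_) (⨁-symmetric xs H λ i j i∈ j∈ → s i j (there i∈) (there j∈)) ⟩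
        H x x + ⨁ xs (λ i → H i i) ∎
        where open ≡-Reasoning

    ∏-map : ∀ {A B : Set} (g : A → B) (xs : List A) (f : B → F) → ∏ (map g xs) f ≡ ∏ xs (λ x → f (g x))
    ∏-map g [] f = refl
    ∏-map g (x ∷ xs) f = cong (f (g x) *_) (∏-map g xs f)

    ⨁-map : ∀ {A B : Set} (g : A → B) (xs : List A) (f : B → F) → ⨁ (map g xs) f ≡ ⨁ xs (λ x → f (g x))
    ⨁-map g [] f = refl
    ⨁-map g (x ∷ xs) f = cong (f (g x) +_) (⨁-map g xs f)

    open DecMem _≟_ using (_∈?_)

    compl : List F → List F
    compl xs = filter (λ x → ¬? (x ∈? xs)) enum

    compl-∉ : ∀ {xs x} → x ∈ compl xs → x ∉ xs
    compl-∉ {xs} h = proj₂ (∈-filter⁻ (λ x → ¬? (x ∈? xs)) {xs = enum} h)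

    compl-↭ : ∀ {xs} → Unique xs → enum ↭ compl xs ++ xs
    compl-↭ {xs} u = Unique-↭ (enum-unique finite)
      (Uₚ.++⁺ (Uₚ.filter⁺ (λ x → ¬? (x ∈? xs)) (enum-unique finite)) u λ (c , x∈) → compl-∉ {xs} c x∈)
      to (λ {x} _ → enum-complete x)
      where
      to : ∀ {x} → x ∈ enum → x ∈ compl xs ++ xs
      to {x} x∈ with x ∈? xs
      ... | yes h = ∈-++⁺ʳ (compl xs) h
      ... | no h = ∈-++⁺ˡ (∈-filter⁺ (λ x → ¬? (x ∈? xs)) x∈ h)

    length-compl : ∀ {xs} → Unique xs → length (compl xs) ℕ.+ length xs ≡ q
    length-compl {xs} u = trans (sym (length-++ (compl xs))) (sym (↭-length (compl-↭ u)))

    ∏-compl : ∀ {xs} → Unique xs → (f : F → F) → ∏ enum f ≡ ∏ (compl xs) f * ∏ xs f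
    ∏-compl {xs} u f = trans (∏-↭ f (compl-↭ u)) (∏-++ (compl xs) xs f)

    -- The Lagrange weight at a node z of Z, the inverse of the product of z - z′ over the other
    -- nodes; `nz` replaces the factor at z itself by 1.
    weight : List F → F → F
    weight Z z = inv (∏ Z λ z′ → nz (z + z′))

    poly : List F → F → F
    poly R z = ∏ R (z +_)

    -- The divided difference of p at the nodes Z.
    DD : List F → (F → F) → F
    DD Z p = ⨁ Z λ z → p z * weight Z z

    DD-+ : ∀ Z p r → DD Z (λ z → p z + r z) ≡ DD Z p + DD Z r
    DD-+ Z p r = trans (⨁-cong Z λ z _ → distribʳ (weight Z z) (p z) (r z)) (⨁-+ Z _ _)

    DD-*ˡ : ∀ Z c p → DD Z (λ z → c * p z) ≡ c * DD Z p
    DD-*ˡ Z c p = trans (⨁-cong Z λ z _ → *-assoc c (p z) _) (⨁-*ˡ Z c _)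

    ∏-nz≢0 : ∀ {A : Set} (xs : List A) (f : A → F) → ∏ xs (λ x → nz (f x)) ≢ 0#
    ∏-nz≢0 xs f = ∏≢0 xs λ x _ → nz≢0 (f x)

    private
      cancel-factor : ∀ {z y} b c → z ≢ y → (z + y) * b * inv (nz (z + y) * c) ≡ (z + y) * b * (inv (z + y) * inv c) →
                      (z + y) * b * inv (nz (z + y) * c) ≡ b * inv c
      cancel-factor {z} {y} b c h e = trans e (trans
        (solve 4 (λ a b a′ c′ → a :* b :* (a′ :* c′) := (a :* a′) :* (b :* c′)) refl (z + y) b (inv (z + y)) (inv c))
        (trans (cong (_* (b * inv c)) (*-inv (x≢y⇒x+y≢0 h))) (*-identityˡ _)))

    -- The node z₀ contributes 0, and at every other node the factor z + z₀ cancels against the one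
    -- in the weight.
    DD-drop₀ : ∀ z₀ Z → All (z₀ ≢_) Z → ∀ p → DD (z₀ ∷ Z) (λ z → (z + z₀) * p z) ≡ DD Z p
    DD-drop₀ z₀ Z fresh p = trans (cong₂ _+_
        (trans (cong (λ y → y * p z₀ * weight (z₀ ∷ Z) z₀) (x+x≡0 z₀)) (trans (cong (_* weight (z₀ ∷ Z) z₀) (zeroˡ _)) (zeroˡ _)))
        (⨁-cong Z term)) (+-identityˡ _)
      where
      term : ∀ z → z ∈ Z → (z + z₀) * p z * weight (z₀ ∷ Z) z ≡ p z * weight Z z
      term z z∈ = cancel-factor (p z) (∏ Z λ z′ → nz (z + z′)) z≢ (cong ((z + z₀) * p z *_)
        (trans (cong (λ y → inv (y * ∏ Z λ z′ → nz (z + z′))) (nz-≢0 (x≢y⇒x+y≢0 z≢))) (inv-* (x≢y⇒x+y≢0 z≢) (∏-nz≢0 Z (z +_)))))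
        where
        z≢ : z ≢ z₀
        z≢ e = All.lookup fresh z∈ (sym e)

    DD-swap : ∀ z₀ z₁ Z p → DD (z₀ ∷ z₁ ∷ Z) p ≡ DD (z₁ ∷ z₀ ∷ Z) p
    DD-swap z₀ z₁ Z p = trans
      (solve 3 (λ a b c → a :+ (b :+ c) := b :+ (a :+ c)) refl _ _ _)
      (cong₂ _+_ (cong (p z₁ *_) (w z₁)) (cong₂ _+_ (cong (p z₀ *_) (w z₀)) (⨁-cong Z λ z _ → cong (p z *_) (w z))))
      where
      w : ∀ z → weight (z₀ ∷ z₁ ∷ Z) z ≡ weight (z₁ ∷ z₀ ∷ Z) z
      w z = cong inv (solve 3 (λ a b c → a :* (b :* c) := b :* (a :* c)) refl (nz (z + z₀)) (nz (z + z₁)) _)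

    DD-one : ∀ z → DD (z ∷ []) (λ _ → 1#) ≡ 1#
    DD-one z = trans (+-identityʳ _) (trans (*-identityˡ _) (inv-unique (trans (*-identityʳ _)
      (trans (*-identityʳ _) (trans (cong nz (x+x≡0 z)) nz-0)))))

    -- Multiply by z₀ + z₁ = (z + z₀) + (z + z₁): each summand drops one node, and the two divided
    -- differences that remain are both 1 or both 0.
    DD-const : ∀ z₀ z₁ Z → Unique (z₀ ∷ z₁ ∷ Z) → DD (z₀ ∷ z₁ ∷ Z) (λ _ → 1#) ≡ 0#
    DD-const z₀ z₁ Z u@((n₀₁ ∷ n₀) ∷ n₁ ∷ uZ) = *≡0 (x≢y⇒x+y≢0 n₀₁) (begin
      (z₀ + z₁) * DD (z₀ ∷ z₁ ∷ Z) (λ _ → 1#)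
        ≡⟨ sym (DD-*ˡ (z₀ ∷ z₁ ∷ Z) (z₀ + z₁) (λ _ → 1#)) ⟩
      DD (z₀ ∷ z₁ ∷ Z) (λ _ → (z₀ + z₁) * 1#)
        ≡⟨ ⨁-cong (z₀ ∷ z₁ ∷ Z) (λ z _ → cong (_* weight (z₀ ∷ z₁ ∷ Z) z)
             (solve 3 (λ a b z → (a :+ b) :* con true := (z :+ a) :* con true :+ (z :+ b) :* con true) refl z₀ z₁ z)) ⟩
      DD (z₀ ∷ z₁ ∷ Z) (λ z → (z + z₀) * 1# + (z + z₁) * 1#)
        ≡⟨ DD-+ (z₀ ∷ z₁ ∷ Z) _ _ ⟩
      DD (z₀ ∷ z₁ ∷ Z) (λ z → (z + z₀) * 1#) + DD (z₀ ∷ z₁ ∷ Z) (λ z → (z + z₁) * 1#)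
        ≡⟨ cong₂ _+_ (DD-drop₀ z₀ (z₁ ∷ Z) (n₀₁ ∷ n₀) _)
             (trans (DD-swap z₀ z₁ Z _) (DD-drop₀ z₁ (z₀ ∷ Z) ((λ e → n₀₁ (sym e)) ∷ n₁) _)) ⟩
      DD (z₁ ∷ Z) (λ _ → 1#) + DD (z₀ ∷ Z) (λ _ → 1#)
        ≡⟨ rest Z n₀ n₁ uZ ⟩
      0# ∎)
      where
      open ≡-Reasoning
      rest : ∀ Z → All (z₀ ≢_) Z → All (z₁ ≢_) Z → Unique Z → DD (z₁ ∷ Z) (λ _ → 1#) + DD (z₀ ∷ Z) (λ _ → 1#) ≡ 0#
      rest [] _ _ _ = trans (cong₂ _+_ (DD-one z₁) (DD-one z₀)) (x+x≡0 1#)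
      rest (z₂ ∷ Z) n₀ n₁ uZ = trans (cong₂ _+_ (DD-const z₁ z₂ Z (n₁ ∷ uZ)) (DD-const z₀ z₂ Z (n₀ ∷ uZ))) (x+x≡0 0#)

    -- The Leibniz rule for a linear factor, from z + r = (z + z₀) + (z₀ + r).
    DD-step : ∀ z₀ Z → All (z₀ ≢_) Z → ∀ r R →
              DD (z₀ ∷ Z) (poly (r ∷ R)) ≡ DD Z (poly R) + (z₀ + r) * DD (z₀ ∷ Z) (poly R)
    DD-step z₀ Z fresh r R = begin
      DD (z₀ ∷ Z) (λ z → (z + r) * poly R z)
        ≡⟨ ⨁-cong (z₀ ∷ Z) (λ z _ → cong (_* weight (z₀ ∷ Z) z)
             (solve 4 (λ z z₀ r p → (z :+ r) :* p := (z :+ z₀) :* p :+ (z₀ :+ r) :* p) refl z z₀ r (poly R z))) ⟩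
      DD (z₀ ∷ Z) (λ z → (z + z₀) * poly R z + (z₀ + r) * poly R z)
        ≡⟨ DD-+ (z₀ ∷ Z) _ _ ⟩
      DD (z₀ ∷ Z) (λ z → (z + z₀) * poly R z) + DD (z₀ ∷ Z) (λ z → (z₀ + r) * poly R z)
        ≡⟨ cong₂ _+_ (DD-drop₀ z₀ Z fresh (poly R)) (DD-*ˡ (z₀ ∷ Z) (z₀ + r) (poly R)) ⟩
      DD Z (poly R) + (z₀ + r) * DD (z₀ ∷ Z) (poly R) ∎
      where open ≡-Reasoning

    -- Induction on the roots with `DD-step`. Over n nodes the divided difference is the coefficient
    -- in degree n - 1, as long as the degree is at most n - 1; `DD-monic` is the borderline case.
    DD-low : ∀ Z R → Unique Z → suc (length R) ℕ.< length Z → DD Z (poly R) ≡ 0#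
    DD-low (z₀ ∷ z₁ ∷ Z) [] u _ = DD-const z₀ z₁ Z u
    DD-low (z₀ ∷ []) [] _ (s≤s ())
    DD-low (z₀ ∷ Z) (r ∷ R) (n ∷ u) (s≤s h) = trans (DD-step z₀ Z n r R) (trans (cong₂ (λ a b → a + (z₀ + r) * b)
      (DD-low Z R u h) (DD-low (z₀ ∷ Z) R (n ∷ u) (ℕₚ.m≤n⇒m≤1+n h)))
      (solve 1 (λ a → con false :+ a :* con false := con false) refl (z₀ + r)))

    DD-monic : ∀ Z R → Unique Z → suc (length R) ≡ length Z → DD Z (poly R) ≡ 1#
    DD-monic (z ∷ []) [] _ _ = DD-one z
    DD-monic (z₀ ∷ Z) (r ∷ R) (n ∷ u) h = trans (DD-step z₀ Z n r R) (trans (cong₂ (λ a b → a + (z₀ + r) * b)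
      (DD-monic Z R u h′) (DD-low (z₀ ∷ Z) R (n ∷ u) (s≤s (ℕₚ.≤-reflexive h′))))
      (solve 1 (λ a → con true :+ a :* con false := con true) refl (z₀ + r)))
      where
      h′ : suc (length R) ≡ length Z
      h′ = ℕₚ.suc-injective h

-- Segre's bound on the tangents of a plane arc through a point of a secant.

module Arcs where
  open ≡ using (refl; sym; trans; cong; cong₂; subst)
  open Characteristic2

  map-Unique : {A B : Set} (f : A → B) (xs : List A) → Unique xs →
               (∀ x y → x ∈ xs → y ∈ xs → x ≢ y → f x ≢ f y) → Unique (map f xs)
  map-Unique f [] _ _ = []
  map-Unique f (x ∷ xs) (x∉ ∷ u) h = All.tabulate fresh ∷ map-Unique f xs u λ y z y∈ z∈ → h y z (there y∈) (there z∈)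
    where
    fresh : ∀ {z} → z ∈ map f xs → f x ≢ z
    fresh z∈ e with ∈-map⁻ f z∈
    ... | y , y∈ , refl = h x y (here refl) (there y∈) (All.lookup x∉ y∈) e

  ∈-take : {A : Set} (n : ℕ) (xs : List A) {x : A} → x ∈ take n xs → x ∈ xs
  ∈-take (suc n) (x ∷ xs) (here e) = here e
  ∈-take (suc n) (x ∷ xs) (there h) = there (∈-take n xs h)

  module ArcLemma (𝔽 : Char2Field) where
    open FieldTheory 𝔽

    Point : Set
    Point = F × F

    X Y : Point → F
    X = proj₁
    Y = proj₂

    _≟ₚ_ : (s w : Point) → Dec (s ≡ w)
    _≟ₚ_ = ≡-dec _≟_ _≟_

    -- For w = s the value is 0, the slope of the horizontal line. With this default the slopes from
    -- s to all of S, including s, also record the secant to the horizontal point at infinity.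
    slope : Point → Point → F
    slope s w = (Y s + Y w) * inv (X s + X w)

    slope-refl : ∀ s → slope s s ≡ 0#
    slope-refl s = trans (cong (_* inv (X s + X s)) (x+x≡0 (Y s))) (zeroˡ _)

    slope-sym : ∀ s w → slope s w ≡ slope w s
    slope-sym s w = cong₂ (λ a b → a * inv b) (+-comm (Y s) (Y w)) (+-comm (X s) (X w))

    slope-* : ∀ s w → X s ≢ X w → slope s w * (X s + X w) ≡ Y s + Y w
    slope-* s w h = trans (*-assoc _ _ _) (trans (cong ((Y s + Y w) *_) (*-invˡ (x≢y⇒x+y≢0 h))) (*-identityʳ _))

    -- The product of all nonzero field elements, a common value to which the complementary products
    -- below are compared.
    W : F
    W = ∏ enum nz

    translate : ∀ z → ∏ enum (λ μ → nz (z + μ)) ≡ W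
    translate z = trans (sym (∏-map (z +_) enum nz)) (∏-↭ nz
      (Unique-↭ (Uₚ.map⁺ injective (enum-unique finite)) (enum-unique finite) (λ {x} _ → enum-complete x) onto))
      where
      injective : ∀ {x y} → z + x ≡ z + y → x ≡ y
      injective {x} {y} e = +-cancelʳ z (trans (+-comm x z) (trans e (+-comm z y)))
      onto : ∀ {x} → x ∈ enum → x ∈ map (z +_) enum
      onto {x} _ = subst (_∈ map (z +_) enum) (solve 2 (λ z x → z :+ (z :+ x) := x) refl z x)
                     (∈-map⁺ (z +_) (enum-complete (z + x)))

    -- The factors with root outside xs and those with root in xs together run through z + μ for all
    -- μ in the field; the vanishing one has become 1.
    poly-compl : ∀ {xs} → Unique xs → ∀ {z} → z ∈ xs → poly (compl xs) z * ∏ xs (λ μ → nz (z + μ)) ≡ W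
    poly-compl {xs} u {z} z∈ = trans (cong (_* ∏ xs (λ μ → nz (z + μ)))
        (∏-cong (compl xs) λ μ μ∈ → sym (nz-≢0 (x≢y⇒x+y≢0 λ e → compl-∉ {xs} μ∈ (subst (_∈ xs) e z∈)))))
      (trans (sym (∏-compl u (λ μ → nz (z + μ)))) (translate z))

    -- S is the affine part of an arc containing the points at infinity of the
    -- horizontal lines and of the lines of slope y₀; the vertical direction is a
    -- point on the secant joining these two.
    record Arc (S : List Point) (y₀ : F) : Set where
      field
        unique     : Unique S
        y₀≢0       : y₀ ≢ 0#
        horizontal : ∀ {s w} → s ∈ S → w ∈ S → s ≢ w → Y s ≢ Y w
        oblique    : ∀ {s w} → s ∈ S → w ∈ S → s ≢ w → Y s + Y w ≢ y₀ * (X s + X w)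
        no-three   : ∀ {s w z} → s ∈ S → w ∈ S → z ∈ S → s ≢ w → s ≢ z → w ≢ z →
                     (Y s + Y w) * (X s + X z) ≢ (Y s + Y z) * (X s + X w)

    -- The condition that the vertical line at s is a tangent of the arc.
    Vertical : List Point → Point → Set
    Vertical S s = ∀ w → w ∈ S → w ≢ s → X s ≢ X w

    module Tangents {S y₀} (arc : Arc S y₀) where
      open Arc arc

      -- The heights of the horizontal lines that avoid S. They are the tangents at the horizontal
      -- point at infinity, so their number is the d of the arc and `G` is the tangent polynomial of
      -- that point.
      missing : List F
      missing = compl (map Y S)

      Y-unique : Unique (map Y S)
      Y-unique = map-Unique Y S unique λ s w s∈ w∈ → horizontal s∈ w∈

      G : F → F
      G = poly missing

      length-missing : length missing ℕ.+ length S ≡ q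
      length-missing = trans (cong (length missing ℕ.+_) (sym (length-map Y S))) (length-compl Y-unique)

      slope≢0 : ∀ {s w} → s ∈ S → w ∈ S → w ≢ s → X s ≢ X w → slope s w ≢ 0#
      slope≢0 {s} {w} s∈ w∈ w≢s h e = horizontal s∈ w∈ (λ e → w≢s (sym e)) (x+y≡0⇒x≡y
        (trans (sym (slope-* s w h)) (trans (cong (_* (X s + X w)) e) (zeroˡ _))))

      slope-injective : ∀ {s} → s ∈ S → Vertical S s → ∀ w z → w ∈ S → z ∈ S → w ≢ z → slope s w ≢ slope s z
      slope-injective {s} s∈ v w z w∈ z∈ w≢z e with w ≟ₚ s | z ≟ₚ s
      ... | yes refl | yes refl = w≢z refl
      ... | yes refl | no z≢s = slope≢0 s∈ z∈ z≢s (v z z∈ z≢s) (trans (sym e) (slope-refl w))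
      ... | no w≢s | yes refl = slope≢0 s∈ w∈ w≢s (v w w∈ w≢s) (trans e (slope-refl z))
      ... | no w≢s | no z≢s = no-three s∈ w∈ z∈ (λ e → w≢s (sym e)) (λ e → z≢s (sym e)) w≢z (begin
        (Y s + Y w) * (X s + X z)                   ≡⟨ cong (_* (X s + X z)) (sym (slope-* s w (v w w∈ w≢s))) ⟩
        slope s w * (X s + X w) * (X s + X z)       ≡⟨ cong (λ m → m * (X s + X w) * (X s + X z)) e ⟩
        slope s z * (X s + X w) * (X s + X z)       ≡⟨ solve 3 (λ a b c → a :* b :* c := a :* c :* b) refl (slope s z) (X s + X w) (X s + X z) ⟩
        slope s z * (X s + X z) * (X s + X w)       ≡⟨ cong (_* (X s + X w)) (slope-* s z (v z z∈ z≢s)) ⟩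
        (Y s + Y z) * (X s + X w) ∎)
        where open ≡-Reasoning

      -- For s in S these are the finite slopes of the secants at s: `y₀` to the oblique point at
      -- infinity, 0 to the horizontal one, and one for each further point of S. The roots of `P s`
      -- are thus the finite slopes of tangents.
      used : Point → List F
      used s = y₀ ∷ map (slope s) S

      used-unique : ∀ {s} → s ∈ S → Vertical S s → Unique (used s)
      used-unique {s} s∈ v = All.tabulate fresh ∷ map-Unique (slope s) S unique (slope-injective s∈ v)
        where
        fresh : ∀ {z} → z ∈ map (slope s) S → y₀ ≢ z
        fresh z∈ e with ∈-map⁻ (slope s) z∈
        ... | w , w∈ , refl with w ≟ₚ s
        ...   | yes refl = y₀≢0 (trans e (slope-refl w))
        ...   | no w≢s = oblique s∈ w∈ (λ e → w≢s (sym e)) (trans (sym (slope-* s w (v w w∈ w≢s))) (cong (_* (X s + X w)) (sym e)))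

      P : Point → F → F
      P s = poly (compl (used s))

      -- One of the d tangents at s is vertical and has no finite slope, so the degree of `P s` is d
      -- - 1. This loss of one is what makes the row sums vanish.
      length-unused : ∀ {s} → s ∈ S → Vertical S s → suc (length (compl (used s))) ≡ length missing
      length-unused {s} s∈ v = ℕₚ.+-cancelʳ-≡ (length S) _ _ (begin
        suc (length (compl (used s))) ℕ.+ length S   ≡⟨ sym (ℕₚ.+-suc (length (compl (used s))) (length S)) ⟩
        length (compl (used s)) ℕ.+ suc (length S)   ≡⟨ cong (λ n → length (compl (used s)) ℕ.+ suc n) (sym (length-map (slope s) S)) ⟩
        length (compl (used s)) ℕ.+ length (used s)  ≡⟨ length-compl (used-unique s∈ v) ⟩
        q                                            ≡⟨ sym length-missing ⟩
        length missing ℕ.+ length S ∎)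
        where open ≡-Reasoning

      D : List Point → Point → Point → F
      D A i j = ∏ A λ l → nz (X i + X l) * nz (slope i j + slope i l)

      D≢0 : ∀ A i j → D A i j ≢ 0#
      D≢0 A i j = ∏≢0 A λ l _ → *≢0 (nz≢0 _) (nz≢0 _)

      -- For l other than i and j the factor is the equation of the line through i and j, evaluated
      -- at l. The two exceptional factors multiply to slope times X-difference, which is the
      -- Y-difference of i and j.
      D-line : ∀ A → Unique A → (∀ {l} → l ∈ A → l ∈ S) → ∀ {i j} → i ∈ A → j ∈ A → i ≢ j → Vertical S i →
               D A i j ≡ (Y i + Y j) * ∏ A (λ l → nz (slope i j * (X i + X l) + (Y i + Y l)))
      D-line A u A⊆S {i} {j} i∈ j∈ i≢j v = trans
          (∏-extract₂ A u i∈ j∈ i≢j _ (λ l → nz (slope i j * (X i + X l) + (Y i + Y l))) gi gj other)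
          (cong (_* ∏ A (λ l → nz (slope i j * (X i + X l) + (Y i + Y l)))) (begin
            nz (X i + X i) * nz (slope i j + slope i i) * (nz (X i + X j) * nz (slope i j + slope i j))
              ≡⟨ cong₂ _*_ (cong₂ _*_ (trans (cong nz (x+x≡0 (X i))) nz-0)
                              (trans (cong nz (trans (cong (slope i j +_) (slope-refl i)) (+-identityʳ _))) (nz-≢0 m≢0)))
                           (cong₂ _*_ (nz-≢0 (x≢y⇒x+y≢0 Xi≢Xj)) (trans (cong nz (x+x≡0 (slope i j))) nz-0)) ⟩
            1# * slope i j * ((X i + X j) * 1#)
              ≡⟨ solve 2 (λ a b → con true :* a :* (b :* con true) := a :* b) refl (slope i j) (X i + X j) ⟩
            slope i j * (X i + X j)
              ≡⟨ slope-* i j Xi≢Xj ⟩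
            Y i + Y j ∎))
        where
        open ≡-Reasoning
        j≢i : j ≢ i
        j≢i e = i≢j (sym e)
        Xi≢Xj : X i ≢ X j
        Xi≢Xj = v j (A⊆S j∈) j≢i
        m≢0 : slope i j ≢ 0#
        m≢0 = slope≢0 (A⊆S i∈) (A⊆S j∈) j≢i Xi≢Xj
        gi : nz (slope i j * (X i + X i) + (Y i + Y i)) ≡ 1#
        gi = trans (cong nz (solve 3 (λ m x y → m :* (x :+ x) :+ (y :+ y) := con false) refl (slope i j) (X i) (Y i))) nz-0
        gj : nz (slope i j * (X i + X j) + (Y i + Y j)) ≡ 1#
        gj = trans (cong (λ z → nz (z + (Y i + Y j))) (slope-* i j Xi≢Xj)) (trans (cong nz (x+x≡0 _)) nz-0)
        other : ∀ l → l ∈ A → l ≢ i → l ≢ j →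
                nz (X i + X l) * nz (slope i j + slope i l) ≡ nz (slope i j * (X i + X l) + (Y i + Y l))
        other l l∈ l≢i l≢j = begin
          nz (X i + X l) * nz (slope i j + slope i l) ≡⟨ cong₂ _*_ (nz-≢0 a≢0) (nz-≢0 d≢0) ⟩
          (X i + X l) * (slope i j + slope i l)       ≡⟨ eq ⟩
          slope i j * (X i + X l) + (Y i + Y l)       ≡⟨ sym (nz-≢0 (λ e → *≢0 a≢0 d≢0 (trans eq e))) ⟩
          nz (slope i j * (X i + X l) + (Y i + Y l)) ∎
          where
          Xi≢Xl : X i ≢ X l
          Xi≢Xl = v l (A⊆S l∈) l≢i
          a≢0 : X i + X l ≢ 0#
          a≢0 = x≢y⇒x+y≢0 Xi≢Xl
          d≢0 : slope i j + slope i l ≢ 0#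
          d≢0 = x≢y⇒x+y≢0 (slope-injective (A⊆S i∈) v j l (A⊆S j∈) (A⊆S l∈) (λ e → l≢j (sym e)))
          eq : (X i + X l) * (slope i j + slope i l) ≡ slope i j * (X i + X l) + (Y i + Y l)
          eq = trans (solve 3 (λ a m n → a :* (m :+ n) := m :* a :+ n :* a) refl (X i + X l) (slope i j) (slope i l))
                     (cong (slope i j * (X i + X l) +_) (slope-* i l Xi≢Xl))

      -- By `D-line` only the line through i and j matters, and its equation may be based at either
      -- point.
      D-sym : ∀ A → Unique A → (∀ {l} → l ∈ A → l ∈ S) → ∀ {i j} → i ∈ A → j ∈ A → i ≢ j →
              Vertical S i → Vertical S j → D A i j ≡ D A j i
      D-sym A u A⊆S {i} {j} i∈ j∈ i≢j vi vj = trans (D-line A u A⊆S i∈ j∈ i≢j vi)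
        (trans (cong₂ _*_ (+-comm (Y i) (Y j)) (∏-cong A λ l _ → cong nz (same l)))
          (sym (D-line A u A⊆S j∈ i∈ (λ e → i≢j (sym e)) vj)))
        where
        open ≡-Reasoning
        same : ∀ l → slope i j * (X i + X l) + (Y i + Y l) ≡ slope j i * (X j + X l) + (Y j + Y l)
        same l = begin
          slope i j * (X i + X l) + (Y i + Y l)
            ≡⟨ solve 6 (λ m a b c x y → m :* (a :+ c) :+ (x :+ y) := m :* (a :+ b) :+ (m :* (b :+ c) :+ (x :+ y))) refl
                 (slope i j) (X i) (X j) (X l) (Y i) (Y l) ⟩
          slope i j * (X i + X j) + (slope i j * (X j + X l) + (Y i + Y l))
            ≡⟨ cong₂ (λ a b → a + (b * (X j + X l) + (Y i + Y l))) (slope-* i j (vi j (A⊆S j∈) (λ e → i≢j (sym e)))) (slope-sym i j) ⟩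
          Y i + Y j + (slope j i * (X j + X l) + (Y i + Y l))
            ≡⟨ solve 4 (λ a b c z → a :+ b :+ (z :+ (a :+ c)) := z :+ (b :+ c)) refl (Y i) (Y j) (Y l) (slope j i * (X j + X l)) ⟩
          slope j i * (X j + X l) + (Y j + Y l) ∎

      nz-slope : ∀ {s} → s ∈ S → Vertical S s → ∀ w → w ∈ S → nz (X s + X w) * nz (slope s w) ≡ nz (Y s + Y w)
      nz-slope {s} s∈ v w w∈ with w ≟ₚ s
      ... | yes refl = trans (cong₂ _*_ (trans (cong nz (x+x≡0 (X w))) nz-0) (trans (cong nz (slope-refl w)) nz-0))
                         (trans (*-identityˡ 1#) (sym (trans (cong nz (x+x≡0 (Y w))) nz-0)))
      ... | no w≢s = trans (cong₂ _*_ (nz-≢0 (x≢y⇒x+y≢0 h)) (nz-≢0 (slope≢0 s∈ w∈ w≢s h)))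
                       (trans (*-comm _ _) (trans (slope-* s w h)
                         (sym (nz-≢0 (x≢y⇒x+y≢0 (horizontal s∈ w∈ (λ e → w≢s (sym e))))))))
        where
        h : X s ≢ X w
        h = v w w∈ w≢s

      ∏-nz-slope : ∀ {s} → s ∈ S → Vertical S s → ∀ A → (∀ {l} → l ∈ A → l ∈ S) →
                   ∏ A (λ w → nz (X s + X w)) * ∏ A (λ w → nz (slope s w)) ≡ ∏ A (λ w → nz (Y s + Y w))
      ∏-nz-slope s∈ v A A⊆S = trans (sym (∏-* A _ _)) (∏-cong A λ w w∈ → nz-slope s∈ v w (A⊆S w∈))

      P-used : ∀ {s} → s ∈ S → Vertical S s → ∀ w → w ∈ S →
               P s (slope s w) * (nz (slope s w + y₀) * ∏ S (λ z → nz (slope s w + slope s z))) ≡ W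
      P-used {s} s∈ v w w∈ = trans (cong (λ p → P s (slope s w) * (nz (slope s w + y₀) * p)) (sym (∏-map (slope s) S _)))
        (poly-compl (used-unique s∈ v) (there (∈-map⁺ (slope s) w∈)))

      P0 : ∀ {s} → s ∈ S → Vertical S s → P s 0# * (y₀ * ∏ S (λ z → nz (slope s z))) ≡ W
      P0 {s} s∈ v = trans (cong₂ (λ p r → P s 0# * (p * r)) (sym (trans (cong nz (+-identityˡ y₀)) (nz-≢0 y₀≢0)))
          (∏-cong S λ z _ → cong nz (sym (+-identityˡ (slope s z)))))
        (subst (λ m → P s m * (nz (m + y₀) * ∏ S (λ z → nz (m + slope s z))) ≡ W) (slope-refl s) (P-used s∈ v s s∈))

      W≢0 : W ≢ 0#
      W≢0 = ∏-nz≢0 enum (λ x → x)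

      P0≢0 : ∀ {s} → s ∈ S → Vertical S s → P s 0# ≢ 0#
      P0≢0 {s} s∈ v e = W≢0 (trans (sym (P0 s∈ v)) (trans (cong (_* (y₀ * ∏ S (λ z → nz (slope s z)))) e) (zeroˡ _)))

      G-on : ∀ {s} → s ∈ S → G (Y s) * ∏ S (λ w → nz (Y s + Y w)) ≡ W
      G-on {s} s∈ = trans (cong (G (Y s) *_) (sym (∏-map Y S _))) (poly-compl Y-unique (∈-map⁺ Y s∈))

      -- Segre's lemma of tangents, scaled so that the tangent polynomials of any two
      -- points of the arc agree on the line joining them.
      tangent-value : ∀ {i j} → i ∈ S → j ∈ S → Vertical S i →
                      G (Y i) * inv (P i 0#) * P i (slope i j) * (nz (slope i j + y₀) * D S i j) ≡ W * y₀
      tangent-value {i} {j} i∈ j∈ v = begin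
        g * p₀⁻¹ * pₘ * (n * D S i j)  ≡⟨ cong (λ z → g * p₀⁻¹ * pₘ * (n * z)) (∏-* S _ _) ⟩
        g * p₀⁻¹ * pₘ * (n * (A * Q))  ≡⟨ solve 6 (λ g p pm n A Q → g :* p :* pm :* (n :* (A :* Q)) := g :* A :* p :* (pm :* (n :* Q))) refl g p₀⁻¹ pₘ n A Q ⟩
        g * A * p₀⁻¹ * (pₘ * (n * Q))  ≡⟨ cong (g * A * p₀⁻¹ *_) (trans (P-used i∈ v j j∈) (sym (P0 i∈ v))) ⟩
        g * A * p₀⁻¹ * (p₀ * (y₀ * M)) ≡⟨ solve 6 (λ g A p′ p y M → g :* A :* p′ :* (p :* (y :* M)) := (g :* (A :* M)) :* y :* (p :* p′)) refl g A p₀⁻¹ p₀ y₀ M ⟩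
        (g * (A * M)) * y₀ * (p₀ * p₀⁻¹) ≡⟨ cong₂ (λ a b → g * a * y₀ * b) (∏-nz-slope i∈ v S (λ h → h)) (*-inv (P0≢0 i∈ v)) ⟩
        (g * ∏ S (λ w → nz (Y i + Y w))) * y₀ * 1# ≡⟨ *-identityʳ _ ⟩
        (g * ∏ S (λ w → nz (Y i + Y w))) * y₀ ≡⟨ cong (_* y₀) (G-on i∈) ⟩
        W * y₀ ∎
        where
        open ≡-Reasoning
        g = G (Y i)
        p₀ = P i 0#
        p₀⁻¹ = inv p₀
        pₘ = P i (slope i j)
        n = nz (slope i j + y₀)
        A = ∏ S (λ w → nz (X i + X w))
        Q = ∏ S (λ w → nz (slope i j + slope i w))
        M = ∏ S (λ w → nz (slope i w))

      module Contradiction (E : List Point) (E-unique : Unique E) (E⊆S : ∀ {l} → l ∈ E → l ∈ S)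
                           (vert : ∀ {l} → l ∈ E → Vertical S l)
                           (E-length : length E ≡ suc (length missing)) where

        κ : Point → F
        κ i = inv (∏ E λ l → nz (X i + X l))

        coeff : Point → F
        coeff i = κ i * (G (Y i) * inv (P i 0#))

        -- Row i is a multiple of the terms of the divided difference of `P i` at the slopes from i
        -- to the points of E. The multiple contains the scaling from the lemma of tangents, and `κ`
        -- supplies the X-differences that complete the denominator to `D E`.
        H : Point → Point → F
        H i j = coeff i * (P i (slope i j) * inv (∏ E λ l → nz (slope i j + slope i l)))

        -- The row is a divided difference of a polynomial of degree d - 1 over d + 1 distinct
        -- slopes, the slope 0 for j = i being one of them.
        row-zero : ∀ i → i ∈ E → ⨁ E (H i) ≡ 0#
        row-zero i i∈ = begin
          ⨁ E (H i)
            ≡⟨ ⨁-*ˡ E (coeff i) _ ⟩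
          coeff i * ⨁ E (λ j → P i (slope i j) * inv (∏ E λ l → nz (slope i j + slope i l)))
            ≡⟨ cong (coeff i *_) (⨁-cong E λ j _ → cong (λ z → P i (slope i j) * inv z) (sym (∏-map (slope i) E _))) ⟩
          coeff i * ⨁ E (λ j → P i (slope i j) * weight (map (slope i) E) (slope i j))
            ≡⟨ cong (coeff i *_) (sym (⨁-map (slope i) E _)) ⟩
          coeff i * DD (map (slope i) E) (P i)
            ≡⟨ cong (coeff i *_) (DD-low (map (slope i) E) (compl (used i)) distinct low) ⟩
          coeff i * 0#
            ≡⟨ zeroʳ _ ⟩
          0# ∎
          where
          open ≡-Reasoning
          distinct : Unique (map (slope i) E)
          distinct = map-Unique (slope i) E E-unique λ w z w∈ z∈ → slope-injective (E⊆S i∈) (vert i∈) w z (E⊆S w∈) (E⊆S z∈)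
          low : suc (length (compl (used i))) ℕ.< length (map (slope i) E)
          low = ℕₚ.≤-reflexive (sym (trans (length-map (slope i) E) (trans E-length (cong suc (sym (length-unused (E⊆S i∈) (vert i∈)))))))

        -- Once denominators are cleared the right side is the same for all pairs; the factor that
        -- clears them is symmetric for i ≠ j, hence so is `H`.
        H-value : ∀ {i j} → i ∈ E → j ∈ E → H i j * (D E i j * (nz (slope i j + y₀) * D S i j)) ≡ W * y₀
        H-value {i} {j} i∈ j∈ = begin
          κ i * g * (p * inv Q) * (D E i j * r)  ≡⟨ cong (λ z → κ i * g * (p * inv Q) * (z * r)) (∏-* E _ _) ⟩
          κ i * g * (p * inv Q) * (A * Q * r)    ≡⟨ solve 7 (λ κ g p Q′ A Q r → κ :* g :* (p :* Q′) :* (A :* Q :* r) := (A :* κ) :* (Q :* Q′) :* (g :* p :* r)) refl (κ i) g p (inv Q) A Q r ⟩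
          (A * κ i) * (Q * inv Q) * (g * p * r)  ≡⟨ cong₂ (λ a b → a * b * (g * p * r)) (*-inv (∏-nz≢0 E (λ l → X i + X l))) (*-inv (∏-nz≢0 E (λ l → slope i j + slope i l))) ⟩
          1# * 1# * (g * p * r)                  ≡⟨ trans (cong (_* (g * p * r)) (*-identityˡ 1#)) (*-identityˡ _) ⟩
          g * p * r                              ≡⟨ tangent-value (E⊆S i∈) (E⊆S j∈) (vert i∈) ⟩
          W * y₀ ∎
          where
          open ≡-Reasoning
          g = G (Y i) * inv (P i 0#)
          p = P i (slope i j)
          Q = ∏ E (λ l → nz (slope i j + slope i l))
          A = ∏ E (λ l → nz (X i + X l))
          r = nz (slope i j + y₀) * D S i j

        H-sym : ∀ i j → i ∈ E → j ∈ E → H i j ≡ H j i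
        H-sym i j i∈ j∈ with i ≟ₚ j
        ... | yes refl = refl
        ... | no i≢j = *-cancel (*≢0 (D≢0 E i j) (*≢0 (nz≢0 (slope i j + y₀)) (D≢0 S i j)))
            (trans (*-comm _ (H i j)) (trans (H-value i∈ j∈) (trans (sym (H-value j∈ i∈))
              (trans (*-comm (H j i) _) (cong (_* H j i) (cong₂ _*_
                (D-sym E E-unique E⊆S j∈ i∈ (λ e → i≢j (sym e)) (vert j∈) (vert i∈))
                (cong₂ _*_ (cong (λ m → nz (m + y₀)) (slope-sym j i))
                   (D-sym S unique (λ h → h) (E⊆S j∈) (E⊆S i∈) (λ e → i≢j (sym e)) (vert j∈) (vert i∈)))))))))

        -- At j = i the slope is 0, so the value of `P i` cancels, and X-differences times slopes
        -- become Y-differences. What is left is the term of `G` at the node Y i.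
        H-diag : ∀ i → i ∈ E → H i i ≡ G (Y i) * inv (∏ E λ l → nz (Y i + Y l))
        H-diag i i∈ = begin
          κ i * (g * inv p₀) * (P i (slope i i) * inv (∏ E λ l → nz (slope i i + slope i l)))
            ≡⟨ cong₂ (λ a b → κ i * (g * inv p₀) * (a * inv b)) (cong (P i) (slope-refl i))
                 (∏-cong E λ l _ → cong nz (trans (cong (_+ slope i l) (slope-refl i)) (+-identityˡ _))) ⟩
          κ i * (g * inv p₀) * (p₀ * inv M)
            ≡⟨ solve 5 (λ κ g p′ p M′ → κ :* (g :* p′) :* (p :* M′) := (p :* p′) :* (g :* (κ :* M′))) refl (κ i) g (inv p₀) p₀ (inv M) ⟩
          (p₀ * inv p₀) * (g * (κ i * inv M))
            ≡⟨ trans (cong (_* (g * (κ i * inv M))) (*-inv (P0≢0 (E⊆S i∈) (vert i∈)))) (*-identityˡ _) ⟩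
          g * (κ i * inv M)
            ≡⟨ cong (g *_) (sym (inv-* (∏-nz≢0 E (λ l → X i + X l)) (∏-nz≢0 E (λ l → slope i l)))) ⟩
          g * inv (∏ E (λ l → nz (X i + X l)) * M)
            ≡⟨ cong (λ z → g * inv z) (∏-nz-slope (E⊆S i∈) (vert i∈) E E⊆S) ⟩
          g * inv (∏ E λ l → nz (Y i + Y l)) ∎
          where
          open ≡-Reasoning
          g = G (Y i)
          p₀ = P i 0#
          M = ∏ E (λ l → nz (slope i l))

        absurd : ⊥
        absurd = 1≢0 (begin
          1#
            ≡⟨ sym (DD-monic (map Y E) missing
                 (map-Unique Y E E-unique λ s w s∈ w∈ → horizontal (E⊆S s∈) (E⊆S w∈))
                 (sym (trans (length-map Y E) E-length))) ⟩
          DD (map Y E) G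
            ≡⟨ ⨁-map Y E _ ⟩
          ⨁ E (λ i → G (Y i) * weight (map Y E) (Y i))
            ≡⟨ ⨁-cong E (λ i i∈ → trans (cong (λ z → G (Y i) * inv z) (∏-map Y E _)) (sym (H-diag i i∈))) ⟩
          ⨁ E (λ i → H i i)
            ≡⟨ sym (⨁-symmetric E H H-sym) ⟩
          ⨁ E (λ i → ⨁ E (H i))
            ≡⟨ ⨁-0 E row-zero ⟩
          0# ∎)
          where open ≡-Reasoning

    arc-bound : ∀ {S y₀} → Arc S y₀ → ∀ E → Unique E → (∀ {l} → l ∈ E → l ∈ S) →
                (∀ {l} → l ∈ E → Vertical S l) → length S ℕ.+ length E ℕ.≤ q
    arc-bound {S} {y₀} arc E E-unique E⊆S vert with length E ℕ.≤? length (Tangents.missing arc)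
    ... | yes h = ℕₚ.≤-trans (ℕₚ.≤-trans (ℕₚ.+-monoʳ-≤ (length S) h) (ℕₚ.≤-reflexive (ℕₚ.+-comm (length S) _)))
                    (ℕₚ.≤-reflexive (Tangents.length-missing arc))
    -- E is cut down to exactly d + 1 points, so that `G` has the degree whose divided difference is
    -- 1.
    ... | no h = ⊥-elim (Contradiction.absurd (take m E) (Uₚ.take⁺ m E-unique)
                   (λ l∈ → E⊆S (∈-take m E l∈)) (λ l∈ → vert (∈-take m E l∈))
                   (trans (length-take m E) (ℕₚ.m≤n⇒m⊓n≡m (ℕₚ.≰⇒> h))))
      where
      open Tangents arc
      m = suc (length missing)

-- The projective plane over the field, in coordinates.

module PlaneOverField where
  open ≡ using (refl; sym; trans; cong; cong₂; subst)
  open Counting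
  open Characteristic2
  open PlaneCombinatorics using (ProjectivePlane; 𝟙-Bit)

  ∑-cart : {A B C : Set} (f : A → B → C) (xs : List A) (ys : List B) (g : C → ℕ) →
           ∑ (cartesianProductWith f xs ys) g ≡ ∑ xs (λ x → ∑ ys (λ y → g (f x y)))
  ∑-cart f [] ys g = refl
  ∑-cart f (x ∷ xs) ys g = trans (∑-++ (map (f x) ys) _ g) (cong₂ ℕ._+_ (∑-map (f x) ys g) (∑-cart f xs ys g))

  module PG2 (𝔽 : Char2Field) where
    open FieldTheory 𝔽

    ∑∀-const : ∀ c → ∑∀ (λ _ → c) ≡ q ℕ.* c
    ∑∀-const c = ∑-const enum c

    ∑∀-root : ∀ c {m} → m ≢ 0# → ∑∀ (λ x → 𝟙 (c + m * x ≟ 0#)) ≡ 1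
    ∑∀-root c {m} m≢0 = trans (∑-cong enum λ x → 𝟙-cong (c + m * x ≟ 0#) (inv m * c ≟ x) (to x) (from x)) (Finite.once finite (inv m * c))
      where
      to : ∀ x → c + m * x ≡ 0# → inv m * c ≡ x
      to x e = *-cancel m≢0 (trans (sym (*-assoc m (inv m) c)) (trans (cong (_* c) (*-inv m≢0)) (trans (*-identityˡ c) (x+y≡0⇒x≡y e))))
      from : ∀ x → inv m * c ≡ x → c + m * x ≡ 0#
      from x refl = trans (cong (c +_) (trans (sym (*-assoc m (inv m) c)) (trans (cong (_* c) (*-inv m≢0)) (*-identityˡ c)))) (x+x≡0 c)

    record V3 : Set where
      constructor v3
      field x y z : F

    dot : V3 → V3 → F
    dot (v3 x y z) (v3 x′ y′ z′) = x * x′ + (y * y′ + z * z′)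

    cross : V3 → V3 → V3
    cross (v3 x y z) (v3 x′ y′ z′) = v3 (y * z′ + z * y′) (z * x′ + x * z′) (x * y′ + y * x′)

    scale : F → V3 → V3
    scale s (v3 x y z) = v3 (s * x) (s * y) (s * z)

    𝟎 : V3
    𝟎 = v3 0# 0# 0#

    v3≡ : ∀ {x y z x′ y′ z′} → x ≡ x′ → y ≡ y′ → z ≡ z′ → v3 x y z ≡ v3 x′ y′ z′
    v3≡ refl refl refl = refl

    -- Coordinate vectors with first nonzero entry 1, one for each point, so that equality of points
    -- is propositional. Lines use the same type through their dual coordinates.
    data Pt : Set where
      aff : F → F → Pt
      inf : F → Pt
      ∞   : Pt

    vec : Pt → V3
    vec (aff a b) = v3 1# a b
    vec (inf a)   = v3 0# 1# a
    vec ∞         = v3 0# 0# 1#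

    _≟P_ : (p p′ : Pt) → Dec (p ≡ p′)
    aff a b ≟P aff a′ b′ with a ≟ a′ | b ≟ b′
    ... | yes refl | yes refl = yes refl
    ... | no h | _ = no λ { refl → h refl }
    ... | yes _ | no h = no λ { refl → h refl }
    aff _ _ ≟P inf _ = no λ ()
    aff _ _ ≟P ∞ = no λ ()
    inf _ ≟P aff _ _ = no λ ()
    inf a ≟P inf a′ with a ≟ a′
    ... | yes refl = yes refl
    ... | no h = no λ { refl → h refl }
    inf _ ≟P ∞ = no λ ()
    ∞ ≟P aff _ _ = no λ ()
    ∞ ≟P inf _ = no λ ()
    ∞ ≟P ∞ = yes refl

    points : List Pt
    points = cartesianProductWith aff enum enum ++ (map inf enum ++ (∞ ∷ []))

    ∑-points : ∀ f → ∑ points f ≡ ∑∀ (λ a → ∑∀ (λ b → f (aff a b))) ℕ.+ (∑∀ (λ a → f (inf a)) ℕ.+ f ∞)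
    ∑-points f = trans (∑-++ (cartesianProductWith aff enum enum) _ f) (cong₂ ℕ._+_ (∑-cart aff enum enum f)
      (trans (∑-++ (map inf enum) _ f) (cong₂ ℕ._+_ (∑-map inf enum f) (ℕₚ.+-identityʳ (f ∞)))))

    finPt : Finite Pt
    finPt = record { enum = points ; _≟ᶠ_ = _≟P_ ; once = once′ }
      where
      open Finite finite using (once)
      once′ : ∀ p → ∑ points (λ p′ → 𝟙 (p ≟P p′)) ≡ 1
      once′ (aff a b) = trans (∑-points _) (cong₂ ℕ._+_
        (trans (∑-cong enum λ a′ → trans (∑-cong enum λ b′ → split a′ b′) (∑-pick b (λ _ → 𝟙 (a ≟ a′)))) (once a))
        (cong (ℕ._+ 0) (∑-zero-∈ enum λ _ _ → refl)))
        where
        split : ∀ a′ b′ → 𝟙 (aff a b ≟P aff a′ b′) ≡ 𝟙 (b ≟ b′) ℕ.* 𝟙 (a ≟ a′)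
        split a′ b′ with a ≟ a′ | b ≟ b′
        ... | yes refl | yes refl = refl
        ... | no _ | yes _ = refl
        ... | no _ | no _ = refl
        ... | yes refl | no _ = refl
      once′ (inf a) = trans (∑-points _) (cong₂ ℕ._+_
        (∑-zero-∈ enum λ _ _ → ∑-zero-∈ enum λ _ _ → refl)
        (trans (ℕₚ.+-identityʳ _) (trans (∑-cong enum λ a′ → 𝟙-cong (inf a ≟P inf a′) (a ≟ a′) (λ { refl → refl }) (λ { refl → refl })) (once a))))
      once′ ∞ = trans (∑-points _) (cong₂ ℕ._+_
        (∑-zero-∈ enum λ _ _ → ∑-zero-∈ enum λ _ _ → refl)
        (cong (ℕ._+ 1) (∑-zero-∈ enum λ _ _ → refl)))

    inc : Pt → Pt → ℕ
    inc p L = 𝟙 (dot (vec p) (vec L) ≟ 0#)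

    length-points : length points ≡ q ℕ.* q ℕ.+ q ℕ.+ 1
    length-points = begin
      length points                 ≡⟨ sym (∑-one points) ⟩
      ∑ points (λ _ → 1)            ≡⟨ ∑-points (λ _ → 1) ⟩
      ∑∀ (λ _ → ∑∀ (λ _ → 1)) ℕ.+ (∑∀ (λ _ → 1) ℕ.+ 1)
        ≡⟨ cong₂ (λ a b → a ℕ.+ (b ℕ.+ 1)) (trans (∑∀-const _) (cong (q ℕ.*_) (∑-one enum))) (∑-one enum) ⟩
      q ℕ.* q ℕ.+ (q ℕ.+ 1)         ≡⟨ sym (ℕₚ.+-assoc (q ℕ.* q) q 1) ⟩
      q ℕ.* q ℕ.+ q ℕ.+ 1 ∎
      where open ≡-Reasoning

    private
      ⇔𝟙 : ∀ {x y} → x ≡ y → 𝟙 (x ≟ 0#) ≡ 𝟙 (y ≟ 0#)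
      ⇔𝟙 e = cong (λ z → 𝟙 (z ≟ 0#)) e

      q*1 : ∑∀ (λ _ → 1) ≡ q
      q*1 = ∑-one enum

      total : ∀ {a b c} n → a ≡ q → b ≡ n → c ℕ.+ n ≡ 1 → a ℕ.+ (b ℕ.+ c) ≡ q ℕ.+ 1
      total n refl refl e = cong (q ℕ.+_) (trans (ℕₚ.+-comm n _) e)

      total′ : ∀ {a b c} → a ≡ 0 → b ≡ q → c ≡ 1 → a ℕ.+ (b ℕ.+ c) ≡ q ℕ.+ 1
      total′ refl refl refl = refl

    -- Normalised solutions of one linear equation are counted; the last nonzero coordinate of p
    -- decides which entry of the line is solved for.
    lines-on : ∀ p → ∑ points (inc p) ≡ q ℕ.+ 1
    lines-on (aff a b) with b ≟ 0#
    ... | no b≢0 = trans (∑-points _) (total 1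
        (trans (∑-cong enum λ c → trans (∑-cong enum λ d → ⇔𝟙 (sym (+-assoc (1# * 1#) (a * c) (b * d)))) (∑∀-root (1# * 1# + a * c) b≢0)) q*1)
        (trans (∑-cong enum λ d → ⇔𝟙 (sym (+-assoc (1# * 0#) (a * 1#) (b * d)))) (∑∀-root (1# * 0# + a * 1#) b≢0))
        (cong (ℕ._+ 1) (𝟙-no (_ ≟ 0#) λ e → b≢0 (trans (solve 2 (λ a b → b := con true :* con false :+ (a :* con false :+ b :* con true)) refl a b) e))))
    ... | yes refl with a ≟ 0#
    ...   | no a≢0 = trans (∑-points _) (total 0
        (trans (∑-cong enum λ c → trans (∑-cong enum λ d → ⇔𝟙 {y = 1# + a * c} (solve 3 (λ a c d → con true :* con true :+ (a :* c :+ con false :* d) := con true :+ a :* c) refl a c d))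
                   (trans (∑∀-const (𝟙 (1# + a * c ≟ 0#))) (ℕₚ.*-comm q _)))
          (trans (∑-*ʳ enum q _) (trans (cong (ℕ._* q) (∑∀-root 1# a≢0)) (ℕₚ.*-identityˡ q))))
        (∑-zero-∈ enum λ d _ → 𝟙-no (_ ≟ 0#) λ e → a≢0 (trans (solve 2 (λ a d → a := con true :* con false :+ (a :* con true :+ con false :* d)) refl a d) e))
        (trans (ℕₚ.+-identityʳ _) (𝟙-yes (_ ≟ 0#) (solve 1 (λ a → con true :* con false :+ (a :* con false :+ con false :* con true) := con false) refl a))))
    ...   | yes refl = trans (∑-points _) (total′
        (∑-zero-∈ enum λ c _ → ∑-zero-∈ enum λ d _ → 𝟙-no (_ ≟ 0#) λ e → 1≢0 (trans (solve 2 (λ c d → con true := con true :* con true :+ (con false :* c :+ con false :* d)) refl c d) e))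
        (trans (∑-cong enum λ d → 𝟙-yes (_ ≟ 0#) (solve 1 (λ d → con true :* con false :+ (con false :* con true :+ con false :* d) := con false) refl d)) q*1)
        (𝟙-yes (_ ≟ 0#) (solve 0 (con true :* con false :+ (con false :* con false :+ con false :* con true) := con false) refl)))
    lines-on (inf b) with b ≟ 0#
    ... | no b≢0 = trans (∑-points _) (total 1 affine
        (trans (∑-cong enum λ d → ⇔𝟙 (sym (+-assoc (0# * 0#) (1# * 1#) (b * d)))) (∑∀-root (0# * 0# + 1# * 1#) b≢0))
        (cong (ℕ._+ 1) (𝟙-no (_ ≟ 0#) λ e → b≢0 (trans (solve 1 (λ b → b := con false :* con false :+ (con true :* con false :+ b :* con true)) refl b) e))))
      where
      affine : ∑∀ (λ c → ∑∀ (λ d → 𝟙 (0# * 1# + (1# * c + b * d) ≟ 0#))) ≡ q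
      affine = trans (∑-cong enum λ c → trans (∑-cong enum λ d → ⇔𝟙 (sym (+-assoc (0# * 1#) (1# * c) (b * d)))) (∑∀-root (0# * 1# + 1# * c) b≢0)) q*1
    ... | yes refl = trans (∑-points _) (total 0
        (trans (∑-swap enum enum _) (trans (∑-cong enum λ d → trans
            (∑-cong enum λ c → ⇔𝟙 {y = 0# + 1# * c} (solve 2 (λ c d → con false :* con true :+ (con true :* c :+ con false :* d) := con false :+ con true :* c) refl c d))
            (∑∀-root 0# 1≢0)) q*1))
        (∑-zero-∈ enum λ d _ → 𝟙-no (_ ≟ 0#) λ e → 1≢0 (trans (solve 1 (λ d → con true := con false :* con false :+ (con true :* con true :+ con false :* d)) refl d) e))
        (trans (ℕₚ.+-identityʳ _) (𝟙-yes (_ ≟ 0#) (solve 0 (con false :* con false :+ (con true :* con false :+ con false :* con true) := con false) refl))))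
    lines-on ∞ = trans (∑-points _) (total 1
        (trans (∑-cong enum λ c → trans (∑-cong enum λ d → ⇔𝟙 {y = 0# + 1# * d} (solve 2 (λ c d → con false :* con true :+ (con false :* c :+ con true :* d) := con false :+ con true :* d) refl c d)) (∑∀-root 0# 1≢0)) q*1)
        (trans (∑-cong enum λ d → ⇔𝟙 {y = 0# + 1# * d} (solve 1 (λ d → con false :* con false :+ (con false :* con true :+ con true :* d) := con false :+ con true :* d) refl d)) (∑∀-root 0# 1≢0))
        (cong (ℕ._+ 1) (𝟙-no (_ ≟ 0#) λ e → 1≢0 (trans (solve 0 (con true := con false :* con false :+ (con false :* con false :+ con true :* con true)) refl) e))))

    dot-comm : ∀ u v → dot u v ≡ dot v u
    dot-comm (v3 a b c) (v3 x y z) = cong₂ _+_ (*-comm a x) (cong₂ _+_ (*-comm b y) (*-comm c z))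

    inc-sym : ∀ p L → inc p L ≡ inc L p
    inc-sym p L = ⇔𝟙 (dot-comm (vec p) (vec L))

    dot-crossˡ : ∀ u w → dot u (cross u w) ≡ 0#
    dot-crossˡ (v3 x y z) (v3 x′ y′ z′) = solve 6 (λ x y z x′ y′ z′ →
      x :* (y :* z′ :+ z :* y′) :+ (y :* (z :* x′ :+ x :* z′) :+ z :* (x :* y′ :+ y :* x′)) := con false) refl x y z x′ y′ z′

    dot-crossʳ : ∀ u w → dot w (cross u w) ≡ 0#
    dot-crossʳ (v3 x y z) (v3 x′ y′ z′) = solve 6 (λ x y z x′ y′ z′ →
      x′ :* (y :* z′ :+ z :* y′) :+ (y′ :* (z :* x′ :+ x :* z′) :+ z′ :* (x :* y′ :+ y :* x′)) := con false) refl x y z x′ y′ z′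

    dot-scaleʳ : ∀ s u w → dot u (scale s w) ≡ s * dot u w
    dot-scaleʳ s (v3 x y z) (v3 x′ y′ z′) = solve 7 (λ s x y z x′ y′ z′ →
      x :* (s :* x′) :+ (y :* (s :* y′) :+ z :* (s :* z′)) := s :* (x :* x′ :+ (y :* y′ :+ z :* z′))) refl s x y z x′ y′ z′

    normalise : ∀ v → v ≢ 𝟎 → ∃₂ λ s p → s ≢ 0# × v ≡ scale s (vec p)
    normalise (v3 x y z) h with x ≟ 0# | y ≟ 0# | z ≟ 0#
    ... | no x≢0 | _ | _ = x , aff (inv x * y) (inv x * z) , x≢0 ,
          v3≡ (sym (*-identityʳ x)) (sym (undo y)) (sym (undo z))
      where
      undo : ∀ w → x * (inv x * w) ≡ w
      undo w = trans (sym (*-assoc x (inv x) w)) (trans (cong (_* w) (*-inv x≢0)) (*-identityˡ w))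
    ... | yes refl | no y≢0 | _ = y , inf (inv y * z) , y≢0 ,
          v3≡ (sym (zeroʳ y)) (sym (*-identityʳ y)) (sym (trans (sym (*-assoc y (inv y) z)) (trans (cong (_* z) (*-inv y≢0)) (*-identityˡ z))))
    ... | yes refl | yes refl | no z≢0 = z , ∞ , z≢0 , v3≡ (sym (zeroʳ z)) (sym (zeroʳ z)) (sym (*-identityʳ z))
    ... | yes refl | yes refl | yes refl = ⊥-elim (h refl)

    cross-vec : ∀ p p′ → cross (vec p) (vec p′) ≡ 𝟎 → p ≡ p′
    cross-vec (aff a b) (aff a′ b′) e = cong₂ aff
      (x+y≡0⇒x≡y (trans (solve 2 (λ a a′ → a :+ a′ := con true :* a′ :+ a :* con true) refl a a′) (cong V3.z e)))
      (x+y≡0⇒x≡y (trans (solve 2 (λ b b′ → b :+ b′ := b :* con true :+ con true :* b′) refl b b′) (cong V3.y e)))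
    cross-vec (inf a) (inf a′) e = cong inf
      (x+y≡0⇒x≡y (trans (solve 2 (λ a a′ → a :+ a′ := con true :* a′ :+ a :* con true) refl a a′) (cong V3.x e)))
    cross-vec ∞ ∞ e = refl
    cross-vec (aff a b) (inf a′) e = ⊥-elim (1≢0 (trans (solve 1 (λ a → con true := con true :* con true :+ a :* con false) refl a) (cong V3.z e)))
    cross-vec (aff a b) ∞ e = ⊥-elim (1≢0 (trans (solve 1 (λ b → con true := b :* con false :+ con true :* con true) refl b) (cong V3.y e)))
    cross-vec (inf a′) (aff a b) e = ⊥-elim (1≢0 (trans (solve 1 (λ a → con true := con false :* a :+ con true :* con true) refl a) (cong V3.z e)))
    cross-vec ∞ (aff a b) e = ⊥-elim (1≢0 (trans (solve 1 (λ b → con true := con true :* con true :+ con false :* b) refl b) (cong V3.y e)))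
    cross-vec (inf a) ∞ e = ⊥-elim (1≢0 (trans (solve 1 (λ a → con true := con true :* con true :+ a :* con false) refl a) (cong V3.x e)))
    cross-vec ∞ (inf a) e = ⊥-elim (1≢0 (trans (solve 1 (λ a → con true := con false :* a :+ con true :* con true) refl a) (cong V3.x e)))

    private
      -- After multiplication by the nonzero first coordinate of c, each minor of u and w is a
      -- combination of minors of c with u and of c with w.
      parallelₓ : ∀ c u w → V3.x c ≢ 0# → cross c u ≡ 𝟎 → cross c w ≡ 𝟎 → cross u w ≡ 𝟎
      parallelₓ (v3 x y z) (v3 a b d) (v3 a′ b′ d′) x≢0 eu ew = v3≡
        (kill (begin
          x * (b * d′ + d * b′)
            ≡⟨ expand x b d′ d b′ ⟩
          (x * b) * d′ + (x * d) * b′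
            ≡⟨ solve 6 (λ α β γ ε d b → α :* d :+ ε :* b := (α :+ β) :* d :+ ((γ :+ ε) :* b :+ (β :* d :+ γ :* b))) refl (x * b) (y * a) (z * a) (x * d) d′ b′ ⟩
          (x * b + y * a) * d′ + ((z * a + x * d) * b′ + ((y * a) * d′ + (z * a) * b′))
            ≡⟨ cong (λ s → (x * b + y * a) * d′ + ((z * a + x * d) * b′ + s)) (sym (trans (expand a y d′ z b′) (cong₂ (λ s t → s * d′ + t * b′) (*-comm a y) (*-comm a z)))) ⟩
          (x * b + y * a) * d′ + ((z * a + x * d) * b′ + a * (y * d′ + z * b′))
            ≡⟨ cong₂ (λ s t → s * d′ + (t * b′ + a * (y * d′ + z * b′))) (cong V3.z eu) (cong V3.y eu) ⟩
          0# * d′ + (0# * b′ + a * (y * d′ + z * b′))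
            ≡⟨ cong (λ s → 0# * d′ + (0# * b′ + a * s)) (cong V3.x ew) ⟩
          0# * d′ + (0# * b′ + a * 0#)
            ≡⟨ solve 3 (λ a b d → con false :* d :+ (con false :* b :+ a :* con false) := con false) refl a b′ d′ ⟩
          0# ∎))
        (kill (trans (solve 6 (λ x z a d a′ d′ → x :* (d :* a′ :+ a :* d′) :=
            (z :* a :+ x :* d) :* a′ :+ a :* (z :* a′ :+ x :* d′)) refl x z a d a′ d′)
          (trans (cong₂ (λ s t → s * a′ + a * t) (cong V3.y eu) (cong V3.y ew))
            (solve 2 (λ a b → con false :* b :+ a :* con false := con false) refl a a′))))
        (kill (trans (solve 6 (λ x y a b a′ b′ → x :* (a :* b′ :+ b :* a′) :=
            (x :* b :+ y :* a) :* a′ :+ a :* (x :* b′ :+ y :* a′)) refl x y a b a′ b′)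
          (trans (cong₂ (λ s t → s * a′ + a * t) (cong V3.z eu) (cong V3.z ew))
            (solve 2 (λ a b → con false :* b :+ a :* con false := con false) refl a a′))))
        where
        open ≡-Reasoning
        expand : ∀ s p r t v → s * (p * r + t * v) ≡ (s * p) * r + (s * t) * v
        expand = solve 5 (λ s p r t v → s :* (p :* r :+ t :* v) := (s :* p) :* r :+ (s :* t) :* v) refl
        kill : ∀ {w} → x * w ≡ 0# → w ≡ 0#
        kill = *≡0 x≢0

      rotate : V3 → V3
      rotate (v3 x y z) = v3 y z x

      rotate⁻¹ : V3 → V3
      rotate⁻¹ (v3 x y z) = v3 z x y

    parallel : ∀ c u w → c ≢ 𝟎 → cross c u ≡ 𝟎 → cross c w ≡ 𝟎 → cross u w ≡ 𝟎
    parallel c@(v3 x y z) u w c≢0 eu ew with x ≟ 0# | y ≟ 0# | z ≟ 0#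
    ... | no x≢0 | _ | _ = parallelₓ c u w x≢0 eu ew
    ... | yes refl | no y≢0 | _ = cong rotate⁻¹ (parallelₓ (rotate c) (rotate u) (rotate w) y≢0 (cong rotate eu) (cong rotate ew))
    ... | yes refl | yes refl | no z≢0 = cong rotate (parallelₓ (rotate⁻¹ c) (rotate⁻¹ u) (rotate⁻¹ w) z≢0 (cong rotate⁻¹ eu) (cong rotate⁻¹ ew))
    ... | yes refl | yes refl | yes refl = ⊥-elim (c≢0 refl)

    private
      double-crossₓ : ∀ l m u → dot u l ≡ 0# → dot u m ≡ 0# → V3.x (cross (cross l m) u) ≡ 0#
      double-crossₓ (v3 a b c) (v3 a′ b′ c′) (v3 x y z) e e′ = begin
        (c * a′ + a * c′) * z + (a * b′ + b * a′) * y
          ≡⟨ cong₂ _+_ (distribʳ z (c * a′) (a * c′)) (distribʳ y (a * b′) (b * a′)) ⟩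
        (c * a′ * z + a * c′ * z) + (a * b′ * y + b * a′ * y)
          ≡⟨ solve 5 (λ m n₁ n₂ s t → (t :+ n₂) :+ (n₁ :+ s) := (m :+ (n₁ :+ n₂)) :+ (m :+ (s :+ t))) refl
               (a * a′ * x) (a * b′ * y) (a * c′ * z) (b * a′ * y) (c * a′ * z) ⟩
        (a * a′ * x + (a * b′ * y + a * c′ * z)) + (a * a′ * x + (b * a′ * y + c * a′ * z))
          ≡⟨ cong₂ _+_ (sym (spread a a′ b′ c′)) (sym (trans (spread a′ a b c)
               (cong₂ _+_ (cong (_* x) (*-comm a′ a)) (cong₂ _+_ (cong (_* y) (*-comm a′ b)) (cong (_* z) (*-comm a′ c)))))) ⟩
        a * (x * a′ + (y * b′ + z * c′)) + a′ * (x * a + (y * b + z * c))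
          ≡⟨ cong₂ (λ g h → a * g + a′ * h) e′ e ⟩
        a * 0# + a′ * 0#
          ≡⟨ solve 2 (λ s t → s :* con false :+ t :* con false := con false) refl a a′ ⟩
        0# ∎
        where
        open ≡-Reasoning
        move : ∀ s p r → s * (p * r) ≡ s * r * p
        move = solve 3 (λ s p r → s :* (p :* r) := s :* r :* p) refl
        spread : ∀ s p r t → s * (x * p + (y * r + z * t)) ≡ s * p * x + (s * r * y + s * t * z)
        spread s p r t = trans (distribˡ s _ _) (cong₂ _+_ (move s x p)
          (trans (distribˡ s _ _) (cong₂ _+_ (move s y r) (move s z t))))

      dot-rotate : ∀ u w → dot (rotate u) (rotate w) ≡ dot u w
      dot-rotate (v3 x y z) (v3 a b c) = solve 3 (λ p r s → r :+ (s :+ p) := p :+ (r :+ s)) refl (x * a) (y * b) (z * c)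

    -- The expansion (l × m) × u = (u·l) m + (u·m) l, read off in the first coordinate; cyclic
    -- rotation gives the other two.
    double-cross : ∀ l m u → dot u l ≡ 0# → dot u m ≡ 0# → cross (cross l m) u ≡ 𝟎
    double-cross l m u e e′ = v3≡ (double-crossₓ l m u e e′)
      (double-crossₓ (rotate l) (rotate m) (rotate u) e₁ e₁′)
      (double-crossₓ (rotate (rotate l)) (rotate (rotate m)) (rotate (rotate u))
        (trans (dot-rotate (rotate u) (rotate l)) e₁) (trans (dot-rotate (rotate u) (rotate m)) e₁′))
      where
      e₁ = trans (dot-rotate u l) e
      e₁′ = trans (dot-rotate u m) e′

    _≟𝟎 : ∀ v → Dec (v ≡ 𝟎)
    v3 x y z ≟𝟎 with x ≟ 0# | y ≟ 0# | z ≟ 0#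
    ... | yes refl | yes refl | yes refl = yes refl
    ... | no h | _ | _ = no λ e → h (cong V3.x e)
    ... | yes _ | no h | _ = no λ e → h (cong V3.y e)
    ... | yes _ | yes _ | no h = no λ e → h (cong V3.z e)

    -- If L and M were different, their cross product would be a nonzero vector to which p and p′
    -- are both proportional.
    join-unique : ∀ {p p′} → p ≢ p′ → ∀ L M → dot (vec p) (vec L) ≡ 0# → dot (vec p′) (vec L) ≡ 0# →
                  dot (vec p) (vec M) ≡ 0# → dot (vec p′) (vec M) ≡ 0# → L ≡ M
    join-unique {p} {p′} p≢p′ L M pL p′L pM p′M with cross (vec L) (vec M) ≟𝟎
    ... | yes e = cross-vec L M e
    ... | no h = ⊥-elim (p≢p′ (cross-vec p p′ (parallel _ (vec p) (vec p′) h
                   (double-cross (vec L) (vec M) (vec p) pL pM) (double-cross (vec L) (vec M) (vec p′) p′L p′M))))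

    join-line : ∀ {p p′} → p ≢ p′ → ∃ λ L → dot (vec p) (vec L) ≡ 0# × dot (vec p′) (vec L) ≡ 0#
    join-line {p} {p′} p≢p′ with normalise (cross (vec p) (vec p′)) (λ e → p≢p′ (cross-vec p p′ e))
    ... | s , L , s≢0 , e = L , on (vec p) (dot-crossˡ (vec p) (vec p′)) , on (vec p′) (dot-crossʳ (vec p) (vec p′))
      where
      on : ∀ u → dot u (cross (vec p) (vec p′)) ≡ 0# → dot u (vec L) ≡ 0#
      on u h = *≡0 s≢0 (trans (sym (dot-scaleʳ s u (vec L))) (trans (cong (dot u) (sym e)) h))

    inc-both : ∀ p p′ L M → (dot (vec p) (vec M) ≡ 0# → dot (vec p′) (vec M) ≡ 0# → L ≡ M) →
               dot (vec p) (vec L) ≡ 0# → dot (vec p′) (vec L) ≡ 0# → inc p M ℕ.* inc p′ M ≡ 𝟙 (L ≟P M)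
    inc-both p p′ L M uniq pL p′L = 𝟙-and (dot (vec p) (vec M) ≟ 0#) (dot (vec p′) (vec M) ≟ 0#) (L ≟P M)
        uniq (λ e → subst (λ N → dot (vec p) (vec N) ≡ 0#) e pL , subst (λ N → dot (vec p′) (vec N) ≡ 0#) e p′L)

    once-points : ∀ L → ∑ points (λ M → 𝟙 (L ≟P M)) ≡ 1
    once-points = Finite.once finPt

    join : ∀ p p′ → p ≢ p′ → ∑ points (λ L → inc p L ℕ.* inc p′ L) ≡ 1
    join p p′ p≢p′ = go (join-line p≢p′)
      where
      go : (∃ λ L → dot (vec p) (vec L) ≡ 0# × dot (vec p′) (vec L) ≡ 0#) → ∑ points (λ L → inc p L ℕ.* inc p′ L) ≡ 1
      go (L , pL , p′L) = trans (∑-cong points λ M → inc-both p p′ L M (join-unique p≢p′ L M pL p′L) pL p′L) (once-points L)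

    plane : ProjectivePlane q Pt Pt
    plane = record
      { finPt = finPt ; finLn = finPt ; inc = inc
      ; bit = λ p L → 𝟙-Bit (dot (vec p) (vec L) ≟ 0#)
      ; size = length-points
      ; points-on = λ L → trans (∑-cong points λ p → inc-sym p L) (lines-on L)
      ; lines-on = lines-on
      ; join = join
      ; meet = λ L M L≢M → trans (∑-cong points λ p → cong₂ ℕ._*_ (inc-sym p L) (inc-sym p M)) (join L M L≢M)
      }

-- Four-dimensional space and its linear changes of coordinates.

module SpaceOverField where
  open ≡ using (refl; sym; trans; cong; cong₂)
  open Counting
  open Characteristic2
  open PlaneOverField

  module Space (𝔽 : Char2Field) where
    open FieldTheory 𝔽
    open PG2 𝔽

    infixl 6 _+₃_ _⊕_
    infixr 7 _·_

    _+₃_ : V3 → V3 → V3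
    v3 x y z +₃ v3 x′ y′ z′ = v3 (x + x′) (y + y′) (z + z′)

    -- Split as 1 + 3 so that projection from the point `e₁` is the map `tl`.
    record V4 : Set where
      constructor ⟨_,_⟩
      field
        hd : F
        tl : V3
    open V4 public

    _⊕_ : V4 → V4 → V4
    ⟨ h , t ⟩ ⊕ ⟨ h′ , t′ ⟩ = ⟨ h + h′ , t +₃ t′ ⟩

    _·_ : F → V4 → V4
    a · ⟨ h , t ⟩ = ⟨ a * h , scale a t ⟩

    0⃗ e₁ e₂ : V4
    0⃗ = ⟨ 0# , 𝟎 ⟩
    e₁ = ⟨ 1# , 𝟎 ⟩
    e₂ = ⟨ 0# , v3 1# 0# 0# ⟩

    dot₄ : V4 → V4 → F
    dot₄ ⟨ h , t ⟩ ⟨ h′ , t′ ⟩ = h * h′ + dot t t′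

    v4≡ : ∀ {h x y z h′ x′ y′ z′} → h ≡ h′ → x ≡ x′ → y ≡ y′ → z ≡ z′ → ⟨ h , v3 x y z ⟩ ≡ ⟨ h′ , v3 x′ y′ z′ ⟩
    v4≡ refl refl refl refl = refl

    _≟V_ : (u w : V4) → Dec (u ≡ w)
    ⟨ h , v3 x y z ⟩ ≟V ⟨ h′ , v3 x′ y′ z′ ⟩ with h ≟ h′ | x ≟ x′ | y ≟ y′ | z ≟ z′
    ... | yes refl | yes refl | yes refl | yes refl = yes refl
    ... | no n | _ | _ | _ = no λ e → n (cong hd e)
    ... | yes _ | no n | _ | _ = no λ e → n (cong (λ u → V3.x (tl u)) e)
    ... | yes _ | yes _ | no n | _ = no λ e → n (cong (λ u → V3.y (tl u)) e)
    ... | yes _ | yes _ | yes _ | no n = no λ e → n (cong (λ u → V3.z (tl u)) e)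

    vectors₃ : List V3
    vectors₃ = cartesianProductWith (λ x yz → v3 x (proj₁ yz) (proj₂ yz)) enum (cartesianProductWith _,_ enum enum)

    vectors₄ : List V4
    vectors₄ = cartesianProductWith ⟨_,_⟩ enum vectors₃

    ∑-vectors₃ : ∀ f → ∑ vectors₃ f ≡ ∑∀ (λ x → ∑∀ (λ y → ∑∀ (λ z → f (v3 x y z))))
    ∑-vectors₃ f = trans (∑-cart (λ x yz → v3 x (proj₁ yz) (proj₂ yz)) enum _ f) (∑-cong enum λ x → ∑-cart _,_ enum enum _)

    ∑-vectors₄ : ∀ f → ∑ vectors₄ f ≡ ∑∀ (λ h → ∑∀ (λ x → ∑∀ (λ y → ∑∀ (λ z → f ⟨ h , v3 x y z ⟩))))
    ∑-vectors₄ f = trans (∑-cart ⟨_,_⟩ enum vectors₃ f) (∑-cong enum λ h → ∑-vectors₃ _)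

    -- The transpose `tr` is carried along because it moves planes; `∑-tr` states that it permutes
    -- the functionals, in the form needed for counting them.
    record Iso : Set where
      field
        to from : V4 → V4
        to-⊕    : ∀ u w → to (u ⊕ w) ≡ to u ⊕ to w
        to-·    : ∀ a u → to (a · u) ≡ a · to u
        from-to : ∀ u → from (to u) ≡ u
        to-from : ∀ u → to (from u) ≡ u
        tr      : V4 → V4
        adjoint : ∀ φ u → dot₄ (tr φ) u ≡ dot₄ φ (to u)
        ∑-tr    : ∀ (f : V4 → ℕ) → ∑ vectors₄ (λ φ → f (tr φ)) ≡ ∑ vectors₄ f

    _∘ᴵ_ : Iso → Iso → Iso
    g ∘ᴵ h = record
      { to = λ u → g.to (h.to u)
      ; from = λ u → h.from (g.from u)
      ; to-⊕ = λ u w → trans (cong g.to (h.to-⊕ u w)) (g.to-⊕ _ _)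
      ; to-· = λ a u → trans (cong g.to (h.to-· a u)) (g.to-· a _)
      ; from-to = λ u → trans (cong h.from (g.from-to _)) (h.from-to u)
      ; to-from = λ u → trans (cong g.to (h.to-from _)) (g.to-from u)
      ; tr = λ φ → h.tr (g.tr φ)
      ; adjoint = λ φ u → trans (h.adjoint (g.tr φ) u) (g.adjoint φ (h.to u))
      ; ∑-tr = λ f → trans (g.∑-tr (λ φ → f (h.tr φ))) (h.∑-tr f)
      }
      where
      module g = Iso g
      module h = Iso h

    swap₀₁ swap₁₂ swap₂₃ : Iso
    swap₀₁ = record
      { to = σ ; from = σ ; to-⊕ = λ _ _ → refl ; to-· = λ _ _ → refl ; from-to = λ _ → refl ; to-from = λ _ → refl
      ; tr = σ
      ; adjoint = λ { ⟨ a , v3 b c d ⟩ ⟨ x , v3 y z w ⟩ →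
          solve 3 (λ p r s → r :+ (p :+ s) := p :+ (r :+ s)) refl (a * y) (b * x) (c * z + d * w) }
      ; ∑-tr = λ f → trans (∑-vectors₄ _) (trans (∑-swap enum enum _) (sym (∑-vectors₄ f)))
      }
      where
      σ : V4 → V4
      σ ⟨ h , v3 x y z ⟩ = ⟨ x , v3 h y z ⟩
    swap₁₂ = record
      { to = σ ; from = σ ; to-⊕ = λ _ _ → refl ; to-· = λ _ _ → refl ; from-to = λ _ → refl ; to-from = λ _ → refl
      ; tr = σ
      ; adjoint = λ { ⟨ a , v3 b c d ⟩ ⟨ x , v3 y z w ⟩ →
          cong (a * x +_) (solve 3 (λ p r s → r :+ (p :+ s) := p :+ (r :+ s)) refl (b * z) (c * y) (d * w)) }
      ; ∑-tr = λ f → trans (∑-vectors₄ _) (trans (∑-cong enum λ _ → ∑-swap enum enum _) (sym (∑-vectors₄ f)))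
      }
      where
      σ : V4 → V4
      σ ⟨ h , v3 x y z ⟩ = ⟨ h , v3 y x z ⟩
    swap₂₃ = record
      { to = σ ; from = σ ; to-⊕ = λ _ _ → refl ; to-· = λ _ _ → refl ; from-to = λ _ → refl ; to-from = λ _ → refl
      ; tr = σ
      ; adjoint = λ { ⟨ a , v3 b c d ⟩ ⟨ x , v3 y z w ⟩ →
          cong (λ s → a * x + (b * y + s)) (+-comm (d * z) (c * w)) }
      ; ∑-tr = λ f → trans (∑-vectors₄ _) (trans (∑-cong enum λ _ → ∑-cong enum λ _ → ∑-swap enum enum _) (sym (∑-vectors₄ f)))
      }
      where
      σ : V4 → V4
      σ ⟨ h , v3 x y z ⟩ = ⟨ h , v3 x z y ⟩

    module Shear (p a b c : F) (p≢0 : p ≢ 0#) where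
      private
        r : F
        r = inv p

        r*p : ∀ x → x * r * p ≡ x
        r*p x = trans (*-assoc x r p) (trans (cong (x *_) (*-invˡ p≢0)) (*-identityʳ x))

        p*r : ∀ x → x * p * r ≡ x
        p*r x = trans (*-assoc x p r) (trans (cong (x *_) (*-inv p≢0)) (*-identityʳ x))

        twice : ∀ x y → x + y + y ≡ x
        twice = solve 2 (λ x y → x :+ y :+ y := x) refl

      -- Elimination with pivot p: the head is divided by p and the other coordinates are cleared,
      -- while vectors with head 0 stay fixed.
      shear : Iso
      shear = record
        { to = λ { ⟨ h , v3 x y z ⟩ → ⟨ h * r , v3 (x + h * r * a) (y + h * r * b) (z + h * r * c) ⟩ }
        ; from = λ { ⟨ h , v3 x y z ⟩ → ⟨ h * p , v3 (x + h * a) (y + h * b) (z + h * c) ⟩ }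
        ; to-⊕ = λ { ⟨ h , v3 x y z ⟩ ⟨ h′ , v3 x′ y′ z′ ⟩ → v4≡ (distribʳ r h h′) (add h h′ x x′ a) (add h h′ y y′ b) (add h h′ z z′ c) }
        ; to-· = λ { s ⟨ h , v3 x y z ⟩ → v4≡ (*-assoc s h r) (mul s h x a) (mul s h y b) (mul s h z c) }
        ; from-to = λ { ⟨ h , v3 x y z ⟩ → v4≡ (r*p h) (twice x _) (twice y _) (twice z _) }
        ; to-from = λ { ⟨ h , v3 x y z ⟩ → v4≡ (p*r h) (back h x a) (back h y b) (back h z c) }
        ; tr = λ { ⟨ h , v3 x y z ⟩ → ⟨ (h + (x * a + (y * b + z * c))) * r , v3 x y z ⟩ }
        ; adjoint = λ { ⟨ h , v3 x y z ⟩ ⟨ h′ , v3 x′ y′ z′ ⟩ → adj h x y z h′ x′ y′ z′ }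
        ; ∑-tr = λ f → trans (∑-vectors₄ _) (trans (move f) (sym (∑-vectors₄ f)))
        }
        where
        add : ∀ h h′ x x′ a → x + x′ + (h + h′) * r * a ≡ (x + h * r * a) + (x′ + h′ * r * a)
        add h h′ x x′ a = solve 6 (λ h h′ x x′ a r → x :+ x′ :+ (h :+ h′) :* r :* a := (x :+ h :* r :* a) :+ (x′ :+ h′ :* r :* a)) refl h h′ x x′ a r
        mul : ∀ s h x a → s * x + s * h * r * a ≡ s * (x + h * r * a)
        mul s h x a = solve 5 (λ s h x a r → s :* x :+ s :* h :* r :* a := s :* (x :+ h :* r :* a)) refl s h x a r
        back : ∀ h x a → x + h * a + h * p * r * a ≡ x
        back h x a = trans (cong (λ t → x + h * a + t * a) (p*r h)) (twice x (h * a))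
        term : ∀ k x x′ a → x * a * k + x * x′ ≡ x * (x′ + k * a)
        term = solve 4 (λ k x x′ a → x :* a :* k :+ x :* x′ := x :* (x′ :+ k :* a)) refl
        adj : ∀ h x y z h′ x′ y′ z′ → (h + (x * a + (y * b + z * c))) * r * h′ + (x * x′ + (y * y′ + z * z′))
              ≡ h * (h′ * r) + (x * (x′ + h′ * r * a) + (y * (y′ + h′ * r * b) + z * (z′ + h′ * r * c)))
        adj h x y z h′ x′ y′ z′ = begin
          (h + (x * a + (y * b + z * c))) * r * h′ + (x * x′ + (y * y′ + z * z′))
            ≡⟨ cong (_+ (x * x′ + (y * y′ + z * z′))) (solve 6 (λ h s t u r h′ → (h :+ (s :+ (t :+ u))) :* r :* h′ :=
                 h :* (h′ :* r) :+ (s :* (h′ :* r) :+ (t :* (h′ :* r) :+ u :* (h′ :* r)))) refl h (x * a) (y * b) (z * c) r h′) ⟩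
          h * k + (x * a * k + (y * b * k + z * c * k)) + (x * x′ + (y * y′ + z * z′))
            ≡⟨ solve 7 (λ o s t u s′ t′ u′ → o :+ (s :+ (t :+ u)) :+ (s′ :+ (t′ :+ u′)) := o :+ ((s :+ s′) :+ ((t :+ t′) :+ (u :+ u′)))) refl
                 (h * k) (x * a * k) (y * b * k) (z * c * k) (x * x′) (y * y′) (z * z′) ⟩
          h * k + ((x * a * k + x * x′) + ((y * b * k + y * y′) + (z * c * k + z * z′)))
            ≡⟨ cong (h * k +_) (cong₂ _+_ (term k x x′ a) (cong₂ _+_ (term k y y′ b) (term k z z′ c))) ⟩
          h * k + (x * (x′ + k * a) + (y * (y′ + k * b) + z * (z′ + k * c))) ∎
          where
          open ≡-Reasoning
          k = h′ * r
        -- For a fixed tail the transpose acts on the head by an affine bijection, so the sum over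
        -- the head is first moved innermost.
        move : ∀ f → ∑∀ (λ h → ∑∀ (λ x → ∑∀ (λ y → ∑∀ (λ z → f ⟨ (h + (x * a + (y * b + z * c))) * r , v3 x y z ⟩))))
                   ≡ ∑∀ (λ h → ∑∀ (λ x → ∑∀ (λ y → ∑∀ (λ z → f ⟨ h , v3 x y z ⟩))))
        move f = begin
          ∑∀ (λ h → ∑∀ (λ x → ∑∀ (λ y → ∑∀ (λ z → f ⟨ (h + (x * a + (y * b + z * c))) * r , v3 x y z ⟩)))) ≡⟨ inwards _ ⟩
          ∑∀ (λ x → ∑∀ (λ y → ∑∀ (λ z → ∑∀ (λ h → f ⟨ (h + (x * a + (y * b + z * c))) * r , v3 x y z ⟩))))
            ≡⟨ ∑-cong enum (λ x → ∑-cong enum λ y → ∑-cong enum λ z → ∑∀-bij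
                 (λ h → (h + (x * a + (y * b + z * c))) * r) (λ h → h * p + (x * a + (y * b + z * c)))
                 (λ h → trans (cong (_+ (x * a + (y * b + z * c))) (r*p _)) (twice h _))
                 (λ h → trans (cong (_* r) (twice (h * p) _)) (p*r h)) (λ h → f ⟨ h , v3 x y z ⟩)) ⟩
          ∑∀ (λ x → ∑∀ (λ y → ∑∀ (λ z → ∑∀ (λ h → f ⟨ h , v3 x y z ⟩)))) ≡⟨ sym (inwards _) ⟩
          ∑∀ (λ h → ∑∀ (λ x → ∑∀ (λ y → ∑∀ (λ z → f ⟨ h , v3 x y z ⟩)))) ∎
          where
          open ≡-Reasoning
          inwards : ∀ (f : F → F → F → F → ℕ) → ∑∀ (λ h → ∑∀ (λ x → ∑∀ (λ y → ∑∀ (λ z → f h x y z)))) ≡ ∑∀ (λ x → ∑∀ (λ y → ∑∀ (λ z → ∑∀ (λ h → f h x y z))))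
          inwards f = trans (∑-swap enum enum _) (∑-cong enum λ x → trans (∑-swap enum enum _) (∑-cong enum λ y → ∑-swap enum enum _))

      shear-self : Iso.to shear ⟨ p , v3 a b c ⟩ ≡ e₁
      shear-self = v4≡ (*-inv p≢0) (clear a) (clear b) (clear c)
        where
        clear : ∀ a → a + p * r * a ≡ 0#
        clear a = trans (cong (λ t → a + t * a) (*-inv p≢0)) (trans (cong (a +_) (*-identityˡ a)) (x+x≡0 a))

      shear-e₂ : Iso.to shear e₂ ≡ e₂
      shear-e₂ = v4≡ (zeroˡ r) (same 1# a) (same 0# b) (same 0# c)
        where
        same : ∀ x a → x + 0# * r * a ≡ x
        same x a = solve 3 (λ x r a → x :+ con false :* r :* a := x) refl x r a

    to-e₁ : ∀ u → u ≢ 0⃗ → ∃ λ (g : Iso) → Iso.to g u ≡ e₁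
    to-e₁ ⟨ h , v3 x y z ⟩ u≢0 with h ≟ 0# | x ≟ 0# | y ≟ 0# | z ≟ 0#
    ... | no n | _ | _ | _ = Shear.shear h x y z n , Shear.shear-self h x y z n
    ... | yes _ | no n | _ | _ = Shear.shear x h y z n ∘ᴵ swap₀₁ , Shear.shear-self x h y z n
    ... | yes _ | yes _ | no n | _ = Shear.shear y h x z n ∘ᴵ (swap₀₁ ∘ᴵ swap₁₂) , Shear.shear-self y h x z n
    ... | yes _ | yes _ | yes _ | no n = Shear.shear z h x y n ∘ᴵ (swap₀₁ ∘ᴵ (swap₁₂ ∘ᴵ swap₂₃)) , Shear.shear-self z h x y n
    ... | yes refl | yes refl | yes refl | yes refl = ⊥-elim (u≢0 refl)

    -- A shear fixes `e₂`; conjugation by `swap₀₁` makes it fix `e₁` and bring u to `e₂`, with the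
    -- pivot taken among the last three coordinates.
    fix-e₁-to-e₂ : ∀ u → tl u ≢ 𝟎 → ∃ λ (g : Iso) → Iso.to g e₁ ≡ e₁ × Iso.to g u ≡ e₂
    fix-e₁-to-e₂ ⟨ h , v3 x y z ⟩ u≢0 with x ≟ 0# | y ≟ 0# | z ≟ 0#
    ... | no n | _ | _ = swap₀₁ ∘ᴵ (Shear.shear x h y z n ∘ᴵ swap₀₁) ,
          cong (Iso.to swap₀₁) (Shear.shear-e₂ x h y z n) , cong (Iso.to swap₀₁) (Shear.shear-self x h y z n)
    ... | yes _ | no n | _ = swap₀₁ ∘ᴵ (Shear.shear y h x z n ∘ᴵ (swap₀₁ ∘ᴵ swap₁₂)) ,
          cong (Iso.to swap₀₁) (Shear.shear-e₂ y h x z n) , cong (Iso.to swap₀₁) (Shear.shear-self y h x z n)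
    ... | yes _ | yes _ | no n = swap₀₁ ∘ᴵ (Shear.shear z h x y n ∘ᴵ (swap₀₁ ∘ᴵ (swap₁₂ ∘ᴵ swap₂₃))) ,
          cong (Iso.to swap₀₁) (Shear.shear-e₂ z h x y n) , cong (Iso.to swap₀₁) (Shear.shear-self z h x y n)
    ... | yes refl | yes refl | yes refl = ⊥-elim (u≢0 refl)

-- Tangents of a cap through a point on one of its secants.

module CapsInSpace where
  open ≡ using (refl; sym; trans; cong; cong₂; subst)
  open Counting
  open Characteristic2
  open Arcs
  open PlaneOverField
  open SpaceOverField

  length-filter-∑ : ∀ {A : Set} {p} {P : Pred A p} (P? : Decidable P) (xs : List A) → length (filter P? xs) ≡ ∑ xs (λ x → 𝟙 (P? x))
  length-filter-∑ P? xs = trans (sym (∑-one (filter P? xs))) (trans (∑-filter P? xs _) (∑-cong xs λ x → ℕₚ.*-identityʳ _))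

  module _ {A : Set} (_≟_ : (x y : A) → Dec (x ≡ y)) where

    ∑-Unique≤1 : ∀ xs → Unique xs → ∀ y → ∑ xs (λ x → 𝟙 (x ≟ y)) ℕ.≤ 1
    ∑-Unique≤1 [] _ y = z≤n
    ∑-Unique≤1 (x ∷ xs) (x∉ ∷ u) y with x ≟ y
    ... | no _ = ∑-Unique≤1 xs u y
    ... | yes refl = ℕₚ.≤-reflexive (cong suc (∑-zero-∈ xs λ z z∈ → 𝟙-no (z ≟ x) λ e → All.lookup x∉ z∈ (sym e)))

    ∑-Unique≡1 : ∀ xs → Unique xs → ∀ {y} → y ∈ xs → ∑ xs (λ x → 𝟙 (x ≟ y)) ≡ 1
    ∑-Unique≡1 xs u {y} y∈ = ℕₚ.≤-antisym (∑-Unique≤1 xs u y)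
      (ℕₚ.≤-trans (ℕₚ.≤-reflexive (sym (𝟙-yes (y ≟ y) refl))) (f≤∑ xs (λ x → 𝟙 (x ≟ y)) y∈))

  𝟙-¬ : ∀ {p} {P : Set p} (d : Dec P) → 𝟙 (¬? d) ℕ.+ 𝟙 d ≡ 1
  𝟙-¬ (yes _) = refl
  𝟙-¬ (no _) = refl

  module Caps (𝔽 : Char2Field) where
    open FieldTheory 𝔽
    open PG2 𝔽
    open Space 𝔽
    open ArcLemma 𝔽

    comb₂ : F → V4 → F → V4 → V4
    comb₂ a u b v = a · u ⊕ b · v

    comb₃ : F → V4 → F → V4 → F → V4 → V4
    comb₃ a u b v c w = (a · u ⊕ b · v) ⊕ c · w

    LI₂ : V4 → V4 → Set
    LI₂ u v = ∀ a b → comb₂ a u b v ≡ 0⃗ → a ≡ 0# × b ≡ 0#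

    LI₃ : V4 → V4 → V4 → Set
    LI₃ u v w = ∀ a b c → comb₃ a u b v c w ≡ 0⃗ → a ≡ 0# × b ≡ 0# × c ≡ 0#

    Dependent : V4 → V4 → V4 → Set
    Dependent u v w = ∃ λ abc → comb₃ (V3.x abc) u (V3.y abc) v (V3.z abc) w ≡ 0⃗ × abc ≢ 𝟎

    ∈vectors₃ : ∀ v → v ∈ vectors₃
    ∈vectors₃ (v3 x y z) = ∈-cartesianProductWith⁺ (λ x yz → v3 x (proj₁ yz) (proj₂ yz)) (enum-complete x)
      (∈-cartesianProductWith⁺ _,_ (enum-complete y) (enum-complete z))

    -- The finitely many coefficient triples are searched, so collinearity is decided and comes with
    -- a witness.
    LI₃⊎Dependent : ∀ u v w → LI₃ u v w ⊎ Dependent u v w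
    LI₃⊎Dependent u v w = decide (∑-zero⊎∃ vectors₃ f)
      where
      zero? : ∀ abc → Dec (comb₃ (V3.x abc) u (V3.y abc) v (V3.z abc) w ≡ 0⃗)
      zero? abc = comb₃ (V3.x abc) u (V3.y abc) v (V3.z abc) w ≟V 0⃗
      f : V3 → ℕ
      f abc = 𝟙 (zero? abc ×-dec ¬? (abc ≟𝟎))
      decide : (∀ x → x ∈ vectors₃ → f x ≡ 0) ⊎ (∃ λ x → x ∈ vectors₃ × f x ≢ 0) → LI₃ u v w ⊎ Dependent u v w
      decide (inj₂ (abc , _ , h)) = inj₂ (abc , 𝟙≢0 (zero? abc ×-dec ¬? (abc ≟𝟎)) h)
      decide (inj₁ z) = inj₁ λ a b c e → trivial a b c e (v3 a b c ≟𝟎)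
        where
        trivial : ∀ a b c → comb₃ a u b v c w ≡ 0⃗ → Dec (v3 a b c ≡ 𝟎) → a ≡ 0# × b ≡ 0# × c ≡ 0#
        trivial a b c e (yes h) = cong V3.x h , cong V3.y h , cong V3.z h
        trivial a b c e (no h) = ⊥-elim (ℕₚ.1+n≢0 (trans (sym (𝟙-yes (zero? (v3 a b c) ×-dec ¬? (v3 a b c ≟𝟎)) (e , h))) (z (v3 a b c) (∈vectors₃ _))))

    LI₃⇒¬Dependent : ∀ {u v w} → LI₃ u v w → ¬ Dependent u v w
    LI₃⇒¬Dependent li (v3 a b c , e , h) with li a b c e
    ... | refl , refl , refl = h refl

    LI₃? : ∀ u v w → Dec (LI₃ u v w)
    LI₃? u v w = case (LI₃⊎Dependent u v w)
      where
      case : LI₃ u v w ⊎ Dependent u v w → Dec (LI₃ u v w)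
      case (inj₁ l) = yes l
      case (inj₂ d) = no λ l → LI₃⇒¬Dependent l d

    ⊕-comm : ∀ u v → u ⊕ v ≡ v ⊕ u
    ⊕-comm ⟨ h , v3 x y z ⟩ ⟨ h′ , v3 x′ y′ z′ ⟩ = v4≡ (+-comm h h′) (+-comm x x′) (+-comm y y′) (+-comm z z′)

    ⊕-swapʳ : ∀ u v w → (u ⊕ v) ⊕ w ≡ (u ⊕ w) ⊕ v
    ⊕-swapʳ ⟨ h , v3 x y z ⟩ ⟨ h′ , v3 x′ y′ z′ ⟩ ⟨ h″ , v3 x″ y″ z″ ⟩ = v4≡ (s h h′ h″) (s x x′ x″) (s y y′ y″) (s z z′ z″)
      where
      s : ∀ a b c → a + b + c ≡ a + c + b
      s = solve 3 (λ a b c → a :+ b :+ c := a :+ c :+ b) refl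

    LI₃-swap₁₂ : ∀ {u v w} → LI₃ u v w → LI₃ v u w
    LI₃-swap₁₂ {u} {v} {w} li a b c e with li b a c (trans (cong (_⊕ c · w) (⊕-comm (b · u) (a · v))) e)
    ... | b0 , a0 , c0 = a0 , b0 , c0

    LI₃-swap₂₃ : ∀ {u v w} → LI₃ u v w → LI₃ u w v
    LI₃-swap₂₃ {u} {v} {w} li a b c e with li a c b (trans (⊕-swapʳ (a · u) (c · v) (b · w)) e)
    ... | a0 , c0 , b0 = a0 , b0 , c0

    module IsoLemmas (g : Iso) where
      open Iso g

      0·≡0⃗ : ∀ u → 0# · u ≡ 0⃗
      0·≡0⃗ ⟨ h , v3 x y z ⟩ = v4≡ (zeroˡ h) (zeroˡ x) (zeroˡ y) (zeroˡ z)

      to-0⃗ : to 0⃗ ≡ 0⃗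
      to-0⃗ = trans (cong to (sym (0·≡0⃗ 0⃗))) (trans (to-· 0# 0⃗) (0·≡0⃗ (to 0⃗)))

      to-injective : ∀ {u v} → to u ≡ to v → u ≡ v
      to-injective {u} {v} e = trans (sym (from-to u)) (trans (cong from e) (from-to v))

      to≡0⃗ : ∀ {u} → to u ≡ 0⃗ → u ≡ 0⃗
      to≡0⃗ e = to-injective (trans e (sym to-0⃗))

      to-comb₂ : ∀ a u b v → to (comb₂ a u b v) ≡ comb₂ a (to u) b (to v)
      to-comb₂ a u b v = trans (to-⊕ _ _) (cong₂ _⊕_ (to-· a u) (to-· b v))

      to-comb₃ : ∀ a u b v c w → to (comb₃ a u b v c w) ≡ comb₃ a (to u) b (to v) c (to w)
      to-comb₃ a u b v c w = trans (to-⊕ _ _) (cong₂ _⊕_ (to-comb₂ a u b v) (to-· c w))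

      dependent-in-coordinates : ∀ {u v w} → LI₃ u v w → ∀ a b c {u′ v′ w′} → to u ≡ u′ → to v ≡ v′ → to w ≡ w′ →
                                 comb₃ a u′ b v′ c w′ ≡ 0⃗ → a ≡ 0# × b ≡ 0# × c ≡ 0#
      dependent-in-coordinates li a b c refl refl refl e = li a b c (to≡0⃗ (trans (to-comb₃ a _ b _ c _) e))

    record IsCap (K : List V4) : Set where
      field
        unique  : Unique K
        nonzero : ∀ {u} → u ∈ K → u ≢ 0⃗
        li₂     : ∀ {u v} → u ∈ K → v ∈ K → u ≢ v → LI₂ u v
        li₃     : ∀ {u v w} → u ∈ K → v ∈ K → w ∈ K → u ≢ v → u ≢ w → v ≢ w → LI₃ u v w

    -- For P in K and N off K, the line NP is a tangent; in the alternative `Secant` it meets K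
    -- again.
    Tangent : List V4 → V4 → V4 → Set
    Tangent K N P = ∀ Q → Q ∈ K → Q ≢ P → LI₃ N P Q

    Secant : List V4 → V4 → V4 → Set
    Secant K N P = ∃ λ Q → Q ∈ K × Q ≢ P × Dependent N P Q

    Tangent⊎Secant : ∀ K N P → Tangent K N P ⊎ Secant K N P
    Tangent⊎Secant K N P = decide (∑-zero⊎∃ K f)
      where
      bad? : ∀ Q → Dec (Q ≢ P × ¬ LI₃ N P Q)
      bad? Q = ¬? (Q ≟V P) ×-dec ¬? (LI₃? N P Q)
      f : V4 → ℕ
      f Q = 𝟙 (bad? Q)
      decide : (∀ Q → Q ∈ K → f Q ≡ 0) ⊎ (∃ λ Q → Q ∈ K × f Q ≢ 0) → Tangent K N P ⊎ Secant K N P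
      decide (inj₁ z) = inj₁ λ Q Q∈ Q≢P → good Q Q∈ Q≢P (LI₃? N P Q)
        where
        good : ∀ Q → Q ∈ K → Q ≢ P → Dec (LI₃ N P Q) → LI₃ N P Q
        good Q Q∈ Q≢P (yes l) = l
        good Q Q∈ Q≢P (no l) = ⊥-elim (ℕₚ.1+n≢0 (trans (sym (𝟙-yes (bad? Q) (Q≢P , l))) (z Q Q∈)))
      decide (inj₂ (Q , Q∈ , h)) = inj₂ (Q , Q∈ , proj₁ (𝟙≢0 (bad? Q) h) , dep (LI₃⊎Dependent N P Q))
        where
        dep : LI₃ N P Q ⊎ Dependent N P Q → Dependent N P Q
        dep (inj₁ l) = ⊥-elim (proj₂ (𝟙≢0 (bad? Q) h) l)
        dep (inj₂ d) = d

    Tangent? : ∀ K N P → Dec (Tangent K N P)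
    Tangent? K N P = case (Tangent⊎Secant K N P)
      where
      case : Tangent K N P ⊎ Secant K N P → Dec (Tangent K N P)
      case (inj₁ t) = yes t
      case (inj₂ (Q , Q∈ , Q≢P , d)) = no λ t → LI₃⇒¬Dependent (t Q Q∈ Q≢P) d

    τ : List V4 → V4 → ℕ
    τ K N = ∑ K λ P → 𝟙 (Tangent? K N P)

    -- The planes through the line of e₁ and e₂ are indexed by the points (1 : 0) and (λ : 1)
    -- of a projective line, and each is coordinatised as an affine plane.

    _≟M_ : (c d : Maybe F) → Dec (c ≡ d)
    _≟M_ = Maybeₚ.≡-dec _≟_

    classes : List (Maybe F)
    classes = nothing ∷ map just enum

    once-class : ∀ c → ∑ classes (λ d → 𝟙 (c ≟M d)) ≡ 1
    once-class nothing = cong suc (trans (∑-map just enum _) (∑-zero-∈ enum λ _ _ → refl))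
    once-class (just a) = trans (∑-map just enum _) (trans (∑-cong enum λ b → 𝟙-cong (just a ≟M just b) (a ≟ b)
      Maybeₚ.just-injective (cong just)) (Finite.once finite a))

    length-classes : length classes ≡ suc q
    length-classes = cong suc (length-map just enum)

    rep₁ rep₂ : Maybe F → F
    rep₁ nothing = 1#
    rep₁ (just a) = a
    rep₂ nothing = 0#
    rep₂ (just _) = 1#

    chart : Maybe F → Point → V4
    chart c s = ⟨ X s , v3 (Y s) (rep₁ c) (rep₂ c) ⟩

    -- The vector is divided by w, or by z if w = 0, so that its last two coordinates become the
    -- chosen representative of their ratio. The first two are then affine coordinates in the plane
    -- with that ratio.
    module Chart (x′ y′ z w : F) where
      den : F
      den with w ≟ 0#
      ... | yes _ = z
      ... | no _ = w

      class : Maybe F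
      class with w ≟ 0#
      ... | yes _ = nothing
      ... | no _ = just (z * inv w)

      point : Point
      point = x′ * inv den , y′ * inv den

      den≢0 : ¬ (z ≡ 0# × w ≡ 0#) → den ≢ 0#
      den≢0 h e with w ≟ 0#
      ... | yes w0 = h (e , w0)
      ... | no w≢0 = w≢0 e

      private
        z-eq : z * inv den ≡ rep₁ class ⊎ den ≡ 0#
        z-eq with w ≟ 0#
        ... | no _ = inj₁ refl
        ... | yes _ with z ≟ 0#
        ...   | yes e = inj₂ e
        ...   | no h = inj₁ (*-inv h)

        w-eq : w * inv den ≡ rep₂ class
        w-eq with w ≟ 0#
        ... | no h = *-inv h
        ... | yes refl = zeroˡ _

      in-chart : ¬ (z ≡ 0# × w ≡ 0#) → inv den · ⟨ x′ , v3 y′ z w ⟩ ≡ chart class point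
      in-chart h = v4≡ (*-comm _ _) (*-comm _ _) (trans (*-comm _ _) (zed z-eq)) (trans (*-comm _ _) w-eq)
        where
        zed : z * inv den ≡ rep₁ class ⊎ den ≡ 0# → z * inv den ≡ rep₁ class
        zed (inj₁ e) = e
        zed (inj₂ e) = ⊥-elim (den≢0 h e)

    ·-assoc : ∀ a b u → a · b · u ≡ (a * b) · u
    ·-assoc a b ⟨ h , v3 x y z ⟩ = v4≡ (s h) (s x) (s y) (s z)
      where
      s : ∀ x → a * (b * x) ≡ a * b * x
      s x = sym (*-assoc a b x)

    ⊕-self : ∀ u → u ⊕ u ≡ 0⃗
    ⊕-self ⟨ h , v3 x y z ⟩ = v4≡ (x+x≡0 h) (x+x≡0 x) (x+x≡0 y) (x+x≡0 z)

    1·cancelˡ : ∀ b x y → comb₂ 1# (comb₂ 0# x b y) b y ≡ 0⃗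
    1·cancelˡ b ⟨ h , v3 p r s ⟩ ⟨ h′ , v3 p′ r′ s′ ⟩ = v4≡ (z h h′) (z p p′) (z r r′) (z s s′)
      where
      z : ∀ x y → 1# * (0# * x + b * y) + b * y ≡ 0#
      z x y = solve 3 (λ b x y → con true :* (con false :* x :+ b :* y) :+ b :* y := con false) refl b x y

    1·cancel-e₁ : ∀ h → comb₂ 1# ⟨ h , 𝟎 ⟩ h e₁ ≡ 0⃗
    1·cancel-e₁ h = v4≡ (solve 1 (λ h → con true :* h :+ h :* con true := con false) refl h) z z z
      where
      z : 1# * 0# + h * 0# ≡ 0#
      z = solve 1 (λ h → con true :* con false :+ h :* con false := con false) refl h

    on-line : ∀ {N U W} → LI₂ U W → Dependent N U W → ∃₂ λ α β → N ≡ comb₂ α U β W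
    on-line {N} {U} {W} li (v3 a b d , e , nt) = inv a * b , inv a * d , express N U W e
      where
      a≢0 : a ≢ 0#
      a≢0 refl = nt (v3≡ refl (proj₁ bd) (proj₂ bd))
        where
        drop : ∀ N U W → comb₃ 0# N b U d W ≡ comb₂ b U d W
        drop ⟨ h , v3 p r s ⟩ ⟨ h′ , v3 p′ r′ s′ ⟩ ⟨ h″ , v3 p″ r″ s″ ⟩ = v4≡ (z h h′ h″) (z p p′ p″) (z r r′ r″) (z s s′ s″)
          where
          z : ∀ n u w → 0# * n + b * u + d * w ≡ b * u + d * w
          z n u w = cong (_+ d * w) (trans (cong (_+ b * u) (zeroˡ n)) (+-identityˡ _))
        bd : b ≡ 0# × d ≡ 0#
        bd = li b d (trans (sym (drop N U W)) e)
      express : ∀ N U W → comb₃ a N b U d W ≡ 0⃗ → N ≡ comb₂ (inv a * b) U (inv a * d) W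
      express ⟨ h , v3 p r s ⟩ ⟨ h′ , v3 p′ r′ s′ ⟩ ⟨ h″ , v3 p″ r″ s″ ⟩ e = v4≡ (x h h′ h″ (cong hd e))
          (x p p′ p″ (cong (λ u → V3.x (tl u)) e)) (x r r′ r″ (cong (λ u → V3.y (tl u)) e)) (x s s′ s″ (cong (λ u → V3.z (tl u)) e))
        where
        x : ∀ n u w → a * n + b * u + d * w ≡ 0# → n ≡ inv a * b * u + inv a * d * w
        x n u w e = begin
          n                              ≡⟨ sym (*-identityˡ n) ⟩
          1# * n                         ≡⟨ cong (_* n) (sym (*-invˡ a≢0)) ⟩
          inv a * a * n                  ≡⟨ *-assoc (inv a) a n ⟩
          inv a * (a * n)                ≡⟨ cong (inv a *_) (x+y≡0⇒x≡y (trans (sym (+-assoc (a * n) _ _)) e)) ⟩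
          inv a * (b * u + d * w)        ≡⟨ distribˡ (inv a) _ _ ⟩
          inv a * (b * u) + inv a * (d * w) ≡⟨ cong₂ _+_ (sym (*-assoc (inv a) b u)) (sym (*-assoc (inv a) d w)) ⟩
          inv a * b * u + inv a * d * w  ∎
          where open ≡-Reasoning

    module SecantPoint {K : List V4} (cap : IsCap K) {x y N : V4} {α β : F}
                       (x∈ : x ∈ K) (y∈ : y ∈ K) (x≢y : x ≢ y) (N≡ : N ≡ comb₂ α x β y)
                       (off : ∀ P → P ∈ K → LI₂ N P) where
      open IsCap cap

      α≢0 : α ≢ 0#
      α≢0 refl = 1≢0 (proj₁ (off y y∈ 1# β (trans (cong (λ n → comb₂ 1# n β y) N≡) (1·cancelˡ β x y))))

      -- The secant becomes the line at infinity of every chart: x is the horizontal direction, N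
      -- the vertical one, and y the direction of slope 1/α. N is off K, so it differs from x and
      -- both can be normalised.
      coordinates : ∃ λ (g : Iso) → Iso.to g x ≡ e₁ × Iso.to g N ≡ e₂
      coordinates with to-e₁ x (nonzero x∈)
      ... | g₁ , gx with tl (Iso.to g₁ N) ≟𝟎
      ...   | yes e = ⊥-elim (1≢0 (proj₁ (off x x∈ 1# (hd (Iso.to g₁ N)) (IsoLemmas.to≡0⃗ g₁
                        (trans (IsoLemmas.to-comb₂ g₁ 1# N _ x)
                          (trans (cong₂ (λ n m → comb₂ 1# ⟨ hd (Iso.to g₁ N) , n ⟩ (hd (Iso.to g₁ N)) m) e gx) (1·cancel-e₁ _)))))))
      ...   | no h with fix-e₁-to-e₂ (Iso.to g₁ N) h
      ...     | g₂ , ge , gN = g₂ ∘ᴵ g₁ , trans (cong (Iso.to g₂) gx) ge , gN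

      module InCoordinates (g : Iso) (to-x : Iso.to g x ≡ e₁) (to-N : Iso.to g N ≡ e₂) where
        open Iso g
        open IsoLemmas g

        β·to-y : β · to y ≡ ⟨ α , v3 1# 0# 0# ⟩
        β·to-y = recover (to y) (trans (sym to-N) (trans (cong to N≡) (trans (to-comb₂ α x β y) (cong (λ u → comb₂ α u β (to y)) to-x))))
          where
          recover : ∀ u → e₂ ≡ comb₂ α e₁ β u → β · u ≡ ⟨ α , v3 1# 0# 0# ⟩
          recover ⟨ h , v3 p r s ⟩ e = v4≡
            (trans (lem α 1# (β * h)) (trans (cong (α * 1# +_) (sym (cong hd e))) (solve 1 (λ a → a :* con true :+ con false := a) refl α)))
            (zero-case (β * p) 1# (cong (λ u → V3.x (tl u)) e))
            (zero-case (β * r) 0# (cong (λ u → V3.y (tl u)) e))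
            (zero-case (β * s) 0# (cong (λ u → V3.z (tl u)) e))
            where
            lem : ∀ a o b → b ≡ a * o + (a * o + b)
            lem = solve 3 (λ a o b → b := a :* o :+ (a :* o :+ b)) refl
            zero-case : ∀ b c → c ≡ α * 0# + b → b ≡ c
            zero-case b c e = trans (solve 2 (λ a b → b := a :* con false :+ b) refl α b) (sym e)

        kβ·to-y : ∀ k → (k * β) · to y ≡ ⟨ k * α , v3 k 0# 0# ⟩
        kβ·to-y k = trans (sym (·-assoc k β (to y))) (trans (cong (k ·_) β·to-y) (v4≡ refl (*-identityʳ k) (zeroʳ k) (zeroʳ k)))

        module C (P : V4) = Chart (hd (to P)) (V3.x (tl (to P))) (V3.y (tl (to P))) (V3.z (tl (to P)))

        cls : V4 → Maybe F
        cls P = C.class P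

        pt : V4 → Point
        pt P = C.point P

        d : V4 → F
        d P = inv (C.den P)

        Other : V4 → Set
        Other P = P ≢ x × P ≢ y

        off-secant : ∀ {P} → P ∈ K → Other P → ¬ (V3.y (tl (to P)) ≡ 0# × V3.z (tl (to P)) ≡ 0#)
        off-secant {P} P∈ (P≢x , P≢y) (z0 , w0) = 1≢0 (proj₁ (dependent-in-coordinates
            (li₃ P∈ x∈ y∈ P≢x P≢y x≢y) 1# (h + p * α) (p * β) {v′ = e₁} {w′ = to y} refl to-x refl
            (trans (cong₂ (λ u w → (1# · u ⊕ (h + p * α) · e₁) ⊕ w) coords (kβ·to-y p)) (v4≡
              (solve 3 (λ h p a → con true :* h :+ (h :+ p :* a) :* con true :+ p :* a := con false) refl h p α)
              (solve 2 (λ p k → con true :* p :+ k :* con false :+ p := con false) refl p (h + p * α))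
              (nil (h + p * α)) (nil (h + p * α))))))
          where
          h = hd (to P)
          p = V3.x (tl (to P))
          coords : to P ≡ ⟨ h , v3 p 0# 0# ⟩
          coords = v4≡ refl refl z0 w0
          nil : ∀ k → 1# * 0# + k * 0# + 0# ≡ 0#
          nil = solve 1 (λ k → con true :* con false :+ k :* con false :+ con false := con false) refl

        d≢0 : ∀ {P} → P ∈ K → Other P → d P ≢ 0#
        d≢0 {P} P∈ o = inv≢0 (C.den≢0 P (off-secant P∈ o))

        to-chart : ∀ {P c} → P ∈ K → Other P → cls P ≡ c → d P · to P ≡ chart c (pt P)
        to-chart {P} P∈ o refl = C.in-chart P (off-secant P∈ o)

        module Pair {P Q c} (P∈ : P ∈ K) (oP : Other P) (cP : cls P ≡ c) (Q∈ : Q ∈ K) (oQ : Other Q) (cQ : cls Q ≡ c) (P≢Q : P ≢ Q) where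
          s w : Point
          s = pt P
          w = pt Q

          chart-sum : chart c s ⊕ chart c w ≡ ⟨ X s + X w , v3 (Y s + Y w) 0# 0# ⟩
          chart-sum = v4≡ refl refl (x+x≡0 _) (x+x≡0 _)

          sum-coords : d P · to P ⊕ d Q · to Q ≡ ⟨ X s + X w , v3 (Y s + Y w) 0# 0# ⟩
          sum-coords = trans (cong₂ _⊕_ (to-chart P∈ oP cP) (to-chart Q∈ oQ cQ)) chart-sum

          pt-distinct : s ≢ w
          pt-distinct e = d≢0 P∈ oP (proj₁ (li₂ P∈ Q∈ P≢Q (d P) (d Q) (to≡0⃗ (trans (to-comb₂ _ P _ Q)
            (trans sum-coords (v4≡ (trans (cong (λ u → X u + X w) e) (x+x≡0 _)) (trans (cong (λ u → Y u + Y w) e) (x+x≡0 _)) refl refl))))))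

          -- Two points of a chart differ by a direction, and if this is the direction of R then the
          -- three points are collinear. With R = x, y and N this gives the conditions on
          -- horizontal, oblique and vertical lines.
          third : ∀ R {a b} k → LI₃ P Q R → k · to R ≡ ⟨ a , v3 b 0# 0# ⟩ → X s + X w ≡ a → Y s + Y w ≡ b → ⊥
          third R {a} {b} k li e ea eb = d≢0 P∈ oP (proj₁ (li (d P) (d Q) k (to≡0⃗ (trans (to-comb₃ _ P _ Q _ R)
            (trans (cong₂ _⊕_ sum-coords e) (v4≡ (trans (cong (_+ a) ea) (x+x≡0 a)) (trans (cong (_+ b) eb) (x+x≡0 b)) (x+x≡0 0#) (x+x≡0 0#)))))))

          horizontal′ : Y s ≢ Y w
          horizontal′ e = third x (X s + X w) (li₃ P∈ Q∈ x∈ P≢Q (proj₁ oP) (proj₁ oQ))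
            (trans (cong ((X s + X w) ·_) to-x) (v4≡ (*-identityʳ _) (zeroʳ _) (zeroʳ _) (zeroʳ _))) refl (trans (cong (_+ Y w) e) (x+x≡0 _))

          oblique′ : Y s + Y w ≢ inv α * (X s + X w)
          oblique′ e = third y ((Y s + Y w) * β) (li₃ P∈ Q∈ y∈ P≢Q (proj₂ oP) (proj₂ oQ)) (kβ·to-y _)
            (trans (sym (trans (cong (_* α) e) (trans (solve 3 (λ i k a → i :* k :* a := (a :* i) :* k) refl (inv α) (X s + X w) α)
              (trans (cong (_* (X s + X w)) (*-inv α≢0)) (*-identityˡ _))))) refl) refl

          vertical′ : LI₃ P Q N → X s ≢ X w
          vertical′ li e = third N (Y s + Y w) li
            (trans (cong ((Y s + Y w) ·_) to-N) (v4≡ (zeroʳ _) (*-identityʳ _) (zeroʳ _) (zeroʳ _))) (trans (cong (_+ X w) e) (x+x≡0 _)) refl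

        selected : ∀ c P → Dec (Other P × cls P ≡ c)
        selected c P = (¬? (P ≟V x) ×-dec ¬? (P ≟V y)) ×-dec (cls P ≟M c)

        members : Maybe F → List V4
        members c = filter (selected c) K

        tangents : Maybe F → List V4
        tangents c = filter (Tangent? K N) (members c)

        S E : Maybe F → List Point
        S c = map pt (members c)
        E c = map pt (tangents c)

        member⁻ : ∀ {c P} → P ∈ members c → P ∈ K × Other P × cls P ≡ c
        member⁻ {c} h = ∈-filter⁻ (selected c) {xs = K} h

        tangent⁻ : ∀ {c P} → P ∈ tangents c → P ∈ members c × Tangent K N P
        tangent⁻ {c} h = ∈-filter⁻ (Tangent? K N) {xs = members c} h

        members-distinct : ∀ {c} P Q → P ∈ members c → Q ∈ members c → P ≢ Q → pt P ≢ pt Q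
        members-distinct P Q P∈ Q∈ P≢Q with member⁻ P∈ | member⁻ Q∈
        ... | P∈K , oP , cP | Q∈K , oQ , cQ = Pair.pt-distinct P∈K oP cP Q∈K oQ cQ P≢Q

        members-unique : ∀ c → Unique (members c)
        members-unique c = Uₚ.filter⁺ (selected c) unique

        no-three′ : ∀ {c P Q R} → P ∈ members c → Q ∈ members c → R ∈ members c → P ≢ Q → P ≢ R → Q ≢ R →
                    (Y (pt P) + Y (pt Q)) * (X (pt P) + X (pt R)) ≢ (Y (pt P) + Y (pt R)) * (X (pt P) + X (pt Q))
        no-three′ {c} {P} {Q} {R} P∈ Q∈ R∈ P≢Q P≢R Q≢R e with member⁻ P∈ | member⁻ Q∈ | member⁻ R∈
        ... | P∈K , oP , cP | Q∈K , oQ , cQ | R∈K , oR , cR =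
            -- The affine dependence of three collinear points has differences of heights as
            -- coefficients; `l₂` is nonzero because P and R are on different horizontals.
            *≢0 (x≢y⇒x+y≢0 (Pair.horizontal′ P∈K oP cP R∈K oR cR P≢R)) (d≢0 Q∈K oQ) (proj₁ (proj₂
              (li₃ P∈K Q∈K R∈K P≢Q P≢R Q≢R ((l₂ + l₃) * d P) (l₂ * d Q) (l₃ * d R)
                (to≡0⃗ (trans (to-comb₃ _ P _ Q _ R) (trans (cong₂ _⊕_ (cong₂ _⊕_ (sc (l₂ + l₃) P∈K oP cP) (sc l₂ Q∈K oQ cQ)) (sc l₃ R∈K oR cR))
                  (v4≡ hdz (solve 3 (λ s w z → (s :+ z :+ (s :+ w)) :* s :+ (s :+ z) :* w :+ (s :+ w) :* z := con false) refl (Y (pt P)) (Y (pt Q)) (Y (pt R)))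
                    (cl (rep₁ c)) (cl (rep₂ c)))))))))
          where
          l₂ = Y (pt P) + Y (pt R)
          l₃ = Y (pt P) + Y (pt Q)
          sc : ∀ l {P} → P ∈ K → Other P → cls P ≡ c → (l * d P) · to P ≡ l · chart c (pt P)
          sc l {P} P∈ o cP = trans (sym (·-assoc l (d P) (to P))) (cong (l ·_) (to-chart P∈ o cP))
          cl : ∀ r → (l₂ + l₃) * r + l₂ * r + l₃ * r ≡ 0#
          cl r = solve 3 (λ a b r → (a :+ b) :* r :+ a :* r :+ b :* r := con false) refl l₂ l₃ r
          hdz : (l₂ + l₃) * X (pt P) + l₂ * X (pt Q) + l₃ * X (pt R) ≡ 0#
          hdz = trans (solve 5 (λ a b s w z → (a :+ b) :* s :+ a :* w :+ b :* z := b :* (s :+ z) :+ a :* (s :+ w)) refl l₂ l₃ (X (pt P)) (X (pt Q)) (X (pt R)))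
                  (trans (cong (_+ l₂ * (X (pt P) + X (pt Q))) e) (x+x≡0 _))

        pull : ∀ {c s} → s ∈ S c → ∃ λ P → P ∈ members c × s ≡ pt P
        pull s∈ = ∈-map⁻ pt s∈

        arc : ∀ c → Arc (S c) (inv α)
        arc c = record
          { unique = map-Unique pt (members c) (members-unique c) members-distinct
          ; y₀≢0 = inv≢0 α≢0
          ; horizontal = λ s∈ w∈ → hor (pull s∈) (pull w∈)
          ; oblique = λ s∈ w∈ → obl (pull s∈) (pull w∈)
          ; no-three = λ s∈ w∈ z∈ → three (pull s∈) (pull w∈) (pull z∈)
          }
          where
          From : Point → Set
          From s = ∃ λ P → P ∈ members c × s ≡ pt P
          ne : ∀ {P Q} → pt P ≢ pt Q → P ≢ Q
          ne h refl = h refl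
          hor : ∀ {s w} → From s → From w → s ≢ w → Y s ≢ Y w
          hor (P , P∈ , refl) (Q , Q∈ , refl) s≢w with member⁻ P∈ | member⁻ Q∈
          ... | P∈K , oP , cP | Q∈K , oQ , cQ = Pair.horizontal′ P∈K oP cP Q∈K oQ cQ (ne s≢w)
          obl : ∀ {s w} → From s → From w → s ≢ w → Y s + Y w ≢ inv α * (X s + X w)
          obl (P , P∈ , refl) (Q , Q∈ , refl) s≢w with member⁻ P∈ | member⁻ Q∈
          ... | P∈K , oP , cP | Q∈K , oQ , cQ = Pair.oblique′ P∈K oP cP Q∈K oQ cQ (ne s≢w)
          three : ∀ {s w z} → From s → From w → From z → s ≢ w → s ≢ z → w ≢ z → (Y s + Y w) * (X s + X z) ≢ (Y s + Y z) * (X s + X w)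
          three (P , P∈ , refl) (Q , Q∈ , refl) (R , R∈ , refl) a b c = no-three′ P∈ Q∈ R∈ (ne a) (ne b) (ne c)

        E-vertical : ∀ c {l} → l ∈ E c → Vertical (S c) l
        E-vertical c l∈ w w∈ w≢l = go (∈-map⁻ pt l∈) (pull w∈) w≢l
          where
          go : ∀ {l w} → (∃ λ P → P ∈ tangents c × l ≡ pt P) → (∃ λ Q → Q ∈ members c × w ≡ pt Q) → w ≢ l → X l ≢ X w
          go (P , P∈ , refl) (Q , Q∈ , refl) w≢l with member⁻ (proj₁ (tangent⁻ P∈)) | member⁻ Q∈
          ... | P∈K , oP , cP | Q∈K , oQ , cQ = Pair.vertical′ P∈K oP cP Q∈K oQ cQ (λ { refl → w≢l refl })
                  (LI₃-swap₂₃ (LI₃-swap₁₂ (proj₂ (tangent⁻ P∈) Q Q∈K (λ { refl → w≢l refl }))))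

        -- Together with x and y the members form an arc in one plane through the secant, so q less
        -- the number of members is its number d of tangents at each point.
        class-bound : ∀ c → length (members c) ℕ.+ length (tangents c) ℕ.≤ q
        class-bound c = subst (ℕ._≤ q) (cong₂ ℕ._+_ (length-map pt (members c)) (length-map pt (tangents c)))
          (arc-bound (arc c) (E c)
            (map-Unique pt (tangents c) (Uₚ.filter⁺ (Tangent? K N) (members-unique c)) λ P Q P∈ Q∈ → members-distinct P Q (proj₁ (tangent⁻ P∈)) (proj₁ (tangent⁻ Q∈)))
            sub (E-vertical c))
          where
          sub : ∀ {l} → l ∈ E c → l ∈ S c
          sub l∈ with ∈-map⁻ pt l∈
          ... | P , P∈ , refl = ∈-map⁺ pt (proj₁ (tangent⁻ P∈))

        outside : ∀ P → Dec (Other P)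
        outside P = ¬? (P ≟V x) ×-dec ¬? (P ≟V y)

        ∑-members : ∑ classes (λ c → length (members c)) ≡ ∑ K (λ P → 𝟙 (outside P))
        ∑-members = begin
          ∑ classes (λ c → length (members c)) ≡⟨ ∑-cong classes (λ c → length-filter-∑ (selected c) K) ⟩
          ∑ classes (λ c → ∑ K λ P → 𝟙 (selected c P)) ≡⟨ ∑-swap classes K _ ⟩
          ∑ K (λ P → ∑ classes λ c → 𝟙 (selected c P))
            ≡⟨ ∑-cong K (λ P → trans (∑-cong classes λ c → sym (𝟙-and (outside P) (cls P ≟M c) (selected c P) _,_ (λ h → h)))
                 (trans (∑-*ˡ classes (𝟙 (outside P)) _) (trans (cong (𝟙 (outside P) ℕ.*_) (once-class (cls P))) (ℕₚ.*-identityʳ _)))) ⟩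
          ∑ K (λ P → 𝟙 (outside P)) ∎
          where open ≡-Reasoning

        -- N is on the secant through x and y, so neither of these can be a point of contact.
        tangent-outside : ∀ {P} → Tangent K N P → Other P
        tangent-outside {P} t = (λ { refl → bad x y N≡ (t y y∈ (λ e → x≢y (sym e))) })
                              , (λ { refl → bad′ (t x x∈ x≢y) })
          where
          bad : ∀ P Q → N ≡ comb₂ α P β Q → ¬ LI₃ N P Q
          bad P Q e li = 1≢0 (proj₁ (li 1# α β (trans (cong (λ n → comb₃ 1# n α P β Q) e) (collapse α P β Q))))
            where
            collapse : ∀ a u b v → comb₃ 1# (comb₂ a u b v) a u b v ≡ 0⃗
            collapse a ⟨ h , v3 p r s ⟩ b ⟨ h′ , v3 p′ r′ s′ ⟩ = v4≡ (z h h′) (z p p′) (z r r′) (z s s′)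
              where
              z : ∀ x y → 1# * (a * x + b * y) + a * x + b * y ≡ 0#
              z x y = solve 2 (λ x y → con true :* (x :+ y) :+ x :+ y := con false) refl (a * x) (b * y)
          bad′ : ¬ LI₃ N y x
          bad′ li = bad x y N≡ (LI₃-swap₂₃ li)

        ∑-tangents : ∑ classes (λ c → length (tangents c)) ≡ τ K N
        ∑-tangents = begin
          ∑ classes (λ c → length (tangents c)) ≡⟨ ∑-cong classes (λ c → trans (length-filter-∑ (Tangent? K N) (members c)) (∑-filter (selected c) K _)) ⟩
          ∑ classes (λ c → ∑ K λ P → 𝟙 (selected c P) ℕ.* 𝟙 (Tangent? K N P)) ≡⟨ ∑-swap classes K _ ⟩
          ∑ K (λ P → ∑ classes λ c → 𝟙 (selected c P) ℕ.* 𝟙 (Tangent? K N P))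
            ≡⟨ ∑-cong K (λ P → trans (∑-cong classes λ c → both P c) (trans (∑-*ˡ classes (𝟙 (Tangent? K N P)) _)
                 (trans (cong (𝟙 (Tangent? K N P) ℕ.*_) (once-class (cls P))) (ℕₚ.*-identityʳ _)))) ⟩
          τ K N ∎
          where
          open ≡-Reasoning
          both : ∀ P c → 𝟙 (selected c P) ℕ.* 𝟙 (Tangent? K N P) ≡ 𝟙 (Tangent? K N P) ℕ.* 𝟙 (cls P ≟M c)
          both P c = trans (𝟙-and (selected c P) (Tangent? K N P) (selected c P ×-dec Tangent? K N P) _,_ (λ h → h))
            (sym (𝟙-and (Tangent? K N P) (cls P ≟M c) (selected c P ×-dec Tangent? K N P)
              (λ t e → (tangent-outside t , e) , t) (λ h → proj₂ h , proj₂ (proj₁ h))))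

        ∑-outside : ∑ K (λ P → 𝟙 (outside P)) ℕ.+ 2 ≡ length K
        ∑-outside = begin
          ∑ K (λ P → 𝟙 (outside P)) ℕ.+ 2
            ≡⟨ cong (∑ K (λ P → 𝟙 (outside P)) ℕ.+_) (sym (cong₂ ℕ._+_ (∑-Unique≡1 _≟V_ K unique x∈) (∑-Unique≡1 _≟V_ K unique y∈))) ⟩
          ∑ K (λ P → 𝟙 (outside P)) ℕ.+ (∑ K (λ P → 𝟙 (P ≟V x)) ℕ.+ ∑ K (λ P → 𝟙 (P ≟V y)))
            ≡⟨ sym (trans (∑-+ K _ _) (cong (∑ K (λ P → 𝟙 (outside P)) ℕ.+_) (∑-+ K _ _))) ⟩
          ∑ K (λ P → 𝟙 (outside P) ℕ.+ (𝟙 (P ≟V x) ℕ.+ 𝟙 (P ≟V y)))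
            ≡⟨ ∑-cong K (λ P → one (P ≟V x) (P ≟V y)) ⟩
          ∑ K (λ _ → 1)
            ≡⟨ ∑-one K ⟩
          length K ∎
          where
          open ≡-Reasoning
          one : ∀ {P} (dx : Dec (P ≡ x)) (dy : Dec (P ≡ y)) → 𝟙 (¬? dx ×-dec ¬? dy) ℕ.+ (𝟙 dx ℕ.+ 𝟙 dy) ≡ 1
          one (yes refl) (yes e) = ⊥-elim (x≢y e)
          one (yes _) (no _) = refl
          one (no _) (yes _) = refl
          one (no _) (no _) = refl

        -- Each of the q + 1 planes through the secant contributes at most q; the summand 2 restores
        -- x and y, which belong to no class.
        bound : τ K N ℕ.+ length K ℕ.≤ q ℕ.* q ℕ.+ q ℕ.+ 2
        bound = begin
          τ K N ℕ.+ length K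
            ≡⟨ cong₂ ℕ._+_ (sym ∑-tangents) (sym (trans (cong (ℕ._+ 2) ∑-members) ∑-outside)) ⟩
          ∑ classes (λ c → length (tangents c)) ℕ.+ (∑ classes (λ c → length (members c)) ℕ.+ 2)
            ≡⟨ lem (∑ classes (λ c → length (tangents c))) _ ⟩
          ∑ classes (λ c → length (members c)) ℕ.+ ∑ classes (λ c → length (tangents c)) ℕ.+ 2
            ≡⟨ cong (ℕ._+ 2) (sym (∑-+ classes (λ c → length (members c)) (λ c → length (tangents c)))) ⟩
          ∑ classes (λ c → length (members c) ℕ.+ length (tangents c)) ℕ.+ 2
            ≤⟨ ℕₚ.+-monoˡ-≤ 2 (∑-mono classes class-bound) ⟩
          ∑ classes (λ _ → q) ℕ.+ 2
            ≡⟨ cong (ℕ._+ 2) (trans (∑-const classes q) (cong (ℕ._* q) length-classes)) ⟩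
          suc q ℕ.* q ℕ.+ 2
            ≡⟨ cong (ℕ._+ 2) (ℕₚ.+-comm q (q ℕ.* q)) ⟩
          q ℕ.* q ℕ.+ q ℕ.+ 2 ∎
          where
          open ℕₚ.≤-Reasoning
          lem : ∀ a b → a ℕ.+ (b ℕ.+ 2) ≡ b ℕ.+ a ℕ.+ 2
          lem = solve-∀

      τ-bound : τ K N ℕ.+ length K ℕ.≤ q ℕ.* q ℕ.+ q ℕ.+ 2
      τ-bound = let g , to-x , to-N = coordinates in InCoordinates.bound g to-x to-N

-- The tangents at a point of the cap as a point set in the quotient plane.

module LocalStructure where
  open ≡ using (refl; sym; trans; cong; cong₂; subst)
  open Counting
  open Characteristic2
  open PlaneCombinatorics
  open Arcs using (map-Unique)
  open PlaneOverField
  open SpaceOverField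
  open CapsInSpace

  module Local (𝔽 : Char2Field) where
    open FieldTheory 𝔽
    open PG2 𝔽
    open Space 𝔽
    open Caps 𝔽

    vec-independent : ∀ {p p′} → p ≢ p′ → ∀ a b → scale a (vec p) +₃ scale b (vec p′) ≡ 𝟎 → a ≡ 0# × b ≡ 0#
    vec-independent {p} {p′} p≢ a b e = vanish a (vec p) (vec p′) b e (λ c → p≢ (cross-vec p p′ c))
      , vanish b (vec p′) (vec p) a (trans (+₃-comm (scale b (vec p′)) (scale a (vec p))) e) (λ c → p≢ (sym (cross-vec p′ p c)))
      where
      +₃-comm : ∀ u v → u +₃ v ≡ v +₃ u
      +₃-comm (v3 x y z) (v3 x′ y′ z′) = v3≡ (+-comm x x′) (+-comm y y′) (+-comm z z′)
      vanish : ∀ a u w b → scale a u +₃ scale b w ≡ 𝟎 → cross u w ≢ 𝟎 → a ≡ 0#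
      vanish a (v3 x y z) (v3 x′ y′ z′) b e h = decide (a ≟ 0#)
        where
        eqx = x+y≡0⇒x≡y (cong V3.x e)
        eqy = x+y≡0⇒x≡y (cong V3.y e)
        eqz = x+y≡0⇒x≡y (cong V3.z e)
        minor : ∀ {s t s′ t′} → a * s ≡ b * s′ → a * t ≡ b * t′ → a * (s * t′ + t * s′) ≡ 0#
        minor {s} {t} {s′} {t′} es et = begin
          a * (s * t′ + t * s′)          ≡⟨ solve 5 (λ a s t s′ t′ → a :* (s :* t′ :+ t :* s′) := a :* s :* t′ :+ a :* t :* s′) refl a s t s′ t′ ⟩
          a * s * t′ + a * t * s′        ≡⟨ cong₂ (λ m n → m * t′ + n * s′) es et ⟩
          b * s′ * t′ + b * t′ * s′      ≡⟨ solve 3 (λ b s t → b :* s :* t :+ b :* t :* s := con false) refl b s′ t′ ⟩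
          0# ∎
          where open ≡-Reasoning
        decide : Dec (a ≡ 0#) → a ≡ 0#
        decide (yes r) = r
        decide (no a≢0) = ⊥-elim (h (v3≡ (*≡0 a≢0 (minor eqy eqz)) (*≡0 a≢0 (minor eqz eqx)) (*≡0 a≢0 (minor eqx eqy))))

    scale-scale : ∀ a b u → scale a (scale b u) ≡ scale (a * b) u
    scale-scale a b (v3 x y z) = v3≡ (sym (*-assoc a b x)) (sym (*-assoc a b y)) (sym (*-assoc a b z))

    nonzero? : ∀ s → Dec (s ≢ 0#)
    nonzero? s = ¬? (s ≟ 0#)

    -- This is q - 1, the number of functionals that define a given plane.
    units : ℕ
    units = ∑∀ λ s → 𝟙 (nonzero? s)

    units+1 : units ℕ.+ 1 ≡ q
    units+1 = trans (cong (units ℕ.+_) (sym (trans (∑-cong enum λ s → 𝟙-cong (s ≟ 0#) (0# ≟ s) sym sym) (Finite.once finite 0#))))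
      (trans (sym (∑-+ enum _ _)) (trans (∑-cong enum λ s → 𝟙-¬ (s ≟ 0#)) (∑-one enum)))

    ∑-split-zero : ∀ f → ∑∀ f ≡ f 0# ℕ.+ ∑∀ (λ s → 𝟙 (nonzero? s) ℕ.* f s)
    ∑-split-zero f = begin
      ∑∀ f ≡⟨ ∑-cong enum (λ s → trans (sym (ℕₚ.*-identityˡ (f s))) (trans (cong (ℕ._* f s) (sym (trans (ℕₚ.+-comm _ (𝟙 (nonzero? s))) (𝟙-¬ (s ≟ 0#))))) (ℕₚ.*-distribʳ-+ (f s) (𝟙 (s ≟ 0#)) _))) ⟩
      ∑∀ (λ s → 𝟙 (s ≟ 0#) ℕ.* f s ℕ.+ 𝟙 (nonzero? s) ℕ.* f s) ≡⟨ ∑-+ enum _ _ ⟩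
      ∑∀ (λ s → 𝟙 (s ≟ 0#) ℕ.* f s) ℕ.+ ∑∀ (λ s → 𝟙 (nonzero? s) ℕ.* f s)
        ≡⟨ cong (ℕ._+ ∑∀ (λ s → 𝟙 (nonzero? s) ℕ.* f s)) (trans (∑-cong enum λ s → cong (ℕ._* f s) (𝟙-cong (s ≟ 0#) (0# ≟ s) sym sym)) (∑-pick 0# f)) ⟩
      f 0# ℕ.+ ∑∀ (λ s → 𝟙 (nonzero? s) ℕ.* f s) ∎
      where open ≡-Reasoning

    ∑-nonzero-cong : ∀ {f h : F → ℕ} → (∀ s → s ≢ 0# → f s ≡ h s) → ∑∀ (λ s → 𝟙 (nonzero? s) ℕ.* f s) ≡ ∑∀ (λ s → 𝟙 (nonzero? s) ℕ.* h s)
    ∑-nonzero-cong {f} {h} e = ∑-cong enum λ s → go s (nonzero? s)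
      where
      go : ∀ s (d : Dec (s ≢ 0#)) → 𝟙 d ℕ.* f s ≡ 𝟙 d ℕ.* h s
      go s (yes n) = cong (1 ℕ.*_) (e s n)
      go s (no _) = refl

    ∑-scale : ∀ {s} → s ≢ 0# → ∀ f → ∑∀ f ≡ ∑∀ (λ x → f (s * x))
    ∑-scale {s} s≢0 f = sym (∑∀-bij (s *_) (inv s *_)
      (λ x → trans (sym (*-assoc (inv s) s x)) (trans (cong (_* x) (*-invˡ s≢0)) (*-identityˡ x)))
      (λ x → trans (sym (*-assoc s (inv s) x)) (trans (cong (_* x) (*-inv s≢0)) (*-identityˡ x))) f)

    -- A nonzero functional is a nonzero scalar times a unique normalised one.
    ∑-projective : ∀ f → ∑ vectors₃ f ≡ f 𝟎 ℕ.+ ∑∀ (λ s → 𝟙 (nonzero? s) ℕ.* ∑ points (λ L → f (scale s (vec L))))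
    ∑-projective f = begin
      ∑ vectors₃ f ≡⟨ ∑-vectors₃ f ⟩
      ∑∀ (λ x → A x) ≡⟨ ∑-split-zero A ⟩
      A 0# ℕ.+ NZ A ≡⟨ cong (ℕ._+ NZ A) (∑-split-zero B) ⟩
      B 0# ℕ.+ NZ B ℕ.+ NZ A ≡⟨ cong (λ z → z ℕ.+ NZ B ℕ.+ NZ A) (∑-split-zero C) ⟩
      C 0# ℕ.+ NZ C ℕ.+ NZ B ℕ.+ NZ A ≡⟨ lem (C 0#) (NZ C) (NZ B) (NZ A) ⟩
      C 0# ℕ.+ (NZ A ℕ.+ (NZ B ℕ.+ NZ C)) ≡⟨ cong (f 𝟎 ℕ.+_) (cong₂ ℕ._+_ (∑-nonzero-cong scaleA) (cong₂ ℕ._+_ (∑-nonzero-cong scaleB) (∑-nonzero-cong scaleC))) ⟩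
      f 𝟎 ℕ.+ (NZ A′ ℕ.+ (NZ B′ ℕ.+ NZ C′)) ≡⟨ cong (f 𝟎 ℕ.+_) (sym (trans (∑-cong enum distribute) (trans (∑-+ enum _ _) (cong (NZ A′ ℕ.+_) (∑-+ enum _ _))))) ⟩
      f 𝟎 ℕ.+ ∑∀ (λ s → 𝟙 (nonzero? s) ℕ.* ∑ points (λ L → f (scale s (vec L)))) ∎
      where
      open ≡-Reasoning
      NZ : (F → ℕ) → ℕ
      NZ h = ∑∀ (λ s → 𝟙 (nonzero? s) ℕ.* h s)
      A B C A′ B′ C′ : F → ℕ
      A x = ∑∀ (λ y → ∑∀ (λ z → f (v3 x y z)))
      B y = ∑∀ (λ z → f (v3 0# y z))
      C z = f (v3 0# 0# z)
      A′ s = ∑∀ (λ a → ∑∀ (λ b → f (scale s (vec (aff a b)))))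
      B′ s = ∑∀ (λ a → f (scale s (vec (inf a))))
      C′ s = f (scale s (vec ∞))
      lem : ∀ a b c d → a ℕ.+ b ℕ.+ c ℕ.+ d ≡ a ℕ.+ (d ℕ.+ (c ℕ.+ b))
      lem = solve-∀
      scaleA : ∀ s → s ≢ 0# → A s ≡ A′ s
      scaleA s h = trans (∑-scale h _) (∑-cong enum λ a → trans (∑-scale h _) (∑-cong enum λ b → cong f (v3≡ (sym (*-identityʳ s)) refl refl)))
      scaleB : ∀ s → s ≢ 0# → B s ≡ B′ s
      scaleB s h = trans (∑-scale h _) (∑-cong enum λ a → cong f (v3≡ (sym (zeroʳ s)) (sym (*-identityʳ s)) refl))
      scaleC : ∀ s → s ≢ 0# → C s ≡ C′ s
      scaleC s h = cong f (v3≡ (sym (zeroʳ s)) (sym (zeroʳ s)) (sym (*-identityʳ s)))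
      distribute : ∀ s → 𝟙 (nonzero? s) ℕ.* ∑ points (λ L → f (scale s (vec L)))
                   ≡ 𝟙 (nonzero? s) ℕ.* A′ s ℕ.+ (𝟙 (nonzero? s) ℕ.* B′ s ℕ.+ 𝟙 (nonzero? s) ℕ.* C′ s)
      distribute s = trans (cong (𝟙 (nonzero? s) ℕ.*_) (∑-points _))
        (trans (ℕₚ.*-distribˡ-+ (𝟙 (nonzero? s)) (A′ s) _) (cong (𝟙 (nonzero? s) ℕ.* A′ s ℕ.+_) (ℕₚ.*-distribˡ-+ (𝟙 (nonzero? s)) (B′ s) (C′ s))))

    zeros : List V4 → V4 → ℕ
    zeros K φ = ∑ K λ Q → 𝟙 (dot₄ φ Q ≟ 0#)

    -- The number of functionals (not planes) vanishing at P and at exactly M points of K.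
    planes : List V4 → ℕ → V4 → ℕ
    planes K M P = ∑ vectors₄ λ φ → 𝟙 (dot₄ φ P ≟ 0#) ℕ.* 𝟙 (zeros K φ ℕ.≟ M)

    -- The shape at P expressed by plane counts, free of the coordinates chosen at P. The last
    -- component of `blocking` provides a plane with q + 1 points through any second point; it
    -- separates this type from `even` when t = 2q.
    data PointType (K : List V4) (P : V4) : Set where
      ovoid    : length K ℕ.+ (q ℕ.+ 1) ≡ q ℕ.* q ℕ.+ q ℕ.+ 2 → PointType K P
      empty    : length K ≡ q ℕ.* q ℕ.+ q ℕ.+ 2 →
                 planes K (q ℕ.+ 2) P ≡ units ℕ.* (q ℕ.* q ℕ.+ q ℕ.+ 1) → PointType K P
      blocking : ∀ A → planes K (q ℕ.+ 1) P ≡ units ℕ.* A →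
                 (length K ℕ.+ (2 ℕ.* q ℕ.+ 1) ≡ q ℕ.* q ℕ.+ q ℕ.+ 2 × A ℕ.+ 1 ≡ q)
                   ⊎ (length K ℕ.+ 2 ℕ.* q ≡ q ℕ.* q ℕ.+ q ℕ.+ 2 × A ℕ.+ 1 ≡ 2 ℕ.* q) →
                 (∀ Q → Q ∈ K → Q ≢ P → ∃ λ φ → φ ∈ vectors₄ × dot₄ φ Q ≡ 0# × zeros K φ ≡ q ℕ.+ 1) → PointType K P
      even     : ∀ A → length K ℕ.+ 2 ℕ.* q ≡ q ℕ.* q ℕ.+ q ℕ.+ 2 → planes K (q ℕ.+ 2) P ≡ units ℕ.* A →
                 A ℕ.+ 1 ≡ q → planes K (q ℕ.+ 1) P ≡ 0 → PointType K P

    module AtPoint {K : List V4} (cap : IsCap K)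
                   (τ-bound : ∀ N → (∀ P → P ∈ K → LI₂ N P) → τ K N ℕ.+ length K ℕ.≤ q ℕ.* q ℕ.+ q ℕ.+ 2)
                   {P : V4} (P∈ : P ∈ K) (g : Iso) (to-P : Iso.to g P ≡ e₁) where
      open IsCap cap
      open Iso g
      open IsoLemmas g

      π : V4 → V3
      π u = tl (to u)

      K° : List V4
      K° = filter (λ Q → ¬? (Q ≟V P)) K

      K°⁻ : ∀ {Q} → Q ∈ K° → Q ∈ K × Q ≢ P
      K°⁻ = ∈-filter⁻ (λ Q → ¬? (Q ≟V P)) {xs = K}

      K°⁺ : ∀ {Q} → Q ∈ K → Q ≢ P → Q ∈ K°
      K°⁺ = ∈-filter⁺ (λ Q → ¬? (Q ≟V P))

      K°-unique : Unique K°
      K°-unique = Uₚ.filter⁺ (λ Q → ¬? (Q ≟V P)) unique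

      ∑-K : ∀ f → ∑ K f ≡ f P ℕ.+ ∑ K° f
      ∑-K f = begin
        ∑ K f ≡⟨ ∑-cong K (λ Q → trans (sym (ℕₚ.*-identityˡ (f Q))) (trans (cong (ℕ._* f Q) (sym (trans (ℕₚ.+-comm (𝟙 (Q ≟V P)) _) (𝟙-¬ (Q ≟V P))))) (ℕₚ.*-distribʳ-+ (f Q) (𝟙 (Q ≟V P)) _))) ⟩
        ∑ K (λ Q → 𝟙 (Q ≟V P) ℕ.* f Q ℕ.+ 𝟙 (¬? (Q ≟V P)) ℕ.* f Q) ≡⟨ ∑-+ K _ _ ⟩
        ∑ K (λ Q → 𝟙 (Q ≟V P) ℕ.* f Q) ℕ.+ ∑ K (λ Q → 𝟙 (¬? (Q ≟V P)) ℕ.* f Q)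
          ≡⟨ cong₂ ℕ._+_ (trans (∑-cong K (λ Q → at Q (Q ≟V P))) (trans (∑-*ʳ K (f P) _) (trans (cong (ℕ._* f P) (∑-Unique≡1 _≟V_ K unique P∈)) (ℕₚ.*-identityˡ (f P)))))
               (sym (∑-filter (λ Q → ¬? (Q ≟V P)) K f)) ⟩
        f P ℕ.+ ∑ K° f ∎
        where
        open ≡-Reasoning
        at : ∀ Q (e : Dec (Q ≡ P)) → 𝟙 e ℕ.* f Q ≡ 𝟙 e ℕ.* f P
        at Q (yes refl) = refl
        at Q (no _) = refl

      size° : length K° ℕ.+ 1 ≡ length K
      size° = trans (cong (ℕ._+ 1) (sym (∑-one K°))) (trans (ℕₚ.+-comm _ 1) (trans (sym (∑-K (λ _ → 1))) (∑-one K)))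

      on-P : ∀ u → π u ≡ 𝟎 → to u ≡ hd (to u) · to P
      on-P u e = trans (cong ⟨ hd (to u) ,_⟩ e) (sym (trans (cong (hd (to u) ·_) to-P) (v4≡ (*-identityʳ _) (zeroʳ _) (zeroʳ _) (zeroʳ _))))

      π≢𝟎 : ∀ {Q} → Q ∈ K° → π Q ≢ 𝟎
      π≢𝟎 {Q} Q∈ e = 1≢0 (proj₁ (li₂ (proj₁ (K°⁻ Q∈)) P∈ (proj₂ (K°⁻ Q∈)) 1# (hd (to Q)) (to≡0⃗ (trans (to-comb₂ 1# Q _ P)
        (trans (cong₂ _⊕_ (1·-id (to Q)) (sym (on-P Q e))) (⊕-self (to Q)))))))
        where
        1·-id : ∀ u → 1# · u ≡ u
        1·-id ⟨ h , v3 x y z ⟩ = v4≡ (*-identityˡ h) (*-identityˡ x) (*-identityˡ y) (*-identityˡ z)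

      normal : V4 → F × Pt
      normal u = pick (π u ≟𝟎)
        where
        pick : Dec (π u ≡ 𝟎) → F × Pt
        -- A placeholder for multiples of P; points of `K°` have a nonzero projection.
        pick (yes _) = 1# , ∞
        pick (no h) = proj₁ (normalise (π u) h) , proj₁ (proj₂ (normalise (π u) h))

      ι : V4 → Pt
      ι u = proj₂ (normal u)

      sc : V4 → F
      sc u = proj₁ (normal u)

      normal-spec : ∀ {Q} → Q ∈ K° → sc Q ≢ 0# × π Q ≡ scale (sc Q) (vec (ι Q))
      normal-spec {Q} Q∈ with π Q ≟𝟎
      ... | yes e = ⊥-elim (π≢𝟎 Q∈ e)
      ... | no h = proj₂ (proj₂ (normalise (π Q) h))

      sc≢0 : ∀ {Q} → Q ∈ K° → sc Q ≢ 0#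
      sc≢0 Q∈ = proj₁ (normal-spec Q∈)

      π≡ : ∀ {Q} → Q ∈ K° → π Q ≡ scale (sc Q) (vec (ι Q))
      π≡ Q∈ = proj₂ (normal-spec Q∈)

      -- If the images agreed, the combination of Q and R with exchanged scalars would project to 0,
      -- hence be a multiple of P, and three points of the cap would be collinear.
      ι-distinct : ∀ Q R → Q ∈ K° → R ∈ K° → Q ≢ R → ι Q ≢ ι R
      ι-distinct Q R Q∈ R∈ Q≢R e = sc≢0 R∈ (proj₁ (li₃ (proj₁ (K°⁻ Q∈)) (proj₁ (K°⁻ R∈)) P∈ Q≢R (proj₂ (K°⁻ Q∈)) (proj₂ (K°⁻ R∈))
          (sc R) (sc Q) (hd (to u)) (to≡0⃗ (trans (to-⊕ u _) (trans (cong₂ _⊕_ (on-P u tail) (to-· _ P)) (⊕-self _))))))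
        where
        u = comb₂ (sc R) Q (sc Q) R
        cancel : ∀ a b v → scale a (scale b v) +₃ scale b (scale a v) ≡ 𝟎
        cancel a b (v3 x y z) = v3≡ (c x) (c y) (c z)
          where
          c : ∀ x → a * (b * x) + b * (a * x) ≡ 0#
          c x = solve 3 (λ a b x → a :* (b :* x) :+ b :* (a :* x) := con false) refl a b x
        tail : π u ≡ 𝟎
        tail = trans (cong tl (to-comb₂ (sc R) Q (sc Q) R)) (trans
          (cong₂ (λ a b → scale (sc R) a +₃ scale (sc Q) b) (trans (π≡ Q∈) (cong (λ p → scale (sc Q) (vec p)) e)) (π≡ R∈))
          (cancel (sc R) (sc Q) (vec (ι R))))

      occ : Pt → ℕ
      occ w = ∑ K° λ Q → 𝟙 (ι Q ≟P w)

      occ≤1 : ∀ w → occ w ℕ.≤ 1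
      occ≤1 w = ℕₚ.≤-trans (ℕₚ.≤-reflexive (sym (∑-map ι K° (λ p → 𝟙 (p ≟P w)))))
        (∑-Unique≤1 _≟P_ (map ι K°) (map-Unique ι K° K°-unique ι-distinct) w)

      -- The tangents at P: the directions in which no other point of K is seen from P.
      T : Pt → ℕ
      T w = 1 ℕ.∸ occ w

      T-bit : ∀ w → Bit (T w)
      T-bit w = go (occ≤1 w)
        where
        go : ∀ {n} → n ℕ.≤ 1 → Bit (1 ℕ.∸ n)
        go {zero} _ = I
        go {suc zero} _ = O
        go {suc (suc _)} (s≤s ())

      T+occ : ∀ w → T w ℕ.+ occ w ≡ 1
      T+occ w = ℕₚ.m∸n+n≡m (occ≤1 w)

      open PointSet plane T T-bit public hiding (_≟P_)

      ∑-occ : ∀ f → ∑ points (λ w → occ w ℕ.* f w) ≡ ∑ K° (λ Q → f (ι Q))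
      ∑-occ f = begin
        ∑ points (λ w → occ w ℕ.* f w) ≡⟨ ∑-cong points (λ w → sym (∑-*ʳ K° (f w) _)) ⟩
        ∑ points (λ w → ∑ K° λ Q → 𝟙 (ι Q ≟P w) ℕ.* f w) ≡⟨ ∑-swap points K° _ ⟩
        ∑ K° (λ Q → ∑ points λ w → 𝟙 (ι Q ≟P w) ℕ.* f w) ≡⟨ ∑-cong K° (λ Q → Fi.∑-pick finPt (ι Q) f) ⟩
        ∑ K° (λ Q → f (ι Q)) ∎
        where open ≡-Reasoning

      -- The plane through P given by L has n L + 1 points of K, as P itself is left out here.
      n : Pt → ℕ
      n L = ∑ K° λ Q → inc (ι Q) L

      δ+n : ∀ L → δ L ℕ.+ n L ≡ q ℕ.+ 1
      δ+n L = begin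
        δ L ℕ.+ n L ≡⟨ cong (δ L ℕ.+_) (sym (∑-occ (λ w → inc w L))) ⟩
        δ L ℕ.+ ∑ points (λ w → occ w ℕ.* inc w L) ≡⟨ sym (∑-+ points _ _) ⟩
        ∑ points (λ w → T w ℕ.* inc w L ℕ.+ occ w ℕ.* inc w L) ≡⟨ ∑-cong points (λ w → trans (sym (ℕₚ.*-distribʳ-+ (inc w L) (T w) (occ w))) (trans (cong (ℕ._* inc w L) (T+occ w)) (ℕₚ.*-identityˡ _))) ⟩
        ∑ points (λ w → inc w L) ≡⟨ ProjectivePlane.points-on plane L ⟩
        q ℕ.+ 1 ∎
        where open ≡-Reasoning

      t+k : t ℕ.+ length K ≡ q ℕ.* q ℕ.+ q ℕ.+ 2
      t+k = begin
        t ℕ.+ length K ≡⟨ cong (t ℕ.+_) (sym size°) ⟩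
        t ℕ.+ (length K° ℕ.+ 1) ≡⟨ sym (ℕₚ.+-assoc t _ 1) ⟩
        t ℕ.+ length K° ℕ.+ 1 ≡⟨ cong (λ z → t ℕ.+ z ℕ.+ 1) (sym (trans (∑-cong points λ w → sym (ℕₚ.*-identityʳ (occ w))) (trans (∑-occ (λ _ → 1)) (∑-one K°)))) ⟩
        t ℕ.+ ∑ points occ ℕ.+ 1 ≡⟨ cong (ℕ._+ 1) (trans (sym (∑-+ points T occ)) (trans (∑-cong points T+occ) (trans (∑-one points) length-points))) ⟩
        q ℕ.* q ℕ.+ q ℕ.+ 1 ℕ.+ 1 ≡⟨ ℕₚ.+-assoc (q ℕ.* q ℕ.+ q) 1 1 ⟩
        q ℕ.* q ℕ.+ q ℕ.+ 2 ∎
        where open ≡-Reasoning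

      dot-+₃ : ∀ u w l → dot (u +₃ w) l ≡ dot u l + dot w l
      dot-+₃ (v3 x y z) (v3 x′ y′ z′) (v3 a b c) = trans
        (cong₂ _+_ (distribʳ a x x′) (cong₂ _+_ (distribʳ b y y′) (distribʳ c z z′)))
        (solve 6 (λ p p′ r r′ s s′ → (p :+ p′) :+ ((r :+ r′) :+ (s :+ s′)) := (p :+ (r :+ s)) :+ (p′ :+ (r′ :+ s′))) refl
          (x * a) (x′ * a) (y * b) (y′ * b) (z * c) (z′ * c))

      dot-scaleˡ : ∀ s u l → dot (scale s u) l ≡ s * dot u l
      dot-scaleˡ s u l = trans (dot-comm (scale s u) l) (trans (dot-scaleʳ s l u) (cong (s *_) (dot-comm l u)))

      scale-vec≡𝟎 : ∀ p {a} → scale a (vec p) ≡ 𝟎 → a ≡ 0#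
      scale-vec≡𝟎 (aff _ _) {a} e = trans (sym (*-identityʳ a)) (cong V3.x e)
      scale-vec≡𝟎 (inf _) {a} e = trans (sym (*-identityʳ a)) (cong V3.y e)
      scale-vec≡𝟎 ∞ {a} e = trans (sym (*-identityʳ a)) (cong V3.z e)

      drop-𝟎 : ∀ u b → u +₃ scale b 𝟎 ≡ u
      drop-𝟎 (v3 x y z) b = v3≡ (c x) (c y) (c z)
        where
        c : ∀ x → x + b * 0# ≡ x
        c x = solve 2 (λ x b → x :+ b :* con false := x) refl x b

      module TangentDirection {v : Pt} (Tv : T v ≡ 1) where

        ι≢v : ∀ {Q} → Q ∈ K° → v ≢ ι Q
        ι≢v {Q} Q∈ e = ℕₚ.1+n≰n (ℕₚ.≤-trans (ℕₚ.≤-trans (ℕₚ.≤-reflexive (sym (𝟙-yes (ι Q ≟P v) (sym e)))) (f≤∑ K° (λ Q → 𝟙 (ι Q ≟P v)) Q∈))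
          (ℕₚ.≤-reflexive (ℕₚ.+-cancelˡ-≡ 1 _ _ (trans (cong (ℕ._+ occ v) (sym Tv)) (T+occ v)))))

        -- As a varies these are the q points other than P on the tangent with direction v.
        N : F → V4
        N a = from ⟨ a , vec v ⟩

        to-N : ∀ a → to (N a) ≡ ⟨ a , vec v ⟩
        to-N a = to-from _

        li-NP : ∀ a → LI₂ (N a) P
        li-NP a α β e = α≡0 , trans (sym (trans (cong (λ z → z * a + β * 1#) α≡0) (solve 2 (λ a b → con false :* a :+ b :* con true := b) refl a β))) (cong hd coords)
          where
          coords : comb₂ α ⟨ a , vec v ⟩ β e₁ ≡ 0⃗
          coords = trans (sym (cong₂ (λ u w → comb₂ α u β w) (to-N a) to-P)) (trans (sym (to-comb₂ α (N a) β P)) (trans (cong to e) to-0⃗))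
          α≡0 : α ≡ 0#
          α≡0 = scale-vec≡𝟎 v (trans (sym (drop-𝟎 (scale α (vec v)) β)) (cong tl coords))

        li-NPQ : ∀ a {Q} → Q ∈ K° → LI₃ (N a) P Q
        li-NPQ a {Q} Q∈ α β γ e = α≡0 , β≡0 , γ≡0
          where
          coords : comb₃ α ⟨ a , vec v ⟩ β e₁ γ (to Q) ≡ 0⃗
          coords = trans (sym (cong₂ (λ u w → comb₃ α u β w γ (to Q)) (to-N a) to-P)) (trans (sym (to-comb₃ α (N a) β P γ Q)) (trans (cong to e) to-0⃗))
          tails : scale α (vec v) +₃ scale (γ * sc Q) (vec (ι Q)) ≡ 𝟎
          tails = trans (cong₂ _+₃_ (sym (drop-𝟎 (scale α (vec v)) β)) (trans (sym (scale-scale γ (sc Q) (vec (ι Q)))) (cong (scale γ) (sym (π≡ Q∈))))) (cong tl coords)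
          both : α ≡ 0# × γ * sc Q ≡ 0#
          both = vec-independent (ι≢v Q∈) α (γ * sc Q) tails
          α≡0 : α ≡ 0#
          α≡0 = proj₁ both
          γ≡0 : γ ≡ 0#
          γ≡0 = *≡0 (sc≢0 Q∈) (trans (*-comm (sc Q) γ) (proj₂ both))
          β≡0 : β ≡ 0#
          β≡0 = trans (sym (trans (cong₂ (λ z w → z * a + β * 1# + w * hd (to Q)) α≡0 γ≡0)
            (solve 3 (λ a b h → con false :* a :+ b :* con true :+ con false :* h := b) refl a β (hd (to Q))))) (cong hd coords)

        off : ∀ a Q → Q ∈ K → LI₂ (N a) Q
        off a Q Q∈ = go (Q ≟V P)
          where
          insert : ∀ u p w → (u ⊕ 0# · p) ⊕ w ≡ u ⊕ w
          insert ⟨ h , v3 x y z ⟩ ⟨ h′ , v3 x′ y′ z′ ⟩ ⟨ h″ , v3 x″ y″ z″ ⟩ = v4≡ (c h h′ h″) (c x x′ x″) (c y y′ y″) (c z z′ z″)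
            where
            c : ∀ a b d → a + 0# * b + d ≡ a + d
            c = solve 3 (λ a b d → a :+ con false :* b :+ d := a :+ d) refl
          go : Dec (Q ≡ P) → LI₂ (N a) Q
          go (yes refl) = li-NP a
          go (no Q≢P) α γ e = let r = li-NPQ a (K°⁺ Q∈ Q≢P) α 0# γ (trans (insert (α · N a) P (γ · Q)) e) in proj₁ r , proj₂ (proj₂ r)

        -- The summand 1 is the tangent at P, which contains all the points `N a`; the rest is
        -- `τ-bound` expressed through t.
        tangents≤ : ∀ a → 1 ℕ.+ ∑ K° (λ Q → 𝟙 (Tangent? K (N a) Q)) ℕ.≤ t
        tangents≤ a = ℕₚ.≤-trans (ℕₚ.≤-reflexive (sym (trans (∑-K _) (cong (ℕ._+ ∑ K° (λ Q → 𝟙 (Tangent? K (N a) Q))) (𝟙-yes (Tangent? K (N a) P) λ Q Q∈ Q≢P → li-NPQ a (K°⁺ Q∈ Q≢P))))))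
          (ℕₚ.+-cancelʳ-≤ (length K) _ _ (ℕₚ.≤-trans (τ-bound (N a) (off a)) (ℕₚ.≤-reflexive (sym t+k))))

        -- For Q and R in `K°` this is 1 if a plane contains the tangent line, Q and R, and 0
        -- otherwise; it is 1 for Q = R.
        cop : V4 → V4 → ℕ
        cop Q R = ∑ points λ L → inc v L ℕ.* (inc (ι Q) L ℕ.* inc (ι R) L)

        dep? : ∀ Q R a → Dec (¬ LI₃ (N a) Q R)
        dep? Q R a = ¬? (LI₃? (N a) Q R)

        module TwoPoints {Q R : V4} (Q∈ : Q ∈ K°) (R∈ : R ∈ K°) (R≢Q : R ≢ Q) where

          dependent : ∀ a → ¬ LI₃ (N a) Q R → Dependent (N a) Q R
          dependent a h = go (LI₃⊎Dependent (N a) Q R)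
            where
            go : LI₃ (N a) Q R ⊎ Dependent (N a) Q R → Dependent (N a) Q R
            go (inj₁ l) = ⊥-elim (h l)
            go (inj₂ d) = d

          leading≢0 : ∀ {a x y z} → comb₃ x (N a) y Q z R ≡ 0⃗ → v3 x y z ≢ 𝟎 → x ≢ 0#
          leading≢0 {a} {x} {y} {z} e h refl = h (v3≡ refl (proj₁ yz) (proj₂ yz))
            where
            lemma : ∀ u v w → (0# · u ⊕ v) ⊕ w ≡ v ⊕ w
            lemma ⟨ h , v3 x y z ⟩ ⟨ h′ , v3 x′ y′ z′ ⟩ ⟨ h″ , v3 x″ y″ z″ ⟩ = v4≡ (c h h′ h″) (c x x′ x″) (c y y′ y″) (c z z′ z″)
              where
              c : ∀ a b d → 0# * a + b + d ≡ b + d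
              c = solve 3 (λ a b d → con false :* a :+ b :+ d := b :+ d) refl
            yz : y ≡ 0# × z ≡ 0#
            yz = li₂ (proj₁ (K°⁻ Q∈)) (proj₁ (K°⁻ R∈)) (λ e → R≢Q (sym e)) y z (trans (sym (lemma (N a) (y · Q) (z · R))) e)

          -- If `N a`, Q and R are collinear, the line joining the projections of Q and R passes
          -- through v.
          1≤cop : ∀ a → ¬ LI₃ (N a) Q R → 1 ℕ.≤ cop Q R
          1≤cop a h = go (dependent a h) (join-line (ι-distinct Q R Q∈ R∈ (λ e → R≢Q (sym e))))
            where
            go : Dependent (N a) Q R → (∃ λ L → dot (vec (ι Q)) (vec L) ≡ 0# × dot (vec (ι R)) (vec L) ≡ 0#) → 1 ℕ.≤ cop Q R
            go (v3 x y z , e , nt) (L , QL , RL) = ℕₚ.≤-trans (ℕₚ.≤-reflexive (sym (cong₂ ℕ._*_ (𝟙-yes (dot (vec v) (vec L) ≟ 0#) vL)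
                (cong₂ ℕ._*_ (𝟙-yes (dot (vec (ι Q)) (vec L) ≟ 0#) QL) (𝟙-yes (dot (vec (ι R)) (vec L) ≟ 0#) RL)))))
                (Fi.f≤∑∀ finPt (λ L → inc v L ℕ.* (inc (ι Q) L ℕ.* inc (ι R) L)) L)
              where
              open ≡-Reasoning
              coords : comb₃ x ⟨ a , vec v ⟩ y (to Q) z (to R) ≡ 0⃗
              coords = trans (sym (cong (λ u → comb₃ x u y (to Q) z (to R)) (to-N a))) (trans (sym (to-comb₃ x (N a) y Q z R)) (trans (cong to e) to-0⃗))
              on : ∀ {Q} → Q ∈ K° → dot (vec (ι Q)) (vec L) ≡ 0# → ∀ y → dot (scale y (π Q)) (vec L) ≡ 0#
              on {Q} Q∈ QL y = trans (dot-scaleˡ y (π Q) (vec L)) (trans (cong (y *_) (trans (cong (λ u → dot u (vec L)) (π≡ Q∈))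
                (trans (dot-scaleˡ (sc Q) (vec (ι Q)) (vec L)) (trans (cong (sc Q *_) QL) (zeroʳ _))))) (zeroʳ y))
              vL : dot (vec v) (vec L) ≡ 0#
              vL = *≡0 (leading≢0 e nt) (begin
                x * dot (vec v) (vec L)
                  ≡⟨ solve 1 (λ s → s := s :+ con false :+ con false) refl (x * dot (vec v) (vec L)) ⟩
                x * dot (vec v) (vec L) + 0# + 0#
                  ≡⟨ cong₂ _+_ (cong₂ _+_ (sym (dot-scaleˡ x (vec v) (vec L))) (sym (on Q∈ QL y))) (sym (on R∈ RL z)) ⟩
                dot (scale x (vec v)) (vec L) + dot (scale y (π Q)) (vec L) + dot (scale z (π R)) (vec L)
                  ≡⟨ sym (trans (dot-+₃ _ _ (vec L)) (cong (_+ dot (scale z (π R)) (vec L)) (dot-+₃ _ _ (vec L)))) ⟩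
                dot (scale x (vec v) +₃ scale y (π Q) +₃ scale z (π R)) (vec L)
                  ≡⟨ cong (λ u → dot u (vec L)) (cong tl coords) ⟩
                dot 𝟎 (vec L)
                  ≡⟨ dot-𝟎 (vec L) ⟩
                0# ∎)
                where
                dot-𝟎 : ∀ l → dot 𝟎 l ≡ 0#
                dot-𝟎 (v3 a b c) = solve 3 (λ a b c → con false :* a :+ (con false :* b :+ con false :* c) := con false) refl a b c

          -- Eliminating v between the two dependences puts (a + b) P in the span of Q and R: the
          -- line QR cannot meet the tangent twice.
          same-N : ∀ a b → ¬ LI₃ (N a) Q R → ¬ LI₃ (N b) Q R → a ≡ b
          same-N a b ha hb = go (dependent a ha) (dependent b hb)
            where
            go : Dependent (N a) Q R → Dependent (N b) Q R → a ≡ b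
            go (v3 x y z , e , nt) (v3 x′ y′ z′ , e′ , nt′) = x+y≡0⇒x≡y (*≡0 (*≢0 (leading≢0 e nt) (leading≢0 e′ nt′))
                (proj₁ (li₃ P∈ (proj₁ (K°⁻ Q∈)) (proj₁ (K°⁻ R∈)) (λ e → proj₂ (K°⁻ Q∈) (sym e)) (λ e → proj₂ (K°⁻ R∈) (sym e)) (λ e → R≢Q (sym e))
                  (x * x′ * (a + b)) (x′ * y + x * y′) (x′ * z + x * z′)
                  (to≡0⃗ (trans (to-comb₃ _ P _ Q _ R) (trans (cong (λ p → comb₃ (x * x′ * (a + b)) p _ (to Q) _ (to R)) to-P)
                    (combine (vec v) (to Q) (to R) (coords e a refl) (coords e′ b refl))))))))
              where
              coords : ∀ {x y z u} → comb₃ x u y Q z R ≡ 0⃗ → ∀ a → u ≡ N a → comb₃ x ⟨ a , vec v ⟩ y (to Q) z (to R) ≡ 0⃗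
              coords {x} {y} {z} e a refl = trans (sym (cong (λ u → comb₃ x u y (to Q) z (to R)) (to-N a))) (trans (sym (to-comb₃ x (N a) y Q z R)) (trans (cong to e) to-0⃗))
              combine : ∀ w u u′ → comb₃ x ⟨ a , w ⟩ y u z u′ ≡ 0⃗ → comb₃ x′ ⟨ b , w ⟩ y′ u z′ u′ ≡ 0⃗ →
                        comb₃ (x * x′ * (a + b)) e₁ (x′ * y + x * y′) u (x′ * z + x * z′) u′ ≡ 0⃗
              combine (v3 w₁ w₂ w₃) ⟨ h , v3 p r s ⟩ ⟨ h′ , v3 p′ r′ s′ ⟩ E E′ = v4≡
                (trans (solve 4 (λ m c i j → m :* c :* con true :+ i :+ j := m :* c :+ i :+ j) refl (x * x′) (a + b) _ _) (line h h′ a b (cong hd E) (cong hd E′)))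
                (flat (line p p′ w₁ w₁ (cong (λ t → V3.x (tl t)) E) (cong (λ t → V3.x (tl t)) E′)))
                (flat (line r r′ w₂ w₂ (cong (λ t → V3.y (tl t)) E) (cong (λ t → V3.y (tl t)) E′)))
                (flat (line s s′ w₃ w₃ (cong (λ t → V3.z (tl t)) E) (cong (λ t → V3.z (tl t)) E′)))
                where
                half : ∀ k x y z c i j → x * c + y * i + z * j ≡ 0# → k * x * c + k * y * i + k * z * j ≡ 0#
                half k x y z c i j e = trans (cong₂ _+_ (cong₂ _+_ (*-assoc k x c) (*-assoc k y i)) (*-assoc k z j))
                  (trans (solve 4 (λ k p r s → k :* p :+ k :* r :+ k :* s := k :* (p :+ r :+ s)) refl k (x * c) (y * i) (z * j))
                    (trans (cong (k *_) e) (zeroʳ k)))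
                line : ∀ i j c d → x * c + y * i + z * j ≡ 0# → x′ * d + y′ * i + z′ * j ≡ 0# →
                       x * x′ * (c + d) + (x′ * y + x * y′) * i + (x′ * z + x * z′) * j ≡ 0#
                line i j c d e e′ = begin
                  x * x′ * (c + d) + (x′ * y + x * y′) * i + (x′ * z + x * z′) * j
                    ≡⟨ cong₂ _+_ (cong₂ _+_ (trans (distribˡ (x * x′) c d) (cong (λ m → m * c + x * x′ * d) (*-comm x x′))) (distribʳ i (x′ * y) (x * y′))) (distribʳ j (x′ * z) (x * z′)) ⟩
                  (x′ * x * c + x * x′ * d) + (x′ * y * i + x * y′ * i) + (x′ * z * j + x * z′ * j)
                    ≡⟨ solve 6 (λ p p′ r r′ s s′ → (p :+ p′) :+ (r :+ r′) :+ (s :+ s′) := (p :+ r :+ s) :+ (p′ :+ r′ :+ s′)) refl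
                         (x′ * x * c) (x * x′ * d) (x′ * y * i) (x * y′ * i) (x′ * z * j) (x * z′ * j) ⟩
                  (x′ * x * c + x′ * y * i + x′ * z * j) + (x * x′ * d + x * y′ * i + x * z′ * j)
                    ≡⟨ cong₂ _+_ (half x′ x y z c i j e) (half x x′ y′ z′ d i j e′) ⟩
                  0# + 0#
                    ≡⟨ +-identityˡ 0# ⟩
                  0# ∎
                  where open ≡-Reasoning
                flat : ∀ {m c i j} → m * (c + c) + i + j ≡ 0# → ∀ {k} → m * k * 0# + i + j ≡ 0#
                flat {m} {c} {i} {j} e {k} = trans (solve 5 (λ m c i j k → m :* k :* con false :+ i :+ j := m :* (c :+ c) :+ i :+ j) refl m c i j k) e

          ∑-dep≤cop : ∑∀ (λ a → 𝟙 (dep? Q R a)) ℕ.≤ cop Q R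
          ∑-dep≤cop = go (Fi.∑∀-zero⊎∃ finite (λ a → 𝟙 (dep? Q R a)))
            where
            go : (∀ a → 𝟙 (dep? Q R a) ≡ 0) ⊎ (∃ λ a → 𝟙 (dep? Q R a) ≢ 0) → ∑∀ (λ a → 𝟙 (dep? Q R a)) ℕ.≤ cop Q R
            go (inj₁ z) = ℕₚ.≤-trans (ℕₚ.≤-reflexive (∑-zero-∈ enum λ a _ → z a)) z≤n
            go (inj₂ (a₀ , h)) = ℕₚ.≤-trans (∑-mono enum λ a → 𝟙-mono (dep? Q R a) (a₀ ≟ a) (same-N a₀ a (𝟙≢0 (dep? Q R a₀) h)))
              (ℕₚ.≤-trans (ℕₚ.≤-reflexive (Finite.once finite a₀)) (1≤cop a₀ (𝟙≢0 (dep? Q R a₀) h)))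

        cop-self : ∀ {Q} → Q ∈ K° → cop Q Q ≡ 1
        cop-self {Q} Q∈ = trans (∑-cong points λ L → cong (inc v L ℕ.*_) (Bit-idem (ProjectivePlane.bit plane (ι Q) L))) (join v (ι Q) (ι≢v Q∈))

        ∑-cop-others : ∀ {Q} → Q ∈ K° → ∑ K° (λ R → 𝟙 (¬? (R ≟V Q)) ℕ.* cop Q R) ℕ.+ 1 ≡ ∑ K° (cop Q)
        ∑-cop-others {Q} Q∈ = begin
          ∑ K° (λ R → 𝟙 (¬? (R ≟V Q)) ℕ.* cop Q R) ℕ.+ 1
            ≡⟨ cong (∑ K° (λ R → 𝟙 (¬? (R ≟V Q)) ℕ.* cop Q R) ℕ.+_) (sym (trans (∑-cong K° (λ R → at R (R ≟V Q))) (∑-Unique≡1 _≟V_ K° K°-unique Q∈))) ⟩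
          ∑ K° (λ R → 𝟙 (¬? (R ≟V Q)) ℕ.* cop Q R) ℕ.+ ∑ K° (λ R → 𝟙 (R ≟V Q) ℕ.* cop Q R)
            ≡⟨ sym (∑-+ K° _ _) ⟩
          ∑ K° (λ R → 𝟙 (¬? (R ≟V Q)) ℕ.* cop Q R ℕ.+ 𝟙 (R ≟V Q) ℕ.* cop Q R)
            ≡⟨ ∑-cong K° (λ R → trans (sym (ℕₚ.*-distribʳ-+ (cop Q R) (𝟙 (¬? (R ≟V Q))) _)) (trans (cong (ℕ._* cop Q R) (𝟙-¬ (R ≟V Q))) (ℕₚ.*-identityˡ _))) ⟩
          ∑ K° (cop Q) ∎
          where
          open ≡-Reasoning
          at : ∀ R (d : Dec (R ≡ Q)) → 𝟙 d ℕ.* cop Q R ≡ 𝟙 d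
          at R (yes refl) = trans (ℕₚ.*-identityˡ _) (cop-self Q∈)
          at R (no _) = refl

        covered : ∀ {Q} → Q ∈ K° → ∀ a → 1 ℕ.≤ 𝟙 (Tangent? K (N a) Q) ℕ.+ ∑ K° (λ R → 𝟙 (¬? (R ≟V Q)) ℕ.* 𝟙 (dep? Q R a))
        covered {Q} Q∈ a = go (Tangent⊎Secant K (N a) Q)
          where
          go : Tangent K (N a) Q ⊎ Secant K (N a) Q → 1 ℕ.≤ 𝟙 (Tangent? K (N a) Q) ℕ.+ ∑ K° (λ R → 𝟙 (¬? (R ≟V Q)) ℕ.* 𝟙 (dep? Q R a))
          go (inj₁ t) = ℕₚ.≤-trans (ℕₚ.≤-reflexive (sym (𝟙-yes (Tangent? K (N a) Q) t))) (ℕₚ.m≤m+n _ _)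
          go (inj₂ (R , R∈ , R≢Q , dep)) = ℕₚ.≤-trans (ℕₚ.≤-trans
              (ℕₚ.≤-reflexive (sym (cong₂ ℕ._*_ (𝟙-yes (¬? (R ≟V Q)) R≢Q) (𝟙-yes (dep? Q R a) (λ l → LI₃⇒¬Dependent l dep)))))
              (f≤∑ K° (λ R → 𝟙 (¬? (R ≟V Q)) ℕ.* 𝟙 (dep? Q R a)) (K°⁺ R∈ R≢P))) (ℕₚ.m≤n+m _ _)
            where
            R≢P : R ≢ P
            R≢P refl = LI₃⇒¬Dependent (LI₃-swap₂₃ (li-NPQ a Q∈)) dep

        -- Each of the q lines from Q to the points `N a` is tangent at Q or contains another R.
        -- Such an R is coplanar with the tangent line and accounts for only one a. The extra 1 pays
        -- for the term R = Q.
        per-point : ∀ {Q} → Q ∈ K° → q ℕ.+ 1 ℕ.≤ ∑∀ (λ a → 𝟙 (Tangent? K (N a) Q)) ℕ.+ ∑ K° (cop Q)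
        per-point {Q} Q∈ = begin
          q ℕ.+ 1
            ≡⟨ cong (ℕ._+ 1) (sym (∑-one enum)) ⟩
          ∑∀ (λ _ → 1) ℕ.+ 1
            ≤⟨ ℕₚ.+-monoˡ-≤ 1 (∑-mono enum (covered Q∈)) ⟩
          ∑∀ (λ a → 𝟙 (Tangent? K (N a) Q) ℕ.+ ∑ K° (λ R → 𝟙 (¬? (R ≟V Q)) ℕ.* 𝟙 (dep? Q R a))) ℕ.+ 1
            ≡⟨ cong (ℕ._+ 1) (trans (∑-+ enum _ _) (cong (tan ℕ.+_) (trans (∑-swap enum K° _) (∑-cong K° λ R → ∑-*ˡ enum (𝟙 (¬? (R ≟V Q))) _)))) ⟩
          tan ℕ.+ ∑ K° (λ R → 𝟙 (¬? (R ≟V Q)) ℕ.* ∑∀ (λ a → 𝟙 (dep? Q R a))) ℕ.+ 1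
            ≤⟨ ℕₚ.+-monoˡ-≤ 1 (ℕₚ.+-monoʳ-≤ tan (∑-mono-∈ K° λ R R∈ → few R R∈ (R ≟V Q))) ⟩
          tan ℕ.+ ∑ K° (λ R → 𝟙 (¬? (R ≟V Q)) ℕ.* cop Q R) ℕ.+ 1
            ≡⟨ trans (ℕₚ.+-assoc tan _ 1) (cong (tan ℕ.+_) (∑-cop-others Q∈)) ⟩
          tan ℕ.+ ∑ K° (cop Q) ∎
          where
          open ℕₚ.≤-Reasoning
          tan = ∑∀ (λ a → 𝟙 (Tangent? K (N a) Q))
          few : ∀ R → R ∈ K° → (d : Dec (R ≡ Q)) → 𝟙 (¬? d) ℕ.* ∑∀ (λ a → 𝟙 (dep? Q R a)) ℕ.≤ 𝟙 (¬? d) ℕ.* cop Q R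
          few R R∈ (yes _) = z≤n
          few R R∈ (no R≢Q) = ℕₚ.*-monoʳ-≤ 1 (TwoPoints.∑-dep≤cop Q∈ R∈ R≢Q)

        ∑-cop : ∑ K° (λ Q → ∑ K° (cop Q)) ≡ ∑ points (λ L → inc v L ℕ.* (n L ℕ.* n L))
        ∑-cop = begin
          ∑ K° (λ Q → ∑ K° (λ R → ∑ points λ L → inc v L ℕ.* (inc (ι Q) L ℕ.* inc (ι R) L)))
            ≡⟨ ∑-cong K° (λ Q → ∑-swap K° points _) ⟩
          ∑ K° (λ Q → ∑ points (λ L → ∑ K° λ R → inc v L ℕ.* (inc (ι Q) L ℕ.* inc (ι R) L)))
            ≡⟨ ∑-swap K° points _ ⟩
          ∑ points (λ L → ∑ K° (λ Q → ∑ K° λ R → inc v L ℕ.* (inc (ι Q) L ℕ.* inc (ι R) L)))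
            ≡⟨ ∑-cong points (λ L → trans (∑-cong K° λ Q → trans (∑-*ˡ K° (inc v L) _) (cong (inc v L ℕ.*_) (∑-*ˡ K° (inc (ι Q) L) _)))
                 (trans (∑-*ˡ K° (inc v L) _) (cong (inc v L ℕ.*_) (∑-*ʳ K° (n L) _)))) ⟩
          ∑ points (λ L → inc v L ℕ.* (n L ℕ.* n L)) ∎
          where open ≡-Reasoning

        -- `per-point` is summed over Q, and each `N a` has at most t - 1 tangents besides the one
        -- at P.
        count : length K° ℕ.* (q ℕ.+ 1) ℕ.+ q ℕ.≤ q ℕ.* t ℕ.+ ∑ points (λ L → inc v L ℕ.* (n L ℕ.* n L))
        count = begin
          length K° ℕ.* (q ℕ.+ 1) ℕ.+ q
            ≡⟨ cong (ℕ._+ q) (sym (∑-const K° (q ℕ.+ 1))) ⟩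
          ∑ K° (λ _ → q ℕ.+ 1) ℕ.+ q
            ≤⟨ ℕₚ.+-monoˡ-≤ q (∑-mono-∈ K° λ Q Q∈ → per-point Q∈) ⟩
          ∑ K° (λ Q → ∑∀ (λ a → 𝟙 (Tangent? K (N a) Q)) ℕ.+ ∑ K° (cop Q)) ℕ.+ q
            ≡⟨ cong₂ ℕ._+_ (trans (∑-+ K° _ _) (cong₂ ℕ._+_ (∑-swap K° enum _) ∑-cop)) (sym (∑-one enum)) ⟩
          tan ℕ.+ cops ℕ.+ ∑∀ (λ _ → 1)
            ≡⟨ lem tan cops _ ⟩
          ∑∀ (λ _ → 1) ℕ.+ tan ℕ.+ cops
            ≡⟨ cong (ℕ._+ cops) (sym (∑-+ enum _ _)) ⟩
          ∑∀ (λ a → 1 ℕ.+ ∑ K° λ Q → 𝟙 (Tangent? K (N a) Q)) ℕ.+ cops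
            ≤⟨ ℕₚ.+-monoˡ-≤ cops (∑-mono enum tangents≤) ⟩
          ∑∀ (λ _ → t) ℕ.+ cops
            ≡⟨ cong (ℕ._+ cops) (∑-const enum t) ⟩
          q ℕ.* t ℕ.+ cops ∎
          where
          open ℕₚ.≤-Reasoning
          tan = ∑∀ (λ a → ∑ K° λ Q → 𝟙 (Tangent? K (N a) Q))
          cops = ∑ points (λ L → inc v L ℕ.* (n L ℕ.* n L))
          lem : ∀ a b c → a ℕ.+ b ℕ.+ c ≡ c ℕ.+ a ℕ.+ b
          lem = solve-∀

        -- On each line n = q + 1 - δ, so n² + 2(q + 1)δ = (q + 1)² + δ(δ - 1) + δ.
        ∑-squares : ∑ points (λ L → inc v L ℕ.* (n L ℕ.* n L)) ℕ.+ 2 ℕ.* (q ℕ.+ 1) ℕ.* (t ℕ.+ q)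
                  ≡ (q ℕ.+ 1) ℕ.* (q ℕ.+ 1) ℕ.* (q ℕ.+ 1) ℕ.+ ∑ points (λ L → inc v L ℕ.* falling (δ L)) ℕ.+ (t ℕ.+ q)
        ∑-squares = begin
          Sn ℕ.+ 2 ℕ.* (q ℕ.+ 1) ℕ.* (t ℕ.+ q)
            ≡⟨ cong (λ z → Sn ℕ.+ 2 ℕ.* (q ℕ.+ 1) ℕ.* z) (sym ∑δ) ⟩
          Sn ℕ.+ 2 ℕ.* (q ℕ.+ 1) ℕ.* ∑ points (λ L → inc v L ℕ.* δ L)
            ≡⟨ trans (cong (Sn ℕ.+_) (sym (∑-*ˡ points (2 ℕ.* (q ℕ.+ 1)) _))) (sym (∑-+ points _ _)) ⟩
          ∑ points (λ L → inc v L ℕ.* (n L ℕ.* n L) ℕ.+ 2 ℕ.* (q ℕ.+ 1) ℕ.* (inc v L ℕ.* δ L))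
            ≡⟨ ∑-cong points (λ L → pointwise (inc v L) (δ L) (n L) (δ+n L)) ⟩
          ∑ points (λ L → (q ℕ.+ 1) ℕ.* (q ℕ.+ 1) ℕ.* inc v L ℕ.+ inc v L ℕ.* falling (δ L) ℕ.+ inc v L ℕ.* δ L)
            ≡⟨ trans (∑-+ points _ _) (cong₂ ℕ._+_ (trans (∑-+ points _ _) (cong (ℕ._+ ∑ points (λ L → inc v L ℕ.* falling (δ L)))
                 (trans (∑-*ˡ points ((q ℕ.+ 1) ℕ.* (q ℕ.+ 1)) _) (cong ((q ℕ.+ 1) ℕ.* (q ℕ.+ 1) ℕ.*_) (lines-on v))))) ∑δ) ⟩
          (q ℕ.+ 1) ℕ.* (q ℕ.+ 1) ℕ.* (q ℕ.+ 1) ℕ.+ ∑ points (λ L → inc v L ℕ.* falling (δ L)) ℕ.+ (t ℕ.+ q) ∎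
          where
          open ≡-Reasoning
          Sn = ∑ points (λ L → inc v L ℕ.* (n L ℕ.* n L))
          ∑δ : ∑ points (λ L → inc v L ℕ.* δ L) ≡ t ℕ.+ q
          ∑δ = trans (∑-δ-through v) (cong (t ℕ.+_) (trans (cong (ℕ._* q) Tv) (ℕₚ.*-identityˡ q)))
          pointwise : ∀ i δ n → δ ℕ.+ n ≡ q ℕ.+ 1 → i ℕ.* (n ℕ.* n) ℕ.+ 2 ℕ.* (q ℕ.+ 1) ℕ.* (i ℕ.* δ) ≡ (q ℕ.+ 1) ℕ.* (q ℕ.+ 1) ℕ.* i ℕ.+ i ℕ.* falling δ ℕ.+ i ℕ.* δ
          pointwise i δ n e = trans (cong (λ z → i ℕ.* (n ℕ.* n) ℕ.+ 2 ℕ.* z ℕ.* (i ℕ.* δ)) (sym e)) (trans (square i δ n)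
            (trans (cong₂ (λ z w → z ℕ.* z ℕ.* i ℕ.+ i ℕ.* w) e (sym (falling-square δ)))
              (trans (cong ((q ℕ.+ 1) ℕ.* (q ℕ.+ 1) ℕ.* i ℕ.+_) (ℕₚ.*-distribˡ-+ i (falling δ) δ)) (sym (ℕₚ.+-assoc ((q ℕ.+ 1) ℕ.* (q ℕ.+ 1) ℕ.* i) (i ℕ.* falling δ) (i ℕ.* δ))))))
            where
            square : ∀ i δ n → i ℕ.* (n ℕ.* n) ℕ.+ 2 ℕ.* (δ ℕ.+ n) ℕ.* (i ℕ.* δ) ≡ (δ ℕ.+ n) ℕ.* (δ ℕ.+ n) ℕ.* i ℕ.+ i ℕ.* (δ ℕ.* δ)
            square = solve-∀

        -- When the size of `K°` and the squares are expressed through t and inserted in `count`,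
        -- all terms in t cancel and q(q + 1) is left.
        star : q ℕ.* q ℕ.+ q ℕ.≤ ∑ points (λ L → inc v L ℕ.* falling (δ L))
        star = ℕₚ.+-cancelˡ-≤ (q ℕ.* q ℕ.* q ℕ.+ 3 ℕ.* q ℕ.* q ℕ.+ 4 ℕ.* q ℕ.+ 1 ℕ.+ t ℕ.* (q ℕ.+ 1) ℕ.+ t ℕ.* (q ℕ.+ 1)) _ _ (begin
          q ℕ.* q ℕ.* q ℕ.+ 3 ℕ.* q ℕ.* q ℕ.+ 4 ℕ.* q ℕ.+ 1 ℕ.+ t ℕ.* (q ℕ.+ 1) ℕ.+ t ℕ.* (q ℕ.+ 1) ℕ.+ (q ℕ.* q ℕ.+ q)
            ≡⟨ lem₁ q t ⟩
          (q ℕ.* q ℕ.+ q ℕ.+ 1) ℕ.* (q ℕ.+ 1) ℕ.+ q ℕ.+ 2 ℕ.* (q ℕ.+ 1) ℕ.* (t ℕ.+ q)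
            ≡⟨ cong (λ z → z ℕ.* (q ℕ.+ 1) ℕ.+ q ℕ.+ 2 ℕ.* (q ℕ.+ 1) ℕ.* (t ℕ.+ q)) (sym t+k°) ⟩
          (t ℕ.+ length K°) ℕ.* (q ℕ.+ 1) ℕ.+ q ℕ.+ 2 ℕ.* (q ℕ.+ 1) ℕ.* (t ℕ.+ q)
            ≡⟨ lem₂ t (length K°) q _ ⟩
          t ℕ.* (q ℕ.+ 1) ℕ.+ (length K° ℕ.* (q ℕ.+ 1) ℕ.+ q ℕ.+ 2 ℕ.* (q ℕ.+ 1) ℕ.* (t ℕ.+ q))
            ≤⟨ ℕₚ.+-monoʳ-≤ (t ℕ.* (q ℕ.+ 1)) (ℕₚ.+-monoˡ-≤ (2 ℕ.* (q ℕ.+ 1) ℕ.* (t ℕ.+ q)) count) ⟩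
          t ℕ.* (q ℕ.+ 1) ℕ.+ (q ℕ.* t ℕ.+ Sn ℕ.+ 2 ℕ.* (q ℕ.+ 1) ℕ.* (t ℕ.+ q))
            ≡⟨ cong (t ℕ.* (q ℕ.+ 1) ℕ.+_) (trans (ℕₚ.+-assoc (q ℕ.* t) Sn _) (cong (q ℕ.* t ℕ.+_) ∑-squares)) ⟩
          t ℕ.* (q ℕ.+ 1) ℕ.+ (q ℕ.* t ℕ.+ ((q ℕ.+ 1) ℕ.* (q ℕ.+ 1) ℕ.* (q ℕ.+ 1) ℕ.+ Sf ℕ.+ (t ℕ.+ q)))
            ≡⟨ lem₃ t q Sf ⟩
          q ℕ.* q ℕ.* q ℕ.+ 3 ℕ.* q ℕ.* q ℕ.+ 4 ℕ.* q ℕ.+ 1 ℕ.+ t ℕ.* (q ℕ.+ 1) ℕ.+ t ℕ.* (q ℕ.+ 1) ℕ.+ Sf ∎)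
          where
          open ℕₚ.≤-Reasoning
          Sn = ∑ points (λ L → inc v L ℕ.* (n L ℕ.* n L))
          Sf = ∑ points (λ L → inc v L ℕ.* falling (δ L))
          t+k° : t ℕ.+ length K° ≡ q ℕ.* q ℕ.+ q ℕ.+ 1
          t+k° = ℕₚ.+-cancelʳ-≡ 1 _ _ (trans (ℕₚ.+-assoc t _ 1) (trans (cong (t ℕ.+_) size°) (trans t+k (sym (ℕₚ.+-assoc (q ℕ.* q ℕ.+ q) 1 1)))))
          lem₁ : ∀ q t → q ℕ.* q ℕ.* q ℕ.+ 3 ℕ.* q ℕ.* q ℕ.+ 4 ℕ.* q ℕ.+ 1 ℕ.+ t ℕ.* (q ℕ.+ 1) ℕ.+ t ℕ.* (q ℕ.+ 1) ℕ.+ (q ℕ.* q ℕ.+ q)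
                 ≡ (q ℕ.* q ℕ.+ q ℕ.+ 1) ℕ.* (q ℕ.+ 1) ℕ.+ q ℕ.+ 2 ℕ.* (q ℕ.+ 1) ℕ.* (t ℕ.+ q)
          lem₁ = solve-∀
          lem₂ : ∀ t k q x → (t ℕ.+ k) ℕ.* (q ℕ.+ 1) ℕ.+ q ℕ.+ x ≡ t ℕ.* (q ℕ.+ 1) ℕ.+ (k ℕ.* (q ℕ.+ 1) ℕ.+ q ℕ.+ x)
          lem₂ = solve-∀
          lem₃ : ∀ t q s → t ℕ.* (q ℕ.+ 1) ℕ.+ (q ℕ.* t ℕ.+ ((q ℕ.+ 1) ℕ.* (q ℕ.+ 1) ℕ.* (q ℕ.+ 1) ℕ.+ s ℕ.+ (t ℕ.+ q)))
                 ≡ q ℕ.* q ℕ.* q ℕ.+ 3 ℕ.* q ℕ.* q ℕ.+ 4 ℕ.* q ℕ.+ 1 ℕ.+ t ℕ.* (q ℕ.+ 1) ℕ.+ t ℕ.* (q ℕ.+ 1) ℕ.+ s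
          lem₃ = solve-∀

      dot₄-0 : ∀ ψ u → dot₄ ⟨ 0# , ψ ⟩ u ≡ dot ψ (tl u)
      dot₄-0 ψ ⟨ h , w ⟩ = trans (cong (_+ dot ψ w) (zeroˡ h)) (+-identityˡ _)

      dot-𝟎ʳ : ∀ ψ → dot ψ 𝟎 ≡ 0#
      dot-𝟎ʳ (v3 a b c) = solve 3 (λ a b c → a :* con false :+ (b :* con false :+ c :* con false) := con false) refl a b c

      zeros-tr : ∀ ψ → zeros K (tr ⟨ 0# , ψ ⟩) ≡ 1 ℕ.+ ∑ K° (λ Q → 𝟙 (dot ψ (π Q) ≟ 0#))
      zeros-tr ψ = begin
        zeros K (tr ⟨ 0# , ψ ⟩) ≡⟨ ∑-cong K (λ Q → cong (λ x → 𝟙 (x ≟ 0#)) (trans (adjoint ⟨ 0# , ψ ⟩ Q) (dot₄-0 ψ (to Q)))) ⟩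
        ∑ K (λ Q → 𝟙 (dot ψ (π Q) ≟ 0#)) ≡⟨ ∑-K _ ⟩
        𝟙 (dot ψ (π P) ≟ 0#) ℕ.+ ∑ K° (λ Q → 𝟙 (dot ψ (π Q) ≟ 0#))
          ≡⟨ cong (ℕ._+ ∑ K° (λ Q → 𝟙 (dot ψ (π Q) ≟ 0#))) (𝟙-yes (dot ψ (π P) ≟ 0#) (trans (cong (dot ψ) (cong tl to-P)) (dot-𝟎ʳ ψ))) ⟩
        1 ℕ.+ ∑ K° (λ Q → 𝟙 (dot ψ (π Q) ≟ 0#)) ∎
        where open ≡-Reasoning

      dot-line : ∀ {s} → s ≢ 0# → ∀ L {Q} → Q ∈ K° → 𝟙 (dot (scale s (vec L)) (π Q) ≟ 0#) ≡ inc (ι Q) L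
      dot-line {s} s≢0 L {Q} Q∈ = 𝟙-cong (dot (scale s (vec L)) (π Q) ≟ 0#) (dot (vec (ι Q)) (vec L) ≟ 0#)
          (λ e → *≡0 (*≢0 s≢0 (sc≢0 Q∈)) (trans (sym expand) e)) (λ e → trans expand (trans (cong (s * sc Q *_) e) (zeroʳ _)))
        where
        expand : dot (scale s (vec L)) (π Q) ≡ s * sc Q * dot (vec (ι Q)) (vec L)
        expand = trans (dot-scaleˡ s (vec L) (π Q)) (trans (cong (λ u → s * dot (vec L) u) (π≡ Q∈))
          (trans (cong (s *_) (trans (dot-scaleʳ (sc Q) (vec L) (vec (ι Q))) (cong (sc Q *_) (dot-comm (vec L) (vec (ι Q)))))) (sym (*-assoc s (sc Q) _))))

      zeros-line : ∀ {s} → s ≢ 0# → ∀ L → zeros K (tr ⟨ 0# , scale s (vec L) ⟩) ≡ 1 ℕ.+ n L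
      zeros-line s≢0 L = trans (zeros-tr _) (cong suc (∑-cong-∈ K° λ Q Q∈ → dot-line s≢0 L Q∈))

      zeros-𝟎 : zeros K (tr ⟨ 0# , 𝟎 ⟩) ≡ length K
      zeros-𝟎 = trans (zeros-tr 𝟎) (trans (cong suc (trans (∑-cong K° λ Q → 𝟙-yes (dot 𝟎 (π Q) ≟ 0#) (trans (dot-comm 𝟎 (π Q)) (dot-𝟎ʳ (π Q)))) (∑-one K°)))
        (trans (ℕₚ.+-comm 1 _) size°))

      ∑-lines : ℕ → ℕ
      ∑-lines M = ∑ points λ L → 𝟙 (suc (n L) ℕ.≟ M)

      -- In the coordinates at P, functionals vanishing at P have head 0, and the nonzero ones are
      -- scalar multiples of lines L, with n L + 1 zeros. The zero functional vanishes on all of K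
      -- and is excluded by the hypothesis on M.
      planes-local : ∀ M → length K ≢ M → planes K M P ≡ units ℕ.* ∑-lines M
      planes-local M K≢M = begin
        planes K M P
          ≡⟨ sym (∑-tr _) ⟩
        ∑ vectors₄ (λ φ → 𝟙 (dot₄ (tr φ) P ≟ 0#) ℕ.* 𝟙 (zeros K (tr φ) ℕ.≟ M))
          ≡⟨ ∑-cong vectors₄ (λ φ → cong (ℕ._* 𝟙 (zeros K (tr φ) ℕ.≟ M)) (vanish φ)) ⟩
        ∑ vectors₄ (λ φ → 𝟙 (0# ≟ hd φ) ℕ.* 𝟙 (zeros K (tr φ) ℕ.≟ M))
          ≡⟨ ∑-cart ⟨_,_⟩ enum vectors₃ _ ⟩
        ∑∀ (λ h → ∑ vectors₃ λ ψ → 𝟙 (0# ≟ h) ℕ.* 𝟙 (zeros K (tr ⟨ h , ψ ⟩) ℕ.≟ M))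
          ≡⟨ ∑-cong enum (λ h → ∑-*ˡ vectors₃ (𝟙 (0# ≟ h)) _) ⟩
        ∑∀ (λ h → 𝟙 (0# ≟ h) ℕ.* ∑ vectors₃ λ ψ → 𝟙 (zeros K (tr ⟨ h , ψ ⟩) ℕ.≟ M))
          ≡⟨ ∑-pick 0# (λ h → ∑ vectors₃ λ ψ → 𝟙 (zeros K (tr ⟨ h , ψ ⟩) ℕ.≟ M)) ⟩
        ∑ vectors₃ (λ ψ → 𝟙 (zeros K (tr ⟨ 0# , ψ ⟩) ℕ.≟ M))
          ≡⟨ ∑-projective _ ⟩
        𝟙 (zeros K (tr ⟨ 0# , 𝟎 ⟩) ℕ.≟ M) ℕ.+ ∑∀ (λ s → 𝟙 (nonzero? s) ℕ.* ∑ points (λ L → 𝟙 (zeros K (tr ⟨ 0# , scale s (vec L) ⟩) ℕ.≟ M)))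
          ≡⟨ cong₂ ℕ._+_ (𝟙-no (zeros K (tr ⟨ 0# , 𝟎 ⟩) ℕ.≟ M) λ e → K≢M (trans (sym zeros-𝟎) e))
               (∑-nonzero-cong λ s s≢0 → ∑-cong points λ L → cong (λ z → 𝟙 (z ℕ.≟ M)) (zeros-line s≢0 L)) ⟩
        ∑∀ (λ s → 𝟙 (nonzero? s) ℕ.* ∑-lines M)
          ≡⟨ ∑-*ʳ enum (∑-lines M) _ ⟩
        units ℕ.* ∑-lines M ∎
        where
        open ≡-Reasoning
        vanish : ∀ φ → 𝟙 (dot₄ (tr φ) P ≟ 0#) ≡ 𝟙 (0# ≟ hd φ)
        vanish ⟨ h , ψ ⟩ = 𝟙-cong (dot₄ (tr ⟨ h , ψ ⟩) P ≟ 0#) (0# ≟ h) (λ e → trans (sym e) value) (λ e → trans value (sym e))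
          where
          value : dot₄ (tr ⟨ h , ψ ⟩) P ≡ h
          value = trans (adjoint ⟨ h , ψ ⟩ P) (trans (cong (dot₄ ⟨ h , ψ ⟩) to-P) (trans (cong (h * 1# +_) (dot-𝟎ʳ ψ)) (trans (+-identityʳ _) (*-identityʳ h))))

      lines-δ : ∀ d M → d ℕ.+ M ≡ q ℕ.+ 2 → ∑-lines M ≡ ∑ points (λ L → 𝟙 (δ L ℕ.≟ d))
      lines-δ d M e = ∑-cong points λ L → 𝟙-cong (suc (n L) ℕ.≟ M) (δ L ℕ.≟ d)
        (λ h → ℕₚ.+-cancelʳ-≡ M _ _ (trans (trans (cong (δ L ℕ.+_) (sym h)) (total L)) (sym e)))
        (λ h → ℕₚ.+-cancelˡ-≡ d _ _ (trans (trans (cong (ℕ._+ suc (n L)) (sym h)) (total L)) (sym e)))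
        where
        total : ∀ L → δ L ℕ.+ suc (n L) ≡ q ℕ.+ 2
        total L = trans (ℕₚ.+-suc (δ L) (n L)) (trans (cong suc (δ+n L)) (trans (sym (ℕₚ.+-suc q 1)) refl))

      module Large (q≥2048 : 2048 ℕ.≤ q) (large : q ℕ.* q ℕ.+ q ℕ.+ 2 ℕ.+ 136 ℕ.≤ length K ℕ.+ 3 ℕ.* q) where

        t-small : t ℕ.+ 136 ℕ.≤ 3 ℕ.* q
        t-small = ℕₚ.+-cancelˡ-≤ (length K) _ _ (ℕₚ.≤-trans (ℕₚ.≤-reflexive (trans (sym (ℕₚ.+-assoc (length K) t 136))
          (cong (ℕ._+ 136) (trans (ℕₚ.+-comm (length K) t) t+k)))) large)

        open Star q≥2048 t-small (λ v Tv → TangentDirection.star Tv)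

        K-big : ∀ {M} → M ℕ.≤ q ℕ.+ 2 → length K ≢ M
        K-big {M} M≤ e = ℕₚ.1+n≰n (begin
          suc (4 ℕ.* q ℕ.+ 2) ≤⟨ ℕₚ.m≤m+n _ 135 ⟩
          suc (4 ℕ.* q ℕ.+ 2) ℕ.+ 135 ≤⟨ ℕₚ.m≤m+n _ q ⟩
          suc (4 ℕ.* q ℕ.+ 2) ℕ.+ 135 ℕ.+ q ≡⟨ lem q ⟩
          4 ℕ.* q ℕ.+ q ℕ.+ 2 ℕ.+ 136 ≤⟨ ℕₚ.+-monoˡ-≤ 136 (ℕₚ.+-monoˡ-≤ 2 (ℕₚ.+-monoˡ-≤ q (ℕₚ.*-monoˡ-≤ q (ℕₚ.≤-trans (ℕₚ.m≤m+n 4 2044) q≥2048)))) ⟩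
          q ℕ.* q ℕ.+ q ℕ.+ 2 ℕ.+ 136 ≤⟨ large ⟩
          length K ℕ.+ 3 ℕ.* q ≡⟨ cong (ℕ._+ 3 ℕ.* q) e ⟩
          M ℕ.+ 3 ℕ.* q ≤⟨ ℕₚ.+-monoˡ-≤ (3 ℕ.* q) M≤ ⟩
          q ℕ.+ 2 ℕ.+ 3 ℕ.* q ≡⟨ lem′ q ⟩
          4 ℕ.* q ℕ.+ 2 ∎)
          where
          open ℕₚ.≤-Reasoning
          lem : ∀ q → suc (4 ℕ.* q ℕ.+ 2) ℕ.+ 135 ℕ.+ q ≡ 4 ℕ.* q ℕ.+ q ℕ.+ 2 ℕ.+ 136
          lem = solve-∀
          lem′ : ∀ q → q ℕ.+ 2 ℕ.+ 3 ℕ.* q ≡ 4 ℕ.* q ℕ.+ 2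
          lem′ = solve-∀

        k+ : ∀ {x} → t ≡ x → length K ℕ.+ x ≡ q ℕ.* q ℕ.+ q ℕ.+ 2
        k+ e = trans (cong (length K ℕ.+_) (sym e)) (trans (ℕₚ.+-comm (length K) t) t+k)

        planes₁ : planes K (q ℕ.+ 1) P ≡ units ℕ.* A₁
        planes₁ = trans (planes-local (q ℕ.+ 1) (K-big (ℕₚ.+-monoʳ-≤ q (ℕₚ.n≤1+n 1)))) (cong (units ℕ.*_) (lines-δ 1 (q ℕ.+ 1) (lem q)))
          where
          lem : ∀ q → 1 ℕ.+ (q ℕ.+ 1) ≡ q ℕ.+ 2
          lem = solve-∀

        planes₀ : planes K (q ℕ.+ 2) P ≡ units ℕ.* A₀
        planes₀ = trans (planes-local (q ℕ.+ 2) (K-big ℕₚ.≤-refl)) (cong (units ℕ.*_) (lines-δ 0 (q ℕ.+ 2) refl))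

        -- The projection of Q is not in `T`, so the q + 1 lines through it partition `T`. If none
        -- of them met it just once, t would be at least 2(q + 1).
        tangent-plane-through : (∀ L → 1 ℕ.≤ δ L) → t ℕ.≤ 2 ℕ.* q ℕ.+ 1 → ∀ Q → Q ∈ K → Q ≢ P →
                                ∃ λ φ → φ ∈ vectors₄ × dot₄ φ Q ≡ 0# × zeros K φ ≡ q ℕ.+ 1
        tangent-plane-through blocks t≤ Q Q∈ Q≢P = go (zero⊎∃L (λ L → inc (ι Q) L ℕ.* 𝟙 (δ L ℕ.≟ 1)))
          where
          Q∈° : Q ∈ K°
          Q∈° = K°⁺ Q∈ Q≢P
          TQ : T (ι Q) ≡ 0
          TQ = ℕₚ.m≤n⇒m∸n≡0 (ℕₚ.≤-trans (ℕₚ.≤-reflexive (sym (𝟙-yes (ι Q ≟P ι Q) refl))) (f≤∑ K° (λ R → 𝟙 (ι R ≟P ι Q)) Q∈°))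
          go : (∀ L → inc (ι Q) L ℕ.* 𝟙 (δ L ℕ.≟ 1) ≡ 0) ⊎ (∃ λ L → inc (ι Q) L ℕ.* 𝟙 (δ L ℕ.≟ 1) ≢ 0) →
               ∃ λ φ → φ ∈ vectors₄ × dot₄ φ Q ≡ 0# × zeros K φ ≡ q ℕ.+ 1
          go (inj₁ z) = ⊥-elim (ℕₚ.1+n≰n (begin
              suc (2 ℕ.* q ℕ.+ 1) ≡⟨ lem q ⟩
              2 ℕ.* (q ℕ.+ 1) ≡⟨ cong (2 ℕ.*_) (sym (lines-on (ι Q))) ⟩
              2 ℕ.* ∑ points (inc (ι Q)) ≡⟨ sym (∑-*ˡ points 2 _) ⟩
              ∑ points (λ L → 2 ℕ.* inc (ι Q) L) ≤⟨ ∑-mono points (λ L → two (ProjectivePlane.bit plane (ι Q) L) (δ L) (blocks L) (z L)) ⟩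
              ∑ points (λ L → inc (ι Q) L ℕ.* δ L) ≡⟨ ∑-δ-through (ι Q) ⟩
              t ℕ.+ T (ι Q) ℕ.* q ≡⟨ trans (cong (λ x → t ℕ.+ x ℕ.* q) TQ) (ℕₚ.+-identityʳ t) ⟩
              t ≤⟨ t≤ ⟩
              2 ℕ.* q ℕ.+ 1 ∎))
            where
            open ℕₚ.≤-Reasoning
            lem : ∀ q → suc (2 ℕ.* q ℕ.+ 1) ≡ 2 ℕ.* (q ℕ.+ 1)
            lem = solve-∀
            two : ∀ {i} → Bit i → ∀ d → 1 ℕ.≤ d → i ℕ.* 𝟙 (d ℕ.≟ 1) ≡ 0 → 2 ℕ.* i ℕ.≤ i ℕ.* d
            two O d _ _ = z≤n
            two I 1 _ ()
            two I (suc (suc d)) _ _ = s≤s (s≤s z≤n)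
          go (inj₂ (L , nz)) = tr ⟨ 0# , scale 1# (vec L) ⟩ , ∈vectors₄ _
              , trans (adjoint _ Q) (trans (dot₄-0 _ (to Q)) (𝟙≢0 (dot (scale 1# (vec L)) (π Q) ≟ 0#)
                  (λ e → nz (cong (ℕ._* 𝟙 (δ L ℕ.≟ 1)) (trans (sym (dot-line 1≢0 L Q∈°)) e)))))
              , trans (zeros-line 1≢0 L) (ℕₚ.+-cancelˡ-≡ (δ L) _ _ (trans (ℕₚ.+-suc (δ L) (n L)) (trans (cong suc (δ+n L)) (sym (cong (ℕ._+ (q ℕ.+ 1)) δ≡1)))))
            where
            ∈vectors₄ : ∀ φ → φ ∈ vectors₄
            ∈vectors₄ ⟨ h , ψ ⟩ = ∈-cartesianProductWith⁺ ⟨_,_⟩ (enum-complete h) (∈vectors₃ ψ)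
            δ≡1 : δ L ≡ 1
            δ≡1 = 𝟙≢0 (δ L ℕ.≟ 1) λ e → nz (trans (cong (inc (ι Q) L ℕ.*_) e) (ℕₚ.*-zeroʳ (inc (ι Q) L)))

        point-type : PointType K P
        point-type = go shape
          where
          go : Shape → PointType K P
          go (empty e) = empty (trans (sym (ℕₚ.+-identityʳ _)) (k+ e)) (trans planes₀ (cong (units ℕ.*_) (trans
              (∑-cong points λ L → 𝟙-yes (δ L ℕ.≟ 0) (∑-zero-∈ points λ p _ → cong (ℕ._* inc p L) (ℕₚ.n≤0⇒n≡0 (subst (T p ℕ.≤_) e (Fi.f≤∑∀ finPt T p)))))
              (trans (∑-one points) length-points))))
          go (line e) = ovoid (k+ e)
          go (blocking b (inj₁ (e , a))) = blocking A₁ planes₁ (inj₁ (k+ e , a)) (tangent-plane-through b (ℕₚ.≤-reflexive e))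
          go (blocking b (inj₂ (e , a))) = blocking A₁ planes₁ (inj₂ (k+ e , a)) (tangent-plane-through b (ℕₚ.≤-trans (ℕₚ.≤-reflexive e) (ℕₚ.m≤m+n _ 1)))
          go (even e a h) = even A₀ (k+ e) planes₀ a (trans planes₁ (trans (cong (units ℕ.*_) (∑-zero-∈ points λ L _ → 𝟙-no (δ L ℕ.≟ 1) (h L))) (ℕₚ.*-zeroʳ units)))

-- Double counting of planes and the resulting divisibilities.

module GlobalStructure where
  open ≡ using (refl; sym; trans; cong; cong₂; subst)
  open Counting
  open Characteristic2
  open PlaneOverField
  open SpaceOverField
  open CapsInSpace
  open LocalStructure

  module Arithmetic where
    open import Data.Nat using (_+_; _*_; _<_)

    not-small-divisor : ∀ {m n} .{{_ : ℕ.NonZero n}} → n < m → ¬ m ∣ n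
    not-small-divisor n<m d = ℕₚ.<⇒≱ n<m (∣⇒≤ d)

    -- A congruence of x to r modulo m, written without subtraction. In the uses r is the value of a
    -- polynomial in u at the root of m.
    remainder : ∀ {m x a b r} → m ∣ x → x + m * a ≡ m * b + r → m ∣ r
    remainder {m} {x} {a} {b} (divides c refl) e = ∣m+n∣m⇒∣n (subst (m ∣_) e (divides (c + a) (lem c m a))) (m∣m*n b)
      where
      lem : ∀ c m a → c * m + m * a ≡ (c + a) * m
      lem = solve-∀

    -- At u = -2 the product is 3 · 4 = 12, too small for u + 2.
    absurd₁ : ∀ u → 100 ≤ u → ¬ (u + 2 ∣ (u * u + u + 1) * (u * u))
    absurd₁ u h d = not-small-divisor (ℕₚ.≤-trans (ℕₚ.m≤m+n 13 87) (ℕₚ.≤-trans h (ℕₚ.m≤m+n u 2)))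
      (remainder {b = u * u * u + 3 * u} d (lem u))
      where
      lem : ∀ u → (u * u + u + 1) * (u * u) + (u + 2) * (u * u + 6) ≡ (u + 2) * (u * u * u + 3 * u) + 12
      lem = solve-∀

    -- At u = -2 the product is 4 · (-2) · (-3) = 24.
    absurd₂ : ∀ u → 100 ≤ u → ¬ (u + 2 ∣ (u * u + u + 2) * (u * (2 * u + 1)))
    absurd₂ u h d = not-small-divisor (ℕₚ.≤-trans (ℕₚ.m≤m+n 25 75) (ℕₚ.≤-trans h (ℕₚ.m≤m+n u 2)))
      (remainder {b = 2 * u * u * u + 7 * u} d (lem u))
      where
      lem : ∀ u → (u * u + u + 2) * (u * (2 * u + 1)) + (u + 2) * (u * u + 12) ≡ (u + 2) * (2 * u * u * u + 7 * u) + 24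
      lem = solve-∀

    -- At u = -3 the product is 8 · 9 = 72.
    absurd₃ : ∀ u → 100 ≤ u → ¬ (u + 3 ∣ (u * u + u + 2) * (u * u))
    absurd₃ u h d = not-small-divisor (ℕₚ.≤-trans (ℕₚ.m≤m+n 73 27) (ℕₚ.≤-trans h (ℕₚ.m≤m+n u 3)))
      (remainder {b = u * u * u + 8 * u} d (lem u))
      where
      lem : ∀ u → (u * u + u + 2) * (u * u) + (u + 3) * (2 * u * u + 24) ≡ (u + 3) * (u * u * u + 8 * u) + 72
      lem = solve-∀

    -- At u = -3 the product is 4 · (-3) · 3 = -36; the sign puts the remainder on the other side of
    -- the identity.
    absurd₄ : ∀ u → 100 ≤ u → ¬ (u + 3 ∣ (u * u + 3 * u + 4) * (u * (u * u + 3 * u + 3)))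
    absurd₄ u h d = not-small-divisor (ℕₚ.≤-trans (ℕₚ.m≤m+n 37 63) (ℕₚ.≤-trans h (ℕₚ.m≤m+n u 3)))
      (∣m+n∣m⇒∣n (subst (u + 3 ∣_) (lem u) (m∣m*n (u * u * (u * u + 3 * u + 7) + 12))) d)
      where
      lem : ∀ u → (u + 3) * (u * u * (u * u + 3 * u + 7) + 12) ≡ (u * u + 3 * u + 4) * (u * (u * u + 3 * u + 3)) + 36
      lem = solve-∀

  module Global (𝔽 : Char2Field) where
    open FieldTheory 𝔽
    open PG2 𝔽
    open Space 𝔽
    open Caps 𝔽
    open Local 𝔽

    Complete : List V4 → Set
    Complete K = ∀ N → (∀ P → P ∈ K → LI₂ N P) →
      ∃₂ λ x y → ∃₂ λ α β → x ∈ K × y ∈ K × x ≢ y × N ≡ comb₂ α x β y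

    -- Pairs of a point of K and a functional vanishing there with exactly M zeros on K: grouped by
    -- functionals, they come in packets of M.
    planes-divisible : ∀ K M C → (∀ P → P ∈ K → planes K M P ≡ C) → M ∣ length K ℕ.* C
    planes-divisible K M C h = divides (∑ vectors₄ λ φ → 𝟙 (zeros K φ ℕ.≟ M)) (begin
      length K ℕ.* C
        ≡⟨ sym (∑-const K C) ⟩
      ∑ K (λ _ → C)
        ≡⟨ sym (∑-cong-∈ K h) ⟩
      ∑ K (λ P → ∑ vectors₄ λ φ → 𝟙 (dot₄ φ P ≟ 0#) ℕ.* 𝟙 (zeros K φ ℕ.≟ M))
        ≡⟨ ∑-swap K vectors₄ _ ⟩
      ∑ vectors₄ (λ φ → ∑ K λ P → 𝟙 (dot₄ φ P ≟ 0#) ℕ.* 𝟙 (zeros K φ ℕ.≟ M))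
        ≡⟨ ∑-cong vectors₄ (λ φ → trans (∑-*ʳ K (𝟙 (zeros K φ ℕ.≟ M)) _) (at (zeros K φ) (zeros K φ ℕ.≟ M))) ⟩
      ∑ vectors₄ (λ φ → 𝟙 (zeros K φ ℕ.≟ M) ℕ.* M)
        ≡⟨ ∑-*ʳ vectors₄ M _ ⟩
      ∑ vectors₄ (λ φ → 𝟙 (zeros K φ ℕ.≟ M)) ℕ.* M ∎)
      where
      open ≡-Reasoning
      at : ∀ z (d : Dec (z ≡ M)) → z ℕ.* 𝟙 d ≡ 𝟙 d ℕ.* M
      at z (yes refl) = trans (ℕₚ.*-identityʳ z) (sym (ℕₚ.*-identityˡ z))
      at z (no _) = ℕₚ.*-zeroʳ z

    module _ {K : List V4} (cap : IsCap K) (complete : Complete K) (q≥2048 : 2048 ≤ q)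
             (large : q ℕ.* q ℕ.+ q ℕ.+ 2 ℕ.+ 136 ≤ length K ℕ.+ 3 ℕ.* q)
             (not-ovoid : length K ≢ q ℕ.* q ℕ.+ 1) where

      τ-bound : ∀ N → (∀ P → P ∈ K → LI₂ N P) → τ K N +ⁿ length K ≤ q *ⁿ q +ⁿ q +ⁿ 2
      τ-bound N off with complete N off
      ... | x , y , α , β , x∈ , y∈ , x≢y , N≡ = SecantPoint.τ-bound cap x∈ y∈ x≢y N≡ off

      types : ∀ P → P ∈ K → PointType K P
      types P P∈ with to-e₁ P (IsCap.nonzero cap P∈)
      ... | g , to-P = AtPoint.Large.point-type cap τ-bound P∈ g to-P q≥2048 large

      private
        k = length K
        u = units
        S = q *ⁿ q +ⁿ q +ⁿ 2

        q≡ : q ≡ u +ⁿ 1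
        q≡ = sym units+1

        u≥100 : 100 ≤ u
        u≥100 = ℕₚ.+-cancelʳ-≤ 1 100 u (ℕₚ.≤-trans (ℕₚ.≤-trans (ℕₚ.m≤m+n 101 1947) q≥2048) (ℕₚ.≤-reflexive q≡))

        same : ∀ {a b} → k +ⁿ a ≡ S → k +ⁿ b ≡ S → a ≡ b
        same e e′ = ℕₚ.+-cancelˡ-≡ k _ _ (trans e (sym e′))

        q≢ : ∀ {n} → n ℕ.< 2048 → q ≢ n
        q≢ h refl = ℕₚ.<⇒≱ h q≥2048

        impossible-ovoid : k +ⁿ (q +ⁿ 1) ≡ S → ⊥
        impossible-ovoid e = not-ovoid (ℕₚ.+-cancelʳ-≡ (q +ⁿ 1) _ _ (trans e (lem q)))
          where
          lem : ∀ q → q *ⁿ q +ⁿ q +ⁿ 2 ≡ q *ⁿ q +ⁿ 1 +ⁿ (q +ⁿ 1)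
          lem = solve-∀

        0≢2q : 0 ≢ 2 *ⁿ q
        0≢2q e = q≢ {0} (s≤s z≤n) (ℕₚ.m+n≡0⇒m≡0 q (sym e))

        0≢2q+1 : 0 ≢ 2 *ⁿ q +ⁿ 1
        0≢2q+1 e = 0≢2q (sym (ℕₚ.m+n≡0⇒m≡0 (2 *ⁿ q) (sym e)))

        2q+1≢2q : 2 *ⁿ q +ⁿ 1 ≢ 2 *ⁿ q
        2q+1≢2q e = ℕₚ.1+n≢n (trans (ℕₚ.+-comm 1 (2 *ⁿ q)) e)

        -- Substituting q = u + 1, every case is a divisibility in the single variable u = q − 1.
        divide : ∀ {M k′ A A′} M′ → M ≡ M′ → k ≡ k′ → A ≡ A′ → (∀ P → P ∈ K → planes K M P ≡ u *ⁿ A) → M′ ∣ k′ *ⁿ (u *ⁿ A′)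
        divide M′ refl refl refl h = planes-divisible K M′ _ h

        q+1≡ : q +ⁿ 1 ≡ u +ⁿ 2
        q+1≡ = trans (cong (_+ⁿ 1) q≡) (ℕₚ.+-assoc u 1 1)

        q+2≡ : q +ⁿ 2 ≡ u +ⁿ 3
        q+2≡ = trans (cong (_+ⁿ 2) q≡) (ℕₚ.+-assoc u 1 2)

        no-plane : ∀ {P φ} → planes K (q +ⁿ 1) P ≡ 0 → φ ∈ vectors₄ → dot₄ φ P ≡ 0# → zeros K φ ≡ q +ⁿ 1 → ⊥
        no-plane {P} {φ} z φ∈ e e′ = ℕₚ.1+n≰n (ℕₚ.≤-trans (ℕₚ.≤-reflexive (sym (cong₂ _*ⁿ_ (𝟙-yes (dot₄ φ P ≟ 0#) e) (𝟙-yes (zeros K φ ℕ.≟ q +ⁿ 1) e′))))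
          (ℕₚ.≤-trans (f≤∑ vectors₄ (λ φ → 𝟙 (dot₄ φ P ≟ 0#) *ⁿ 𝟙 (zeros K φ ℕ.≟ q +ⁿ 1)) φ∈) (ℕₚ.≤-reflexive z)))

        A≡ : ∀ {A c} → A +ⁿ 1 ≡ q → c +ⁿ 1 ≡ q → A ≡ c
        A≡ e e′ = ℕₚ.+-cancelʳ-≡ 1 _ _ (trans e (sym e′))

        k₂ : k +ⁿ 2 *ⁿ q ≡ S → k ≡ u *ⁿ u +ⁿ u +ⁿ 2
        k₂ e = ℕₚ.+-cancelʳ-≡ (2 *ⁿ q) _ _ (trans e (trans (cong (λ q → q *ⁿ q +ⁿ q +ⁿ 2) q≡) (trans (lem u) (cong (λ q → u *ⁿ u +ⁿ u +ⁿ 2 +ⁿ 2 *ⁿ q) (sym q≡)))))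
          where
          lem : ∀ u → (u +ⁿ 1) *ⁿ (u +ⁿ 1) +ⁿ (u +ⁿ 1) +ⁿ 2 ≡ u *ⁿ u +ⁿ u +ⁿ 2 +ⁿ 2 *ⁿ (u +ⁿ 1)
          lem = solve-∀

      -- The size of K fixes t, so all points have the same type, except that t = 2q admits both
      -- `even` and the second kind of `blocking`. These cannot coexist, so one plane count is
      -- constant on K.
      contradiction : ∀ {P₀} → P₀ ∈ K → ⊥
      contradiction {P₀} P₀∈ = go (types P₀ P₀∈)
        where
        go : PointType K P₀ → ⊥
        go (ovoid e) = impossible-ovoid e
        go (empty e _) = Arithmetic.absurd₄ u u≥100 (divide (u +ⁿ 3) q+2≡ (trans e (trans (cong (λ q → q *ⁿ q +ⁿ q +ⁿ 2) q≡) (lem u)))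
            (trans (cong (λ q → q *ⁿ q +ⁿ q +ⁿ 1) q≡) (lem′ u)) λ P P∈ → all (types P P∈))
          where
          lem : ∀ u → (u +ⁿ 1) *ⁿ (u +ⁿ 1) +ⁿ (u +ⁿ 1) +ⁿ 2 ≡ u *ⁿ u +ⁿ 3 *ⁿ u +ⁿ 4
          lem = solve-∀
          lem′ : ∀ u → (u +ⁿ 1) *ⁿ (u +ⁿ 1) +ⁿ (u +ⁿ 1) +ⁿ 1 ≡ u *ⁿ u +ⁿ 3 *ⁿ u +ⁿ 3
          lem′ = solve-∀
          e₀ : k +ⁿ 0 ≡ S
          e₀ = trans (ℕₚ.+-identityʳ k) e
          all : ∀ {P} → PointType K P → planes K (q +ⁿ 2) P ≡ u *ⁿ (q *ⁿ q +ⁿ q +ⁿ 1)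
          all (ovoid f) = ⊥-elim (impossible-ovoid f)
          all (empty _ c) = c
          all (blocking _ _ (inj₁ (f , _)) _) = ⊥-elim (0≢2q+1 (same e₀ f))
          all (blocking _ _ (inj₂ (f , _)) _) = ⊥-elim (0≢2q (same e₀ f))
          all (even _ f _ _ _) = ⊥-elim (0≢2q (same e₀ f))
        go (blocking A _ (inj₁ (e , a)) _) = Arithmetic.absurd₁ u u≥100 (divide (u +ⁿ 2) q+1≡ k₁ (A≡ a units+1) λ P P∈ → all (types P P∈))
          where
          k₁ : k ≡ u *ⁿ u +ⁿ u +ⁿ 1
          k₁ = ℕₚ.+-cancelʳ-≡ (2 *ⁿ q +ⁿ 1) _ _ (trans e (trans (cong (λ q → q *ⁿ q +ⁿ q +ⁿ 2) q≡) (trans (lem u) (cong (λ q → u *ⁿ u +ⁿ u +ⁿ 1 +ⁿ (2 *ⁿ q +ⁿ 1)) (sym q≡)))))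
            where
            lem : ∀ u → (u +ⁿ 1) *ⁿ (u +ⁿ 1) +ⁿ (u +ⁿ 1) +ⁿ 2 ≡ u *ⁿ u +ⁿ u +ⁿ 1 +ⁿ (2 *ⁿ (u +ⁿ 1) +ⁿ 1)
            lem = solve-∀
          all : ∀ {P} → PointType K P → planes K (q +ⁿ 1) P ≡ u *ⁿ A
          all (ovoid f) = ⊥-elim (impossible-ovoid f)
          all (empty f _) = ⊥-elim (0≢2q+1 (same (trans (ℕₚ.+-identityʳ k) f) e))
          all (blocking A′ c (inj₁ (_ , a′)) _) = trans c (cong (u *ⁿ_) (A≡ a′ a))
          all (blocking _ _ (inj₂ (f , _)) _) = ⊥-elim (2q+1≢2q (same e f))
          all (even _ f _ _ _) = ⊥-elim (2q+1≢2q (same e f))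
        go (blocking A c₀ (inj₂ (e , a)) through) = Arithmetic.absurd₂ u u≥100 (divide (u +ⁿ 2) q+1≡ (k₂ e) A-val λ P P∈ → all P∈ (P ≟V P₀) (types P P∈))
          where
          A-val : A ≡ 2 *ⁿ u +ⁿ 1
          A-val = ℕₚ.+-cancelʳ-≡ 1 _ _ (trans a (trans (cong (2 *ⁿ_) q≡) (lem u)))
            where
            lem : ∀ u → 2 *ⁿ (u +ⁿ 1) ≡ 2 *ⁿ u +ⁿ 1 +ⁿ 1
            lem = solve-∀
          all : ∀ {P} → P ∈ K → Dec (P ≡ P₀) → PointType K P → planes K (q +ⁿ 1) P ≡ u *ⁿ A
          all _ (yes refl) _ = c₀
          all _ _ (ovoid f) = ⊥-elim (impossible-ovoid f)
          all _ _ (empty f _) = ⊥-elim (0≢2q (same (trans (ℕₚ.+-identityʳ k) f) e))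
          all _ _ (blocking _ _ (inj₁ (f , _)) _) = ⊥-elim (2q+1≢2q (same f e))
          all _ _ (blocking A′ c (inj₂ (_ , a′)) _) = trans c (cong (u *ⁿ_) (ℕₚ.+-cancelʳ-≡ 1 _ _ (trans a′ (sym a))))
          -- The type at `P₀` gives a plane with q + 1 points through P, but a point of type `even`
          -- lies on no such plane.
          all P∈ (no P≢P₀) (even _ _ _ _ z) with through _ P∈ P≢P₀
          ... | φ , φ∈ , on , zs = ⊥-elim (no-plane z φ∈ on zs)
        go (even A e c₀ a z₀) = Arithmetic.absurd₃ u u≥100 (divide (u +ⁿ 3) q+2≡ (k₂ e) (A≡ a units+1) λ P P∈ → all P∈ (P ≟V P₀) (types P P∈))
          where
          all : ∀ {P} → P ∈ K → Dec (P ≡ P₀) → PointType K P → planes K (q +ⁿ 2) P ≡ u *ⁿ A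
          all _ (yes refl) _ = c₀
          all _ _ (ovoid f) = ⊥-elim (impossible-ovoid f)
          all _ _ (empty f _) = ⊥-elim (0≢2q (same (trans (ℕₚ.+-identityʳ k) f) e))
          all _ _ (blocking _ _ (inj₁ (f , _)) _) = ⊥-elim (2q+1≢2q (same f e))
          -- The same conflict with the roles exchanged: the plane comes from P and passes through
          -- `P₀`.
          all _ (no P≢P₀) (blocking _ _ (inj₂ _) through) with through P₀ P₀∈ (λ e → P≢P₀ (sym e))
          ... | φ , φ∈ , on , zs = ⊥-elim (no-plane z₀ φ∈ on zs)
          all _ _ (even A′ _ c a′ _) = trans c (cong (u *ⁿ_) (A≡ a′ a))

open Counting
open Characteristic2
open PlaneOverField
open SpaceOverField
open CapsInSpace using (∑-Unique≡1; module Caps)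
open GlobalStructure

-- Transfer from an arbitrary field of even order, and the final bound.

finiteFin : ∀ q → Finite (Fin q)
finiteFin q = record { enum = allFin q ; _≟ᶠ_ = Finₚ._≟_ ; once = λ x →
  ≡.trans (∑-cong (allFin q) λ y → 𝟙-cong (x Finₚ.≟ y) (y Finₚ.≟ x) ≡.sym ≡.sym)
    (∑-Unique≡1 Finₚ._≟_ (allFin q) (Uₚ.allFin⁺ q) (∈-allFin x)) }

-- Away from its fixed point the involution pairs x < σ x with σ x > x.
involution-odd : ∀ q (σ : Fin q → Fin q) → (∀ x → σ (σ x) ≡ x) → ∀ z → (∀ x → σ x ≡ x → x ≡ z) → σ z ≡ z → ¬ 2 ∣ q
involution-odd q σ σσ z fixed fz (divides c q≡) = parity c A (≡.trans (≡.sym q≡) (≡.trans (≡.sym (length-tabulate (λ (x : Fin q) → x))) count))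
  where
  open Fi (finiteFin q)
  A = ∑∀ λ x → 𝟙 (x Finₚ.<? σ x)
  split : ∀ x → 𝟙 (x Finₚ.<? σ x) +ⁿ 𝟙 (σ x Finₚ.<? σ (σ x)) +ⁿ 𝟙 (z Finₚ.≟ x) ≡ 1
  split x with Finₚ.<-cmp x (σ x)
  ... | tri< a b c = ≡.cong₂ _+ⁿ_ (≡.cong₂ _+ⁿ_ (𝟙-yes (x Finₚ.<? σ x) a) (𝟙-no (σ x Finₚ.<? σ (σ x)) λ h → c (≡.subst (σ x Fin.<_) (σσ x) h)))
                       (𝟙-no (z Finₚ.≟ x) λ { ≡.refl → b (≡.sym fz) })
  ... | tri≈ a b c = ≡.cong₂ _+ⁿ_ (≡.cong₂ _+ⁿ_ (𝟙-no (x Finₚ.<? σ x) a) (𝟙-no (σ x Finₚ.<? σ (σ x)) λ h → c (≡.subst (σ x Fin.<_) (σσ x) h)))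
                       (𝟙-yes (z Finₚ.≟ x) (≡.sym (fixed x (≡.sym b))))
  ... | tri> a b c = ≡.cong₂ _+ⁿ_ (≡.cong₂ _+ⁿ_ (𝟙-no (x Finₚ.<? σ x) a) (𝟙-yes (σ x Finₚ.<? σ (σ x)) (≡.subst (σ x Fin.<_) (≡.sym (σσ x)) c)))
                       (𝟙-no (z Finₚ.≟ x) λ { ≡.refl → b (≡.sym fz) })
  count : length (allFin q) ≡ A +ⁿ A +ⁿ 1
  count = begin
    length (allFin q) ≡⟨ ≡.sym (∑-one (allFin q)) ⟩
    ∑∀ (λ _ → 1) ≡⟨ ≡.sym (∑-cong (allFin q) split) ⟩
    ∑∀ (λ x → 𝟙 (x Finₚ.<? σ x) +ⁿ 𝟙 (σ x Finₚ.<? σ (σ x)) +ⁿ 𝟙 (z Finₚ.≟ x)) ≡⟨ ≡.trans (∑-+ (allFin q) _ _) (≡.cong₂ _+ⁿ_ (∑-+ (allFin q) _ _) (once z)) ⟩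
    A +ⁿ ∑∀ (λ x → 𝟙 (σ x Finₚ.<? σ (σ x))) +ⁿ 1 ≡⟨ ≡.cong (λ y → A +ⁿ y +ⁿ 1) (∑∀-bij σ σ σσ σσ (λ x → 𝟙 (x Finₚ.<? σ x))) ⟩
    A +ⁿ A +ⁿ 1 ∎
    where open ≡-Reasoning
  parity : ∀ c A → c *ⁿ 2 ≡ A +ⁿ A +ⁿ 1 → ⊥
  parity zero A e = ℕₚ.1+n≢0 (≡.trans (ℕₚ.+-comm 1 (A +ⁿ A)) (≡.sym e))
  parity (suc zero) zero ()
  parity (suc (suc c)) zero ()
  parity (suc c) (suc A) e = parity c A (ℕₚ.+-cancelˡ-≡ 2 _ _ (≡.trans e (lem A)))
    where
    lem : ∀ A → suc A +ⁿ suc A +ⁿ 1 ≡ 2 +ⁿ (A +ⁿ A +ⁿ 1)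
    lem = solve-∀

module Transport {c ℓ} (R : CommutativeRing c ℓ) (isField : IsField R) (q : ℕ) (size : HasSize R q) (even : 2 ∣ q) where
  open CommutativeRing R
  open IsField isField
  open Algebra.Properties.Ring ring using (-‿involutive; -0#≈0#; -‿distribˡ-*)

  f : Fin q → Carrier
  f = proj₁ size

  f-injective : ∀ {i j} → f i ≈ f j → i ≡ j
  f-injective = proj₁ (proj₂ size) _ _

  idx : Carrier → Fin q
  idx x = proj₁ (proj₂ (proj₂ size) x)

  f-idx : ∀ x → f (idx x) ≈ x
  f-idx x = proj₂ (proj₂ (proj₂ size) x)

  f-cong : ∀ {i j} → i ≡ j → f i ≈ f j
  f-cong ≡.refl = refl

  idx-cong : ∀ {x y} → x ≈ y → idx x ≡ idx y
  idx-cong {x} {y} e = f-injective (trans (f-idx x) (trans e (sym (f-idx y))))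

  idx-f : ∀ i → idx (f i) ≡ i
  idx-f i = f-injective (f-idx (f i))

  infixl 6 _⊞_
  infixl 7 _⊠_

  _⊞_ _⊠_ : Fin q → Fin q → Fin q
  a ⊞ b = idx (f a + f b)
  a ⊠ b = idx (f a * f b)

  0ᶠ 1ᶠ : Fin q
  0ᶠ = idx 0#
  1ᶠ = idx 1#

  f-⊞ : ∀ a b → f (a ⊞ b) ≈ f a + f b
  f-⊞ a b = f-idx _

  f-⊠ : ∀ a b → f (a ⊠ b) ≈ f a * f b
  f-⊠ a b = f-idx _

  f≈0 : ∀ {a} → f a ≈ 0# → a ≡ 0ᶠ
  f≈0 e = f-injective (trans e (sym (f-idx 0#)))

  idx≡0 : ∀ {x} → idx x ≡ 0ᶠ → x ≈ 0#
  idx≡0 {x} e = trans (sym (f-idx x)) (trans (f-cong e) (f-idx 0#))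

  -- Otherwise 2 is invertible, so negation is an involution fixing only 0, and q would be odd.
  1+1≈0 : 1# + 1# ≈ 0#
  1+1≈0 with idx (1# + 1#) Finₚ.≟ 0ᶠ
  ... | yes e = idx≡0 e
  ... | no h = ⊥-elim (involution-odd q (λ x → idx (- f x))
      (λ x → f-injective (trans (f-idx _) (trans (-‿cong (f-idx _)) (-‿involutive (f x)))))
      0ᶠ fixed (idx-cong (trans (-‿cong (f-idx 0#)) -0#≈0#)) even)
    where
    two≉0 : ¬ (1# + 1# ≈ 0#)
    two≉0 e = h (idx-cong e)
    fixed : ∀ x → idx (- f x) ≡ x → x ≡ 0ᶠ
    fixed x e with inverse (1# + 1#) two≉0
    ... | y , 2y≈1 = f≈0 (begin
      f x                              ≈⟨ sym (*-identityˡ (f x)) ⟩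
      1# * f x                         ≈⟨ *-congʳ (sym (trans (*-comm y (1# + 1#)) 2y≈1)) ⟩
      y * (1# + 1#) * f x              ≈⟨ *-assoc y (1# + 1#) (f x) ⟩
      y * ((1# + 1#) * f x)            ≈⟨ *-congˡ (trans (distribʳ (f x) 1# 1#) (+-cong (*-identityˡ (f x)) (*-identityˡ (f x)))) ⟩
      y * (f x + f x)                  ≈⟨ *-congˡ (+-congʳ (sym (trans (sym (f-idx (- f x))) (f-cong e)))) ⟩
      y * (- f x + f x)                ≈⟨ *-congˡ (-‿inverseˡ (f x)) ⟩
      y * 0#                           ≈⟨ zeroʳ y ⟩
      0# ∎)
      where open import Relation.Binary.Reasoning.Setoid setoid

  invᶠ : Fin q → Fin q
  invᶠ x with x Finₚ.≟ 0ᶠ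
  ... | yes _ = 0ᶠ
  ... | no h = idx (proj₁ (inverse (f x) (h ∘ f≈0)))

  invᶠ-0 : invᶠ 0ᶠ ≡ 0ᶠ
  invᶠ-0 with 0ᶠ Finₚ.≟ 0ᶠ
  ... | yes _ = ≡.refl
  ... | no h = ⊥-elim (h ≡.refl)

  ⊠-inv : ∀ {x} → x ≢ 0ᶠ → x ⊠ invᶠ x ≡ 1ᶠ
  ⊠-inv {x} x≢0 with x Finₚ.≟ 0ᶠ
  ... | yes e = ⊥-elim (x≢0 e)
  ... | no h = idx-cong (trans (*-congˡ (f-idx _)) (proj₂ (inverse (f x) (h ∘ f≈0))))

  field₂ : Char2Field
  field₂ = record
    { F = Fin q ; finite = finiteFin q ; _+_ = _⊞_ ; _*_ = _⊠_ ; 0# = 0ᶠ ; 1# = 1ᶠ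
    ; isCommutativeSemiring = record
      { isSemiring = record
        { isSemiringWithoutAnnihilatingZero = record
          { +-isCommutativeMonoid = record
            { isMonoid = record
              { isSemigroup = record
                { isMagma = record { isEquivalence = ≡.isEquivalence ; ∙-cong = ≡.cong₂ _⊞_ }
                ; assoc = λ a b c → idx-cong (trans (+-congʳ (f-⊞ a b)) (trans (+-assoc _ _ _) (+-congˡ (sym (f-⊞ b c))))) }
              ; identity = (λ a → ≡.trans (idx-cong (trans (+-congʳ (f-idx 0#)) (+-identityˡ _))) (idx-f a))
                         , (λ a → ≡.trans (idx-cong (trans (+-congˡ (f-idx 0#)) (+-identityʳ _))) (idx-f a)) }
            ; comm = λ a b → idx-cong (+-comm _ _) }
          ; *-cong = ≡.cong₂ _⊠_
          ; *-assoc = λ a b c → idx-cong (trans (*-congʳ (f-⊠ a b)) (trans (*-assoc _ _ _) (*-congˡ (sym (f-⊠ b c)))))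
          ; *-identity = (λ a → ≡.trans (idx-cong (trans (*-congʳ (f-idx 1#)) (*-identityˡ _))) (idx-f a))
                       , (λ a → ≡.trans (idx-cong (trans (*-congˡ (f-idx 1#)) (*-identityʳ _))) (idx-f a))
          ; distrib = (λ a b c → idx-cong (trans (*-congˡ (f-⊞ b c)) (trans (distribˡ _ _ _) (+-cong (sym (f-⊠ a b)) (sym (f-⊠ a c))))))
                    , (λ a b c → idx-cong (trans (*-congʳ (f-⊞ b c)) (trans (distribʳ _ _ _) (+-cong (sym (f-⊠ b a)) (sym (f-⊠ c a)))))) }
        ; zero = (λ a → idx-cong (trans (*-congʳ (f-idx 0#)) (zeroˡ _)))
               , (λ a → idx-cong (trans (*-congˡ (f-idx 0#)) (zeroʳ _))) }
      ; *-comm = λ a b → idx-cong (*-comm _ _) }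
    ; x+x≡0 = λ x → idx-cong (trans (+-cong (sym (*-identityˡ _)) (sym (*-identityˡ _))) (trans (sym (distribʳ (f x) 1# 1#)) (trans (*-congʳ 1+1≈0) (zeroˡ _))))
    ; inv = invᶠ ; inv-0 = invᶠ-0 ; *-inv = ⊠-inv
    ; 0≢1 = λ e → 0≉1 (trans (sym (f-idx 0#)) (trans (f-cong e) (f-idx 1#)))
    }

  open FieldTheory field₂ using () renaming (_≟_ to _≟ᶠ_; 1≢0 to 1ᶠ≢0)
  open PG2 field₂ using (V3; v3; 𝟎; _≟𝟎)
  open Space field₂ using (V4; ⟨_,_⟩; 0⃗; v4≡; _≟V_) renaming (_·_ to _·ᶠ_)
  open Caps field₂
  open Global field₂ using (Complete; contradiction)
  open PG3 R

  comp : Fin 4 → V4 → Fin q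
  comp Fin.zero ⟨ h , _ ⟩ = h
  comp (Fin.suc Fin.zero) ⟨ _ , v3 x _ _ ⟩ = x
  comp (Fin.suc (Fin.suc Fin.zero)) ⟨ _ , v3 _ y _ ⟩ = y
  comp (Fin.suc (Fin.suc (Fin.suc Fin.zero))) ⟨ _ , v3 _ _ z ⟩ = z

  tabulate₄ : (Fin 4 → Fin q) → V4
  tabulate₄ g = ⟨ g Fin.zero , v3 (g (Fin.suc Fin.zero)) (g (Fin.suc (Fin.suc Fin.zero))) (g (Fin.suc (Fin.suc (Fin.suc Fin.zero)))) ⟩

  comp-tabulate : ∀ g i → comp i (tabulate₄ g) ≡ g i
  comp-tabulate g Fin.zero = ≡.refl
  comp-tabulate g (Fin.suc Fin.zero) = ≡.refl
  comp-tabulate g (Fin.suc (Fin.suc Fin.zero)) = ≡.refl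
  comp-tabulate g (Fin.suc (Fin.suc (Fin.suc Fin.zero))) = ≡.refl

  comp-ext : ∀ {U W} → (∀ i → comp i U ≡ comp i W) → U ≡ W
  comp-ext h = v4≡ (h Fin.zero) (h (Fin.suc Fin.zero)) (h (Fin.suc (Fin.suc Fin.zero))) (h (Fin.suc (Fin.suc (Fin.suc Fin.zero))))

  comp-0⃗ : ∀ i → comp i 0⃗ ≡ 0ᶠ
  comp-0⃗ Fin.zero = ≡.refl
  comp-0⃗ (Fin.suc Fin.zero) = ≡.refl
  comp-0⃗ (Fin.suc (Fin.suc Fin.zero)) = ≡.refl
  comp-0⃗ (Fin.suc (Fin.suc (Fin.suc Fin.zero))) = ≡.refl

  comp-comb₂ : ∀ a U b W i → comp i (comb₂ a U b W) ≡ a ⊠ comp i U ⊞ b ⊠ comp i W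
  comp-comb₂ a U b W Fin.zero = ≡.refl
  comp-comb₂ a U b W (Fin.suc Fin.zero) = ≡.refl
  comp-comb₂ a U b W (Fin.suc (Fin.suc Fin.zero)) = ≡.refl
  comp-comb₂ a U b W (Fin.suc (Fin.suc (Fin.suc Fin.zero))) = ≡.refl

  comp-comb₃ : ∀ a U b W d Z i → comp i (comb₃ a U b W d Z) ≡ a ⊠ comp i U ⊞ b ⊠ comp i W ⊞ d ⊠ comp i Z
  comp-comb₃ a U b W d Z Fin.zero = ≡.refl
  comp-comb₃ a U b W d Z (Fin.suc Fin.zero) = ≡.refl
  comp-comb₃ a U b W d Z (Fin.suc (Fin.suc Fin.zero)) = ≡.refl
  comp-comb₃ a U b W d Z (Fin.suc (Fin.suc (Fin.suc Fin.zero))) = ≡.refl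

  Represents : V4 → Vec4 → Set ℓ
  Represents U u = ∀ i → f (comp i U) ≈ u i

  enc : Vec4 → V4
  enc u = tabulate₄ (λ i → idx (u i))

  dec : V4 → Vec4
  dec U i = f (comp i U)

  enc-rep : ∀ u → Represents (enc u) u
  enc-rep u i = trans (f-cong (comp-tabulate (λ j → idx (u j)) i)) (f-idx (u i))

  dec-rep : ∀ U → Represents U (dec U)
  dec-rep U i = refl

  module _ {U W u w} (rU : Represents U u) (rW : Represents W w) where

    f-comb₂ : ∀ {a b A B} → f A ≈ a → f B ≈ b → ∀ i → f (comp i (comb₂ A U B W)) ≈ ((a · u) ⊕ (b · w)) i
    f-comb₂ {A = A} {B} ea eb i = trans (f-cong (comp-comb₂ A U B W i))
      (trans (f-⊞ _ _) (+-cong (trans (f-⊠ _ _) (*-cong ea (rU i))) (trans (f-⊠ _ _) (*-cong eb (rW i)))))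

    comb₂-zero⁻ : ∀ {a b A B} → f A ≈ a → f B ≈ b → comb₂ A U B W ≡ 0⃗ → IsZeroVec ((a · u) ⊕ (b · w))
    comb₂-zero⁻ ea eb e i = trans (sym (f-comb₂ ea eb i)) (trans (f-cong (≡.trans (≡.cong (comp i) e) (comp-0⃗ i))) (f-idx 0#))

    comb₂-zero⁺ : ∀ {a b A B} → f A ≈ a → f B ≈ b → IsZeroVec ((a · u) ⊕ (b · w)) → comb₂ A U B W ≡ 0⃗
    comb₂-zero⁺ ea eb z = comp-ext λ i → ≡.trans (f≈0 (trans (f-comb₂ ea eb i) (z i))) (≡.sym (comp-0⃗ i))

    different⇒LI₂ : ¬ SamePoint u w → LI₂ U W
    different⇒LI₂ h a b e with a ≟ᶠ 0ᶠ | b ≟ᶠ 0ᶠ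
    ... | yes a0 | yes b0 = a0 , b0
    ... | no a≢0 | _ = ⊥-elim (h (f a , f b , (λ z → a≢0 (f≈0 (proj₁ z))) , comb₂-zero⁻ refl refl e))
    ... | yes _ | no b≢0 = ⊥-elim (h (f a , f b , (λ z → b≢0 (f≈0 (proj₂ z))) , comb₂-zero⁻ refl refl e))

    LI₂⇒different : LI₂ U W → ¬ SamePoint u w
    LI₂⇒different li (a , b , nt , z) with li (idx a) (idx b) (comb₂-zero⁺ (f-idx a) (f-idx b) z)
    ... | a0 , b0 = nt (idx≡0 a0 , idx≡0 b0)

  module _ {U W Z u w z} (rU : Represents U u) (rW : Represents W w) (rZ : Represents Z z) where

    f-comb₃ : ∀ {a b d A B D} → f A ≈ a → f B ≈ b → f D ≈ d →
              ∀ i → f (comp i (comb₃ A U B W D Z)) ≈ (((a · u) ⊕ (b · w)) ⊕ (d · z)) i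
    f-comb₃ {A = A} {B} {D} ea eb ed i = trans (f-cong (comp-comb₃ A U B W D Z i)) (trans (f-⊞ _ _) (+-cong
      (trans (f-⊞ _ _) (+-cong (trans (f-⊠ _ _) (*-cong ea (rU i))) (trans (f-⊠ _ _) (*-cong eb (rW i)))))
      (trans (f-⊠ _ _) (*-cong ed (rZ i)))))

    non-collinear⇒LI₃ : ¬ Collinear u w z → LI₃ U W Z
    non-collinear⇒LI₃ h a b d e = decide (v3 a b d ≟𝟎)
      where
      decide : Dec (v3 a b d ≡ 𝟎) → a ≡ 0ᶠ × b ≡ 0ᶠ × d ≡ 0ᶠ
      decide (yes p) = ≡.cong V3.x p , ≡.cong V3.y p , ≡.cong V3.z p
      decide (no nt) = ⊥-elim (h (f a , f b , f d
        , (λ (a0 , b0 , d0) → nt (≡.trans (≡.cong (λ s → v3 s b d) (f≈0 a0)) (≡.cong₂ (v3 0ᶠ) (f≈0 b0) (f≈0 d0))))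
        , λ i → trans (sym (f-comb₃ refl refl refl i)) (trans (f-cong (≡.trans (≡.cong (comp i) e) (comp-0⃗ i))) (f-idx 0#))))

    LI₃⇒non-collinear : LI₃ U W Z → ¬ Collinear u w z
    LI₃⇒non-collinear li (a , b , d , nt , zv) with li (idx a) (idx b) (idx d)
      (comp-ext λ i → ≡.trans (f≈0 (trans (f-comb₃ (f-idx a) (f-idx b) (f-idx d) i) (zv i))) (≡.sym (comp-0⃗ i)))
    ... | a0 , b0 , d0 = nt (idx≡0 a0 , idx≡0 b0 , idx≡0 d0)

  enc-nonzero : ∀ {u} → NonzeroVec u → enc u ≢ 0⃗
  enc-nonzero {u} h e = h λ i → trans (sym (enc-rep u i)) (trans (f-cong (≡.trans (≡.cong (comp i) e) (comp-0⃗ i))) (f-idx 0#))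

  1+-1≈0 : ∀ x → 1# * x + - 1# * x ≈ 0#
  1+-1≈0 x = trans (sym (distribʳ x 1# (- 1#))) (trans (*-congʳ (-‿inverseʳ 1#)) (zeroˡ x))

  enc-distinct : ∀ {u w} → ¬ SamePoint u w → enc u ≢ enc w
  enc-distinct {u} {w} h e = h (1# , - 1# , (λ z → 0≉1 (sym (proj₁ z))) , λ i →
    trans (+-congˡ (*-congˡ (trans (sym (enc-rep w i)) (trans (f-cong (≡.cong (comp i) (≡.sym e))) (enc-rep u i))))) (1+-1≈0 (u i)))

  LI₂-sym : ∀ {U W} → LI₂ U W → LI₂ W U
  LI₂-sym {U} {W} li a b e with li b a (≡.trans (⊕-comm (b ·ᶠ U) (a ·ᶠ W)) e)
  ... | b0 , a0 = a0 , b0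

  cap-unique : ∀ K → PG3.IsCap R K → Unique (map enc K)
  cap-unique [] _ = []
  cap-unique (u ∷ K) (_ , d , _ , cap) = All.tabulate fresh ∷ cap-unique K cap
    where
    fresh : ∀ {W} → W ∈ map enc K → enc u ≢ W
    fresh W∈ with ∈-map⁻ enc W∈
    ... | w , w∈ , ≡.refl = enc-distinct (All.lookup d w∈)

  cap-nonzero : ∀ K → PG3.IsCap R K → ∀ {u} → u ∈ K → enc u ≢ 0⃗
  cap-nonzero (u ∷ K) (n , _) (here ≡.refl) = enc-nonzero n
  cap-nonzero (_ ∷ K) (_ , _ , _ , cap) (there u∈) = cap-nonzero K cap u∈

  -- Distinctness is expressed by codes, where equality is decidable; it rules out that the same
  -- entry of the list is picked twice.
  cap-LI₂ : ∀ K → PG3.IsCap R K → ∀ {u w} → u ∈ K → w ∈ K → enc u ≢ enc w → LI₂ (enc u) (enc w)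
  cap-LI₂ _ _ (here ≡.refl) (here ≡.refl) h = ⊥-elim (h ≡.refl)
  cap-LI₂ (u ∷ K) (_ , d , _) {w = w} (here ≡.refl) (there w∈) _ = different⇒LI₂ (enc-rep u) (enc-rep w) (All.lookup d w∈)
  cap-LI₂ (u ∷ K) (_ , d , _) {u = w} (there w∈) (here ≡.refl) _ = LI₂-sym (different⇒LI₂ (enc-rep u) (enc-rep w) (All.lookup d w∈))
  cap-LI₂ (_ ∷ K) (_ , _ , _ , cap) (there u∈) (there w∈) h = cap-LI₂ K cap u∈ w∈ h

  pairs-LI₃ : ∀ v K → AllPairs (λ u w → ¬ Collinear v u w) K → ∀ {u w} → u ∈ K → w ∈ K → enc u ≢ enc w → LI₃ (enc v) (enc u) (enc w)
  pairs-LI₃ v _ _ (here ≡.refl) (here ≡.refl) h = ⊥-elim (h ≡.refl)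
  pairs-LI₃ v (u ∷ K) (a ∷ _) {w = w} (here ≡.refl) (there w∈) _ = non-collinear⇒LI₃ (enc-rep v) (enc-rep u) (enc-rep w) (All.lookup a w∈)
  pairs-LI₃ v (u ∷ K) (a ∷ _) {u = w} (there w∈) (here ≡.refl) _ = LI₃-swap₂₃ (non-collinear⇒LI₃ (enc-rep v) (enc-rep u) (enc-rep w) (All.lookup a w∈))
  pairs-LI₃ v (_ ∷ K) (_ ∷ p) (there u∈) (there w∈) h = pairs-LI₃ v K p u∈ w∈ h

  cap-LI₃ : ∀ K → PG3.IsCap R K → ∀ {u w z} → u ∈ K → w ∈ K → z ∈ K → enc u ≢ enc w → enc u ≢ enc z → enc w ≢ enc z → LI₃ (enc u) (enc w) (enc z)
  cap-LI₃ _ _ (here ≡.refl) (here ≡.refl) _ h _ _ = ⊥-elim (h ≡.refl)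
  cap-LI₃ _ _ (here ≡.refl) (there _) (here ≡.refl) _ h _ = ⊥-elim (h ≡.refl)
  cap-LI₃ _ _ (there _) (here ≡.refl) (here ≡.refl) _ _ h = ⊥-elim (h ≡.refl)
  cap-LI₃ (v ∷ K) (_ , _ , p , _) (here ≡.refl) (there w∈) (there z∈) _ _ h = pairs-LI₃ v K p w∈ z∈ h
  cap-LI₃ (v ∷ K) (_ , _ , p , _) (there u∈) (here ≡.refl) (there z∈) _ h _ = LI₃-swap₁₂ (pairs-LI₃ v K p u∈ z∈ h)
  cap-LI₃ (v ∷ K) (_ , _ , p , _) (there u∈) (there w∈) (here ≡.refl) h _ _ = LI₃-swap₂₃ (LI₃-swap₁₂ (pairs-LI₃ v K p u∈ w∈ h))
  cap-LI₃ (_ ∷ K) (_ , _ , _ , cap) (there u∈) (there w∈) (there z∈) h₁ h₂ h₃ = cap-LI₃ K cap u∈ w∈ z∈ h₁ h₂ h₃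

  is-cap : ∀ K → PG3.IsCap R K → Caps.IsCap field₂ (map enc K)
  is-cap K cap = record
    { unique = cap-unique K cap
    ; nonzero = λ U∈ → nonzero (∈-map⁻ enc U∈)
    ; li₂ = λ U∈ W∈ → li₂ (∈-map⁻ enc U∈) (∈-map⁻ enc W∈)
    ; li₃ = λ U∈ W∈ Z∈ → li₃ (∈-map⁻ enc U∈) (∈-map⁻ enc W∈) (∈-map⁻ enc Z∈)
    }
    where
    From : V4 → Set c
    From U = ∃ λ u → u ∈ K × U ≡ enc u
    nonzero : ∀ {U} → From U → U ≢ 0⃗
    nonzero (_ , u∈ , ≡.refl) = cap-nonzero K cap u∈
    li₂ : ∀ {U W} → From U → From W → U ≢ W → LI₂ U W
    li₂ (_ , u∈ , ≡.refl) (_ , w∈ , ≡.refl) = cap-LI₂ K cap u∈ w∈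
    li₃ : ∀ {U W Z} → From U → From W → From Z → U ≢ W → U ≢ Z → W ≢ Z → LI₃ U W Z
    li₃ (_ , u∈ , ≡.refl) (_ , w∈ , ≡.refl) (_ , z∈ , ≡.refl) = cap-LI₃ K cap u∈ w∈ z∈

  OnSecant : List Vec4 → V4 → Set c
  OnSecant K N = ∃₂ λ u w → u ∈ K × w ∈ K × enc u ≢ enc w × Dependent N (enc u) (enc w)

  lines-through : ∀ N u K → All (λ w → ¬ Collinear (dec N) u w) K ⊎ (∃ λ w → w ∈ K × Dependent N (enc u) (enc w))
  lines-through N u [] = inj₁ []
  lines-through N u (w ∷ K) with LI₃⊎Dependent N (enc u) (enc w) | lines-through N u K
  ... | inj₂ d | _ = inj₂ (w , here ≡.refl , d)
  ... | inj₁ l | inj₁ a = inj₁ (LI₃⇒non-collinear (dec-rep N) (enc-rep u) (enc-rep w) l ∷ a)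
  ... | inj₁ _ | inj₂ (z , z∈ , d) = inj₂ (z , there z∈ , d)

  pairs⊎secant : ∀ N K → PG3.IsCap R K → AllPairs (λ u w → ¬ Collinear (dec N) u w) K ⊎ OnSecant K N
  pairs⊎secant N [] _ = inj₁ []
  pairs⊎secant N (u ∷ K) (_ , d , _ , cap) with lines-through N u K | pairs⊎secant N K cap
  ... | inj₂ (w , w∈ , dep) | _ = inj₂ (u , w , here ≡.refl , there w∈ , enc-distinct (All.lookup d w∈) , dep)
  ... | inj₁ _ | inj₂ (v , w , v∈ , w∈ , h , dep) = inj₂ (v , w , there v∈ , there w∈ , h , dep)
  ... | inj₁ a | inj₁ p = inj₁ (a ∷ p)

  -- Maximality only says that the cap cannot be extended. As dependence is decidable, the search
  -- for an obstruction to adding N produces an actual secant through N.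
  is-complete : ∀ {v₀} K → v₀ ∈ K → IsCompleteCap K → Complete (map enc K)
  is-complete {v₀} K v₀∈ (cap , maximal) N off = go (pairs⊎secant N K cap)
    where
    -- Here the point `v₀` of the cap is used: the zero vector would be dependent with it.
    N-nonzero : NonzeroVec (dec N)
    N-nonzero z = 1ᶠ≢0 (proj₁ (off (enc v₀) (∈-map⁺ enc v₀∈) 1ᶠ 0ᶠ (comb₂-zero⁺ (dec-rep N) (enc-rep v₀) (f-idx 1#) (f-idx 0#)
      λ i → trans (+-cong (trans (*-congˡ (z i)) (zeroʳ 1#)) (zeroˡ _)) (+-identityˡ 0#))))
    go : AllPairs (λ u w → ¬ Collinear (dec N) u w) K ⊎ OnSecant K N →
         ∃₂ λ x y → ∃₂ λ α β → x ∈ map enc K × y ∈ map enc K × x ≢ y × N ≡ comb₂ α x β y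
    go (inj₁ p) = ⊥-elim (maximal (dec N) (N-nonzero
      , All.tabulate (λ {u} u∈ → LI₂⇒different (dec-rep N) (enc-rep u) (off (enc u) (∈-map⁺ enc u∈))) , p , cap))
    go (inj₂ (u , w , u∈ , w∈ , h , dep)) with on-line (cap-LI₂ K cap u∈ w∈ h) dep
    ... | α , β , e = enc u , enc w , α , β , ∈-map⁺ enc u∈ , ∈-map⁺ enc w∈ , h , e

  small : 2048 ≤ q → ∀ K → IsCompleteCap K → length K ≢ q ℕ.^ 2 +ⁿ 1 →
          (length K +ⁿ 2 *ⁿ q ℕ.∸ (q ℕ.^ 2 +ⁿ 2)) ℕ.^ 2 ℕ.< 9 *ⁿ q
  small q≥ K complete K≢ with (length K +ⁿ 2 *ⁿ q ℕ.∸ (q ℕ.^ 2 +ⁿ 2)) ℕ.^ 2 ℕ.<? 9 *ⁿ q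
  ... | yes h = h
  ... | no h = ⊥-elim (nonempty K complete large K≢)
    where
    s = length K +ⁿ 2 *ⁿ q ℕ.∸ (q ℕ.^ 2 +ⁿ 2)
    q² : q ℕ.^ 2 ≡ q *ⁿ q
    q² = ≡.cong (q *ⁿ_) (ℕₚ.*-identityʳ q)
    -- If s ≤ 135, then s² ≤ 18225 < 18432 = 9 · 2048 ≤ 9q.
    s≥136 : 136 ≤ s
    s≥136 with 136 ℕ.≤? s
    ... | yes g = g
    ... | no g = ⊥-elim (h (ℕₚ.≤-trans (s≤s (ℕₚ.^-monoˡ-≤ 2 (ℕₚ.≤-pred (ℕₚ.≰⇒> g)))) (ℕₚ.≤-trans (ℕₚ.m≤m+n 18226 206) (ℕₚ.*-monoʳ-≤ 9 q≥))))
    large : q *ⁿ q +ⁿ q +ⁿ 2 +ⁿ 136 ≤ length K +ⁿ 3 *ⁿ q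
    large = begin
      q *ⁿ q +ⁿ q +ⁿ 2 +ⁿ 136 ≡⟨ lem₁ (q *ⁿ q) q 136 ⟩
      136 +ⁿ (q *ⁿ q +ⁿ 2) +ⁿ q ≤⟨ ℕₚ.+-monoˡ-≤ q (ℕₚ.+-monoˡ-≤ (q *ⁿ q +ⁿ 2) s≥136) ⟩
      s +ⁿ (q *ⁿ q +ⁿ 2) +ⁿ q ≡⟨ ≡.cong (λ z → s +ⁿ (z +ⁿ 2) +ⁿ q) (≡.sym q²) ⟩
      -- Since s is positive, the truncated subtraction in it was exact.
      s +ⁿ (q ℕ.^ 2 +ⁿ 2) +ⁿ q ≡⟨ ≡.cong (_+ⁿ q) (ℕₚ.m∸n+n≡m {length K +ⁿ 2 *ⁿ q} {q ℕ.^ 2 +ⁿ 2} (ℕₚ.<⇒≤ (ℕₚ.m∸n≢0⇒n<m λ e → ℕₚ.<⇒≱ (s≤s (z≤n {135})) (≡.subst (136 ≤_) e s≥136)))) ⟩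
      length K +ⁿ 2 *ⁿ q +ⁿ q ≡⟨ lem₂ (length K) q ⟩
      length K +ⁿ 3 *ⁿ q ∎
      where
      open ℕₚ.≤-Reasoning
      lem₁ : ∀ a q c → a +ⁿ q +ⁿ 2 +ⁿ c ≡ c +ⁿ (a +ⁿ 2) +ⁿ q
      lem₁ = solve-∀
      lem₂ : ∀ k q → k +ⁿ 2 *ⁿ q +ⁿ q ≡ k +ⁿ 3 *ⁿ q
      lem₂ = solve-∀
    q≡ : length (allFin q) ≡ q
    q≡ = length-tabulate (λ (x : Fin q) → x)
    nonempty : ∀ K → IsCompleteCap K → q *ⁿ q +ⁿ q +ⁿ 2 +ⁿ 136 ≤ length K +ⁿ 3 *ⁿ q → length K ≢ q ℕ.^ 2 +ⁿ 1 → ⊥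
    -- An empty list would need q² < 3q; a first point is required to start the double count.
    nonempty [] _ large _ = ℕₚ.<⇒≱ (ℕₚ.≤-trans (s≤s (ℕₚ.*-monoˡ-≤ q (ℕₚ.≤-trans (ℕₚ.m≤m+n 3 2045) q≥)))
      (ℕₚ.≤-trans (ℕₚ.m≤m+n _ (q +ⁿ 2 +ⁿ 135)) (ℕₚ.≤-reflexive (lem (q *ⁿ q) q)))) large
      where
      lem : ∀ a q → suc a +ⁿ (q +ⁿ 2 +ⁿ 135) ≡ a +ⁿ q +ⁿ 2 +ⁿ 136
      lem = solve-∀
    nonempty K@(v ∷ _) complete large K≢ = contradiction (is-cap K (proj₁ complete)) (is-complete K (here ≡.refl) complete)
      (≡.subst (2048 ≤_) (≡.sym q≡) q≥)
      (≡.subst₂ (λ k q → q *ⁿ q +ⁿ q +ⁿ 2 +ⁿ 136 ≤ k +ⁿ 3 *ⁿ q) (≡.sym (length-map enc K)) (≡.sym q≡) large)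
      (λ e → K≢ (≡.trans (≡.sym (length-map enc K)) (≡.trans e (≡.cong (_+ⁿ 1) (≡.trans (≡.cong₂ _*ⁿ_ q≡ q≡) (≡.sym q²))))))
      (here ≡.refl)

open import Data.Nat using (_+_; _*_; _∸_; _^_; _<_)

theorem4p1 : ∀ {c ℓ} (F : CommutativeRing c ℓ) → IsField F →
    (q : ℕ) → HasSize F q → 2 ∣ q → 2048 ≤ q →
    (K : List (PG3.Vec4 F)) → PG3.IsCompleteCap F K →
    length K ≢ q ^ 2 + 1 →
    (length K + 2 * q ∸ (q ^ 2 + 2)) ^ 2 < 9 * q
theorem4p1 F isField q size even q≥2048 K = Transport.small F isField q size even q≥2048 K
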